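{- Call a partition of an even positive integer $n$ graphical if its parts form the degree sequence of a simple graph (no loops or multiple edges). Then the probability that a uniformly random partition of an even integer $n$ is graphical is $$O\left(\frac{1}{\ln^{1/2}n}\right)\qquad (n\to\infty).$$ -}

module Defs where

open import Data.Nat using (ℕ; _≤_; _≥_; _*_)
open import Data.Nat.Logarithm using (⌊log₂_⌋)
open import Data.Bool using (Bool; true; false; if_then_else_)
open import Data.Fin using (Fin)
open import Data.List using (List; length; map; allFin; lookup)
open import Data.Nat.ListAction using (sum)
open import Data.List.Relation.Unary.All using (All)
open import Data.List.Relation.Unary.Linked using (Linked)
open import Data.Product using (Σ; _×_)
open import Relation.Binary.PropositionalEquality using (_≡_)

-- A simple graph on the vertex set Fin k: symmetric, loopless adjacency relation
-- (no multiple edges since adjacency is Boolean).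
record SimpleGraph (k : ℕ) : Set where
  field
    adj   : Fin k → Fin k → Bool
    sym   : ∀ i j → adj i j ≡ adj j i
    loopless : ∀ i → adj i i ≡ false

open SimpleGraph public

degree : ∀ {k} → SimpleGraph k → Fin k → ℕ
degree {k} G i = sum (map (λ j → if adj G i j then 1 else 0) (allFin k))

IsPartition : ℕ → List ℕ → Set
IsPartition n λs = All (λ x → 1 ≤ x) λs × Linked _≥_ λs × sum λs ≡ n

IsGraphical : List ℕ → Set
IsGraphical λs = Σ (SimpleGraph (length λs)) λ G → ∀ i → degree G i ≡ lookup λs i

GraphicalPartition : ℕ → List ℕ → Set
GraphicalPartition n λs = IsPartition n λs × IsGraphical λs

Even : ℕ → Set
Even n = Σ ℕ λ k → n ≡ 2 * k

{-# OPTIONS --safe #-}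
module Submission where

-- Cut a partition along its Durfee square of side d: let A_j be the number of columns of height j to the
-- right of the square and B_j the number of rows of length j below it, so n = d² + Σ j (A_j + B_j).  Double
-- counting edges shows that a graphical partition has S_k = Σ_j min(j,k) (A_j - B_j) ≤ 0 for every k ≤ d.
-- Given d and all c_j = A_j + B_j, the A_j are independent and uniform on {0, ..., c_j}.  The Euler identity
-- for the generating function ∏_{j ≤ d} (1 - q^j)^(-2) shows that for most partitions j c_j is √(n - d²) up to
-- powers of log n.  Hence, at scales k whose ratios are powers of log n, S_k is dominated by the terms with j
-- near k; these block sums are independent, and a fourth moment bound makes each of them exceed the remainder
-- with probability at least 1/432.  Using a large constant times log log n such scales, all the S_k are ≤ 0
-- with probability O(1/√log n).

open import Data.Bool using (if_then_else_; true; false)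
open import Data.Empty using (⊥-elim)
open import Data.Fin as Fin using (Fin; toℕ)
open import Data.Integer as ℤ using (ℤ; -[1+_]; ∣_∣; _⊖_)
import Data.Integer.Properties as ℤ
import Data.Integer.Tactic.RingSolver as ℤ-Ring
open import Data.List.Base using (List; []; _∷_; _++_; map; concatMap; length; upTo; replicate; take; drop; allFin; lookup; filter)
open import Data.List.Membership.Propositional using (_∈_; find; lose)
open import Data.List.Membership.Propositional.Properties using (∈-upTo⁻; ∈-map⁻; ∈-concatMap⁻; ∈-upTo⁺; ∈-map⁺; ∈-concatMap⁺; ∈-∃++; ∈-++⁻; ∈-++⁺ˡ; ∈-++⁺ʳ; ∈-filter⁺; ∈-filter⁻)
open import Data.List.Properties using (upTo-∷ʳ; map-upTo; length-map; length-upTo; map-++; length-replicate; take++drop≡id; length-take; length-++; map-tabulate; ++-cancelʳ; ∷-injective)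
open import Data.List.Relation.Binary.Pointwise using (Pointwise; []; _∷_; Pointwise-length)
import Data.List.Relation.Unary.All as All
open import Data.List.Relation.Unary.All using (All; []; _∷_)
import Data.List.Relation.Unary.All.Properties as All
open import Data.List.Relation.Unary.AllPairs using (AllPairs; []; _∷_)
import Data.List.Relation.Unary.AllPairs.Properties as AllPairs
open import Data.List.Relation.Unary.Any using (here; there)
import Data.List.Relation.Unary.Linked.Properties as Linked
open import Data.List.Relation.Unary.Unique.Propositional using (Unique)
import Data.List.Relation.Unary.Unique.Propositional.Properties as Unique
open import Data.Nat
open import Data.Nat.DivMod using (_/_; m/n*n≤m; m≡m%n+[m/n]*n; m%n<n; m/n≤m)
open import Data.Nat.ListAction using (sum)
open import Data.Nat.ListAction.Properties using (sum-++)
open import Data.Nat.Logarithm using (⌊log₂_⌋; ⌊log₂⌋-mono-≤; ⌊log₂[2^n]⌋≡n)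
open import Data.Nat.Properties
open import Data.Nat.Tactic.RingSolver using (solve-∀)
open import Data.Product using (Σ; _×_; _,_; proj₁; proj₂; ∃; uncurry)
open import Data.Sum using (_⊎_; inj₁; inj₂)
open import Defs hiding (sym)
open import Function using (_∘_; id)
open import Relation.Binary.PropositionalEquality
open import Relation.Nullary using (¬_; Dec; yes; no)
open import Relation.Nullary.Decidable using (_×-dec_)

-- The sums S_k are strongly correlated, so they are not treated as such: S_k ≤ 0 forces either the
-- block sum at scale k to be small or the remainder to be large in absolute value, and only the
-- blocks need independence. Let 4^v ≤ log₂ n < 4^(v+1). The target is of order 2^(-v), so every
-- exceptional event must be pushed below 2^(-v). For the blocks, (431/432)^T ≤ 2^(-v) holds with T
-- = 432 v scales; for the T remainders, Chebyshev needs ratios 2^(O(v)) between scales. All scales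
-- together span 2^(O(v²)), which is eventually smaller than any power of n, so they fit below the
-- Durfee size. No asymptotic formula for the number of partitions enters: counts are compared with
-- `G d s` for the same d and s = n - d², except for the few codes with d or s too small, which are
-- compared with the total. A bound p ≤ c · 2^(-v) on a probability is written 2^v · count ≤ c ·
-- total.

private variable
  A A′ : Set

-- Finite sums

∑ : List A → (A → ℕ) → ℕ
∑ []       f = 0
∑ (x ∷ xs) f = f x + ∑ xs f

∑-cong : ∀ (xs : List A) {f g} → (∀ x → f x ≡ g x) → ∑ xs f ≡ ∑ xs g
∑-cong []       e = refl
∑-cong (x ∷ xs) e = cong₂ _+_ (e x) (∑-cong xs e)

∑-cong∈ : ∀ (xs : List A) {f g} → (∀ {x} → x ∈ xs → f x ≡ g x) → ∑ xs f ≡ ∑ xs g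
∑-cong∈ []       e = refl
∑-cong∈ (x ∷ xs) e = cong₂ _+_ (e (here refl)) (∑-cong∈ xs (e ∘ there))

∑-mono∈ : ∀ (xs : List A) {f g} → (∀ {x} → x ∈ xs → f x ≤ g x) → ∑ xs f ≤ ∑ xs g
∑-mono∈ []       e = z≤n
∑-mono∈ (x ∷ xs) e = +-mono-≤ (e (here refl)) (∑-mono∈ xs (e ∘ there))

∑-mono : ∀ (xs : List A) {f g} → (∀ x → f x ≤ g x) → ∑ xs f ≤ ∑ xs g
∑-mono xs e = ∑-mono∈ xs (λ {x} _ → e x)

∑-+ : ∀ (xs : List A) f g → ∑ xs (λ x → f x + g x) ≡ ∑ xs f + ∑ xs g
∑-+ []       f g = refl
∑-+ (x ∷ xs) f g rewrite ∑-+ xs f g = lem (f x) (g x) (∑ xs f) (∑ xs g)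
  where
  lem : ∀ a b c d → a + b + (c + d) ≡ a + c + (b + d)
  lem = solve-∀

∑-*ˡ : ∀ (xs : List A) k f → ∑ xs (λ x → k * f x) ≡ k * ∑ xs f
∑-*ˡ []       k f = sym (*-zeroʳ k)
∑-*ˡ (x ∷ xs) k f rewrite ∑-*ˡ xs k f = sym (*-distribˡ-+ k (f x) (∑ xs f))

∑-*ʳ : ∀ (xs : List A) k f → ∑ xs (λ x → f x * k) ≡ ∑ xs f * k
∑-*ʳ xs k f = trans (∑-cong xs (λ x → *-comm (f x) k)) (trans (∑-*ˡ xs k f) (*-comm k (∑ xs f)))

∑-const : ∀ (xs : List A) k → ∑ xs (λ _ → k) ≡ length xs * k
∑-const []       k = refl
∑-const (x ∷ xs) k = cong (k +_) (∑-const xs k)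

∑-zero : ∀ (xs : List A) {f} → (∀ {x} → x ∈ xs → f x ≡ 0) → ∑ xs f ≡ 0
∑-zero xs e = trans (∑-cong∈ xs e) (trans (∑-const xs 0) (*-zeroʳ (length xs)))

∑-swap : ∀ (xs : List A) (ys : List A′) (f : A → A′ → ℕ) →
  ∑ xs (λ x → ∑ ys (f x)) ≡ ∑ ys (λ y → ∑ xs (λ x → f x y))
∑-swap []       ys f = sym (∑-zero ys (λ _ → refl))
∑-swap (x ∷ xs) ys f = trans (cong (∑ ys (f x) +_) (∑-swap xs ys f)) (sym (∑-+ ys (f x) _))

∑-++ : ∀ (xs ys : List A) f → ∑ (xs ++ ys) f ≡ ∑ xs f + ∑ ys f
∑-++ []       ys f = refl
∑-++ (x ∷ xs) ys f = trans (cong (f x +_) (∑-++ xs ys f)) (sym (+-assoc (f x) _ _))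

∑-map : ∀ (h : A → A′) xs f → ∑ (map h xs) f ≡ ∑ xs (f ∘ h)
∑-map h []       f = refl
∑-map h (x ∷ xs) f = cong (f (h x) +_) (∑-map h xs f)

∑-concatMap : ∀ (h : A → List A′) xs f → ∑ (concatMap h xs) f ≡ ∑ xs (λ x → ∑ (h x) f)
∑-concatMap h []       f = refl
∑-concatMap h (x ∷ xs) f = trans (∑-++ (h x) _ f) (cong (∑ (h x) f +_) (∑-concatMap h xs f))

∑-∈ : ∀ {xs : List A} {x} f → x ∈ xs → f x ≤ ∑ xs f
∑-∈ f (here refl) = m≤m+n _ _
∑-∈ f (there i)   = ≤-trans (∑-∈ f i) (m≤n+m _ _)

∑-length : ∀ (xs : List A) → ∑ xs (λ _ → 1) ≡ length xs
∑-length xs = trans (∑-const xs 1) (*-identityʳ _)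

∑-bound : ∀ (xs : List A) {f} k → (∀ {x} → x ∈ xs → f x ≤ k) → ∑ xs f ≤ length xs * k
∑-bound xs k e = ≤-trans (∑-mono∈ xs e) (≤-reflexive (∑-const xs k))

∑< : ℕ → (ℕ → ℕ) → ℕ
∑< n f = ∑ (upTo n) f

∑<-last : ∀ n f → ∑< (suc n) f ≡ ∑< n f + f n
∑<-last n f = begin
  ∑ (upTo (suc n)) f         ≡⟨ cong (λ l → ∑ l f) (sym (upTo-∷ʳ n)) ⟩
  ∑ (upTo n ++ n ∷ []) f     ≡⟨ ∑-++ (upTo n) (n ∷ []) f ⟩
  ∑< n f + (f n + 0)         ≡⟨ cong (∑< n f +_) (+-identityʳ (f n)) ⟩
  ∑< n f + f n               ∎
  where open ≡-Reasoning

∑<-front : ∀ n f → ∑< (suc n) f ≡ f 0 + ∑< n (f ∘ suc)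
∑<-front n f = cong (f 0 +_) (trans (cong (λ l → ∑ l f) (sym (map-upTo suc n))) (∑-map suc (upTo n) f))

∑<-cong : ∀ n {f g} → (∀ i → i < n → f i ≡ g i) → ∑< n f ≡ ∑< n g
∑<-cong n e = ∑-cong∈ (upTo n) (λ i∈ → e _ (∈-upTo⁻ i∈))

∑<-mono : ∀ n {f g} → (∀ i → i < n → f i ≤ g i) → ∑< n f ≤ ∑< n g
∑<-mono n e = ∑-mono∈ (upTo n) (λ i∈ → e _ (∈-upTo⁻ i∈))

∑<-split : ∀ m n f → ∑< (m + n) f ≡ ∑< m f + ∑< n (λ i → f (m + i))
∑<-split zero    n f = refl
∑<-split (suc m) n f = begin
  ∑< (suc (m + n)) f                                        ≡⟨ ∑<-front (m + n) f ⟩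
  f 0 + ∑< (m + n) (f ∘ suc)                                ≡⟨ cong (f 0 +_) (∑<-split m n (f ∘ suc)) ⟩
  f 0 + (∑< m (f ∘ suc) + ∑< n (λ i → f (suc m + i)))       ≡⟨ sym (+-assoc (f 0) _ _) ⟩
  f 0 + ∑< m (f ∘ suc) + ∑< n (λ i → f (suc m + i))         ≡⟨ cong (_+ ∑< n (λ i → f (suc m + i))) (sym (∑<-front m f)) ⟩
  ∑< (suc m) f + ∑< n (λ i → f (suc m + i))                 ∎
  where open ≡-Reasoning

∑<-const : ∀ n k → ∑< n (λ _ → k) ≡ n * k
∑<-const zero    k = refl
∑<-const (suc n) k = trans (∑<-front n (λ _ → k)) (cong (k +_) (∑<-const n k))

∑<-zero : ∀ n {f} → (∀ i → i < n → f i ≡ 0) → ∑< n f ≡ 0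
∑<-zero n e = ∑-zero (upTo n) (λ i∈ → e _ (∈-upTo⁻ i∈))

∑<-monoˡ : ∀ {m n} f → m ≤ n → ∑< m f ≤ ∑< n f
∑<-monoˡ {m} {n} f m≤n = begin
  ∑< m f              ≤⟨ m≤m+n _ _ ⟩
  ∑< m f + ∑< (n ∸ m) (λ i → f (m + i)) ≡⟨ sym (∑<-split m (n ∸ m) f) ⟩
  ∑< (m + (n ∸ m)) f  ≡⟨ cong (λ k → ∑< k f) (m+[n∸m]≡n m≤n) ⟩
  ∑< n f              ∎
  where open ≤-Reasoning

𝟙 : {P : Set} → Dec P → ℕ
𝟙 (yes _) = 1
𝟙 (no  _) = 0

𝟙-yes : ∀ {P : Set} (d : Dec P) → P → 𝟙 d ≡ 1
𝟙-yes (yes _) p = refl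
𝟙-yes (no ¬p) p = ⊥-elim (¬p p)

𝟙-no : ∀ {P : Set} (d : Dec P) → ¬ P → 𝟙 d ≡ 0
𝟙-no (yes p) ¬p = ⊥-elim (¬p p)
𝟙-no (no _)  ¬p = refl

𝟙≤1 : ∀ {P : Set} (d : Dec P) → 𝟙 d ≤ 1
𝟙≤1 (yes _) = ≤-refl
𝟙≤1 (no _)  = z≤n

Vanish : ℕ → (ℕ → ℕ) → Set
Vanish n f = ∀ i → n ≤ i → f i ≡ 0

∑<-vanish : ∀ n m {f} → Vanish n f → ∑< (n + m) f ≡ ∑< n f
∑<-vanish n m {f} v = begin
  ∑< (n + m) f                        ≡⟨ ∑<-split n m f ⟩
  ∑< n f + ∑< m (λ i → f (n + i))     ≡⟨ cong (∑< n f +_) (∑<-zero m (λ i _ → v (n + i) (m≤m+n n i))) ⟩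
  ∑< n f + 0                          ≡⟨ +-identityʳ _ ⟩
  ∑< n f                              ∎
  where open ≡-Reasoning

∑<-reindex : ∀ n i {f} → Vanish n f → ∑< n (λ k → f (i + k)) ≡ ∑< n (λ m → 𝟙 (i ≤? m) * f m)
∑<-reindex n i {f} v = begin
  ∑< n (λ k → f (i + k))            ≡⟨ ∑<-cong n (λ k _ → sym (trans (cong (_* f (i + k)) (𝟙-yes (i ≤? i + k) (m≤m+n i k))) (*-identityˡ _))) ⟩
  ∑< n (λ k → h (i + k))            ≡⟨ cong (_+ ∑< n (λ k → h (i + k))) (sym (∑<-zero i (λ m m<i → cong (_* f m) (𝟙-no (i ≤? m) (<⇒≱ m<i))))) ⟩
  ∑< i h + ∑< n (λ k → h (i + k))   ≡⟨ sym (∑<-split i n h) ⟩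
  ∑< (i + n) h                      ≡⟨ cong (λ k → ∑< k h) (+-comm i n) ⟩
  ∑< (n + i) h                      ≡⟨ ∑<-vanish n i (λ m n≤m → trans (cong (𝟙 (i ≤? m) *_) (v m n≤m)) (*-zeroʳ (𝟙 (i ≤? m)))) ⟩
  ∑< n h                            ∎
  where
  open ≡-Reasoning
  h : ℕ → ℕ
  h m = 𝟙 (i ≤? m) * f m

count≤ : ∀ n m → m < n → ∑< n (λ i → 𝟙 (i ≤? m)) ≡ suc m
count≤ n m m<n = begin
  ∑< n h                     ≡⟨ cong (λ k → ∑< k h) (sym (m+[n∸m]≡n m<n)) ⟩
  ∑< (suc m + (n ∸ suc m)) h ≡⟨ ∑<-vanish (suc m) (n ∸ suc m) (λ i m<i → 𝟙-no (i ≤? m) (<⇒≱ m<i)) ⟩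
  ∑< (suc m) h               ≡⟨ ∑<-cong (suc m) (λ i i≤m → 𝟙-yes (i ≤? m) (≤-pred i≤m)) ⟩
  ∑< (suc m) (λ _ → 1)       ≡⟨ trans (∑<-const (suc m) 1) (*-identityʳ _) ⟩
  suc m                      ∎
  where
  open ≡-Reasoning
  h : ℕ → ℕ
  h i = 𝟙 (i ≤? m)

-- There are m + 1 pairs (i, k) with i + k = m. This multiplicity identifies two equal factors 1/(1
-- - q^t) with the number of ways of writing m as a + b.
∑<-convolve : ∀ n {f} → Vanish n f → ∑< n (λ i → ∑< n (λ k → f (i + k))) ≡ ∑< n (λ m → suc m * f m)
∑<-convolve n {f} v = begin
  ∑< n (λ i → ∑< n (λ k → f (i + k)))          ≡⟨ ∑<-cong n (λ i _ → ∑<-reindex n i v) ⟩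
  ∑< n (λ i → ∑< n (λ m → 𝟙 (i ≤? m) * f m))   ≡⟨ ∑-swap (upTo n) (upTo n) _ ⟩
  ∑< n (λ m → ∑< n (λ i → 𝟙 (i ≤? m) * f m))   ≡⟨ ∑<-cong n (λ m m<n → trans (∑-*ʳ (upTo n) (f m) _) (cong (_* f m) (count≤ n m m<n))) ⟩
  ∑< n (λ m → suc m * f m)                     ∎
  where open ≡-Reasoning

∑<-reverse : ∀ n f → ∑< (suc n) f ≡ ∑< (suc n) (λ i → f (n ∸ i))
∑<-reverse zero    f = refl
∑<-reverse (suc n) f = begin
  ∑< (suc (suc n)) f                        ≡⟨ ∑<-last (suc n) f ⟩
  ∑< (suc n) f + f (suc n)                  ≡⟨ +-comm _ (f (suc n)) ⟩
  f (suc n) + ∑< (suc n) f                  ≡⟨ cong (f (suc n) +_) (∑<-reverse n f) ⟩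
  f (suc n) + ∑< (suc n) (λ i → f (n ∸ i))  ≡⟨ sym (∑<-front (suc n) (λ i → f (suc n ∸ i))) ⟩
  ∑< (suc (suc n)) (λ i → f (suc n ∸ i))    ∎
  where open ≡-Reasoning

-- Sequences, written as coefficients of power series: `shift t` is multiplication by q^t
-- and `geo t` is multiplication by 1/(1 - q^t), exact in degrees below the truncation B.

Seq : Set
Seq = ℕ → ℕ

shift : ℕ → Seq → Seq
shift zero    a s       = a s
shift (suc t) a zero    = 0
shift (suc t) a (suc s) = shift t a s

shift-+ : ∀ t u a s → shift (t + u) a s ≡ shift t (shift u a) s
shift-+ zero    u a s       = refl
shift-+ (suc t) u a zero    = refl
shift-+ (suc t) u a (suc s) = shift-+ t u a s

shift-comm : ∀ t u a s → shift t (shift u a) s ≡ shift u (shift t a) s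
shift-comm t u a s = trans (sym (shift-+ t u a s)) (trans (cong (λ x → shift x a s) (+-comm t u)) (shift-+ u t a s))

shift-> : ∀ {t s} a → s < t → shift t a s ≡ 0
shift-> {suc t} {zero}  a _         = refl
shift-> {suc t} {suc s} a (s≤s s<t) = shift-> a s<t

shift-plus : ∀ t a s → shift t a (t + s) ≡ a s
shift-plus zero    a s = refl
shift-plus (suc t) a s = shift-plus t a s

shift-≤ : ∀ {t s} a → t ≤ s → shift t a s ≡ a (s ∸ t)
shift-≤ {t} {s} a t≤s = trans (cong (shift t a) (sym (m+[n∸m]≡n t≤s))) (shift-plus t a (s ∸ t))

shift-cong : ∀ t {a b} s → (∀ s' → s' ≤ s → a s' ≡ b s') → shift t a s ≡ shift t b s
shift-cong zero    s       e = e s ≤-refl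
shift-cong (suc t) zero    e = refl
shift-cong (suc t) (suc s) e = shift-cong t s (λ s' s'≤s → e s' (m≤n⇒m≤1+n s'≤s))

shift-mono : ∀ t {a b} s → (∀ s' → s' ≤ s → a s' ≤ b s') → shift t a s ≤ shift t b s
shift-mono zero    s       e = e s ≤-refl
shift-mono (suc t) zero    e = z≤n
shift-mono (suc t) (suc s) e = shift-mono t s (λ s' s'≤s → e s' (m≤n⇒m≤1+n s'≤s))

shift-∑ : ∀ t (xs : List A) (f : A → Seq) s → shift t (λ s' → ∑ xs (λ x → f x s')) s ≡ ∑ xs (λ x → shift t (f x) s)
shift-∑ zero    xs f s       = refl
shift-∑ (suc t) xs f zero    = sym (∑-zero xs (λ _ → refl))
shift-∑ (suc t) xs f (suc s) = shift-∑ t xs f s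

shift-* : ∀ t k a s → shift t (λ s' → k * a s') s ≡ k * shift t a s
shift-* zero    k a s       = refl
shift-* (suc t) k a zero    = sym (*-zeroʳ k)
shift-* (suc t) k a (suc s) = shift-* t k a s

shift-bound : ∀ t {a k} s → (∀ s' → s' ≤ s → a s' ≤ k) → shift t a s ≤ k
shift-bound zero    s       e = e s ≤-refl
shift-bound (suc t) zero    e = z≤n
shift-bound (suc t) (suc s) e = shift-bound t s (λ s' s'≤s → e s' (m≤n⇒m≤1+n s'≤s))

-- The Euler operator q d/dq is a derivation.
euler-shift : ∀ x a s → s * shift x a s ≡ shift x (λ s' → s' * a s') s + x * shift x a s
euler-shift zero    a s       = sym (+-identityʳ _)
euler-shift (suc x) a zero    = sym (*-zeroʳ x)
euler-shift (suc x) a (suc s) = begin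
  t + s * t             ≡⟨ cong (t +_) (euler-shift x a s) ⟩
  t + (b + x * t)       ≡⟨ lem t b (x * t) ⟩
  b + (t + x * t)       ∎
  where
  open ≡-Reasoning
  t = shift x a s
  b = shift x (λ s' → s' * a s') s
  lem : ∀ p q r → p + (q + r) ≡ q + (p + r)
  lem = solve-∀

δ₀ : Seq
δ₀ zero    = 1
δ₀ (suc _) = 0

module Truncated (B : ℕ) where

  -- `geo⁺ t` is multiplication by q^t/(1 - q^t): the same geometric series without its constant
  -- term.
  geo geo⁺ : ℕ → Seq → Seq
  geo  t a s = ∑< B (λ i → shift (t * i) a s)
  geo⁺ t a s = ∑< B (λ i → shift (t * suc i) a s)

  term-vanish : ∀ {t s} a → 1 ≤ t → s < B → Vanish B (λ i → shift (t * i) a s)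
  term-vanish {t} {s} a 1≤t s<B i B≤i = shift-> a (<-≤-trans s<B (≤-trans B≤i (≤-trans (≤-reflexive (sym (*-identityˡ i))) (*-monoˡ-≤ i 1≤t))))

  shift-geo : ∀ t a s → shift t (geo t a) s ≡ geo⁺ t a s
  shift-geo t a s = trans (shift-∑ t (upTo B) _ s)
    (∑-cong (upTo B) (λ i → trans (sym (shift-+ t (t * i) a s)) (cong (λ x → shift x a s) (sym (*-suc t i)))))

  geo-unfold : ∀ {t s} a → 1 ≤ t → s < B → geo t a s ≡ a s + shift t (geo t a) s
  geo-unfold {t} {s} a 1≤t s<B = begin
    ∑< B f                       ≡⟨ sym (+-identityʳ _) ⟩
    ∑< B f + 0                   ≡⟨ cong (∑< B f +_) (sym (term-vanish a 1≤t s<B B ≤-refl)) ⟩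
    ∑< B f + f B                 ≡⟨ sym (∑<-last B f) ⟩
    ∑< (suc B) f                 ≡⟨ ∑<-front B f ⟩
    f 0 + geo⁺ t a s             ≡⟨ cong₂ _+_ (cong (λ x → shift x a s) (*-zeroʳ t)) (sym (shift-geo t a s)) ⟩
    a s + shift t (geo t a) s    ∎
    where
    open ≡-Reasoning
    f : ℕ → ℕ
    f i = shift (t * i) a s

  geo-cong : ∀ t {a b} s → (∀ s' → s' ≤ s → a s' ≡ b s') → geo t a s ≡ geo t b s
  geo-cong t s e = ∑-cong (upTo B) (λ i → shift-cong (t * i) s e)

  geo-bound : ∀ t {a k} s → (∀ s' → s' ≤ s → a s' ≤ k) → geo t a s ≤ B * k
  geo-bound t {a} {k} s e = ≤-trans (∑<-mono B (λ i _ → shift-bound (t * i) s e)) (≤-reflexive (∑<-const B k))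

  geo-geo : ∀ {t s} a → 1 ≤ t → s < B → geo t (geo t a) s ≡ ∑< B (λ m → suc m * shift (t * m) a s)
  geo-geo {t} {s} a 1≤t s<B = trans
    (∑-cong (upTo B) (λ i → trans (shift-∑ (t * i) (upTo B) _ s)
      (∑-cong (upTo B) (λ k → trans (sym (shift-+ (t * i) (t * k) a s)) (cong (λ x → shift x a s) (sym (*-distribˡ-+ t i k)))))))
    (∑<-convolve B (term-vanish a 1≤t s<B))

  geo⁺-geo : ∀ {t s} a → 1 ≤ t → s < B → geo⁺ t (geo t a) s ≡ ∑< B (λ m → m * shift (t * m) a s)
  geo⁺-geo {t} {s} a 1≤t s<B = begin
    geo⁺ t (geo t a) s
      ≡⟨ ∑-cong (upTo B) (λ i → trans (shift-∑ (t * suc i) (upTo B) _ s)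
           (∑-cong (upTo B) (λ k → trans (sym (shift-+ (t * suc i) (t * k) a s)) (cong (λ x → shift x a s) (sym (*-distribˡ-+ t (suc i) k)))))) ⟩
    ∑< B (λ i → ∑< B (λ k → f (suc (i + k))))
      ≡⟨ ∑<-convolve B {f ∘ suc} (λ i B≤i → term-vanish a 1≤t s<B (suc i) (m≤n⇒m≤1+n B≤i)) ⟩
    ∑< B (λ m → suc m * f (suc m))
      ≡⟨ sym (∑<-front B (λ m → m * f m)) ⟩
    ∑< (suc B) (λ m → m * f m)
      ≡⟨ ∑<-last B (λ m → m * f m) ⟩
    ∑< B (λ m → m * f m) + B * f B
      ≡⟨ cong (∑< B (λ m → m * f m) +_) (trans (cong (B *_) (term-vanish a 1≤t s<B B ≤-refl)) (*-zeroʳ B)) ⟩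
    ∑< B (λ m → m * f m) + 0
      ≡⟨ +-identityʳ _ ⟩
    ∑< B (λ m → m * f m) ∎
    where
    open ≡-Reasoning
    f : ℕ → ℕ
    f i = shift (t * i) a s

  -- Leibniz rule for q d/dq. The factor 1/(1 - q^t) has logarithmic derivative t q^t/(1 - q^t),
  -- which is why `geo⁺` is applied to the full series `geo t a`.
  euler-geo : ∀ {t s} a → 1 ≤ t → s < B → s * geo t a s ≡ t * geo⁺ t (geo t a) s + geo t (λ s' → s' * a s') s
  euler-geo {t} {s} a 1≤t s<B = begin
    s * ∑< B f                                           ≡⟨ sym (∑-*ˡ (upTo B) s f) ⟩
    ∑< B (λ i → s * f i)                                 ≡⟨ ∑-cong (upTo B) (λ i → trans (euler-shift (t * i) a s) (lem _ t i (f i))) ⟩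
    ∑< B (λ i → t * (i * f i) + shift (t * i) (λ s' → s' * a s') s) ≡⟨ ∑-+ (upTo B) _ _ ⟩
    ∑< B (λ i → t * (i * f i)) + geo t (λ s' → s' * a s') s ≡⟨ cong (_+ geo t (λ s' → s' * a s') s) (trans (∑-*ˡ (upTo B) t _) (cong (t *_) (sym (geo⁺-geo a 1≤t s<B)))) ⟩
    t * geo⁺ t (geo t a) s + geo t (λ s' → s' * a s') s ∎
    where
    open ≡-Reasoning
    f : ℕ → ℕ
    f i = shift (t * i) a s
    lem : ∀ p t i x → p + t * i * x ≡ t * (i * x) + p
    lem = solve-∀

  geo-geo⁺-comm : ∀ t (ts : List ℕ) b s →
    geo t (λ s' → ∑ ts (λ u → u * geo⁺ u b s')) s ≡ ∑ ts (λ u → u * geo⁺ u (geo t b) s)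
  geo-geo⁺-comm t ts b s = begin
    ∑< B (λ i → shift (t * i) (λ s' → ∑ ts (λ u → u * geo⁺ u b s')) s)
      ≡⟨ ∑-cong (upTo B) (λ i → shift-∑ (t * i) ts _ s) ⟩
    ∑< B (λ i → ∑ ts (λ u → shift (t * i) (λ s' → u * geo⁺ u b s') s))
      ≡⟨ ∑-swap (upTo B) ts _ ⟩
    ∑ ts (λ u → ∑< B (λ i → shift (t * i) (λ s' → u * geo⁺ u b s') s))
      ≡⟨ ∑-cong ts (λ u → begin
           ∑< B (λ i → shift (t * i) (λ s' → u * geo⁺ u b s') s)
             ≡⟨ ∑-cong (upTo B) (λ i → trans (shift-* (t * i) u (geo⁺ u b) s) (cong (u *_) (shift-∑ (t * i) (upTo B) _ s))) ⟩
           ∑< B (λ i → u * ∑< B (λ k → shift (t * i) (shift (u * suc k) b) s))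
             ≡⟨ ∑-*ˡ (upTo B) u _ ⟩
           u * ∑< B (λ i → ∑< B (λ k → shift (t * i) (shift (u * suc k) b) s))
             ≡⟨ cong (u *_) (∑-swap (upTo B) (upTo B) _) ⟩
           u * ∑< B (λ k → ∑< B (λ i → shift (t * i) (shift (u * suc k) b) s))
             ≡⟨ cong (u *_) (∑-cong (upTo B) (λ k → trans
                  (∑-cong (upTo B) (λ i → shift-comm (t * i) (u * suc k) b s))
                  (sym (shift-∑ (u * suc k) (upTo B) _ s)))) ⟩
           u * geo⁺ u (geo t b) s ∎) ⟩
    ∑ ts (λ u → u * geo⁺ u (geo t b) s) ∎
    where open ≡-Reasoning

  -- The number of multisets with total size s whose parts come from ts (equal entries of ts being different colours).
  cnt : List ℕ → Seq
  cnt []       = δ₀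
  cnt (t ∷ ts) = geo t (cnt ts)

  -- Logarithmic differentiation of the whole product: one factor by `euler-geo`, the others by
  -- induction, after which the operators are commuted by `geo-geo⁺-comm`.
  euler : ∀ {ts s} → All (1 ≤_) ts → s < B → s * cnt ts s ≡ ∑ ts (λ t → t * geo⁺ t (cnt ts) s)
  euler {[]} {zero}  _ _ = refl
  euler {[]} {suc s} _ _ = *-zeroʳ s
  euler {t ∷ ts} {s} (1≤t ∷ ps) s<B = begin
    s * geo t (cnt ts) s
      ≡⟨ euler-geo (cnt ts) 1≤t s<B ⟩
    t * geo⁺ t (cnt (t ∷ ts)) s + geo t (λ s' → s' * cnt ts s') s
      ≡⟨ cong (t * geo⁺ t (cnt (t ∷ ts)) s +_) (trans
           (geo-cong t s (λ s' s'≤s → euler ps (≤-<-trans s'≤s s<B)))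
           (geo-geo⁺-comm t ts (cnt ts) s)) ⟩
    ∑ (t ∷ ts) (λ u → u * geo⁺ u (cnt (t ∷ ts)) s) ∎
    where open ≡-Reasoning

  -- Monotonicity, decay and first differences of the coefficients

  multiples≤ : ∀ n t h → t * ∑< n (λ i → 𝟙 (t * suc i ≤? h)) ≤ h
  multiples≤ zero    t h = ≤-trans (≤-reflexive (*-zeroʳ t)) z≤n
  multiples≤ (suc n) t h with t * suc n ≤? h in eq
  ... | yes p = ≤-trans (*-monoʳ-≤ t (≤-trans (∑<-mono (suc n) (λ i _ → 𝟙≤1 (t * suc i ≤? h))) (≤-reflexive (trans (∑<-const (suc n) 1) (*-identityʳ _))))) p
  ... | no ¬p = ≤-trans (≤-reflexive (cong (t *_) (trans (∑<-last n _) (trans (cong (∑< n (λ i → 𝟙 (t * suc i ≤? h)) +_) (𝟙-no (t * suc n ≤? h) ¬p)) (+-identityʳ _))))) (multiples≤ n t h)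

  -- With f = h / t ≥ 1 the remainder costs at most a factor 2: h < t + f t ≤ 2 f t.
  multiples≥ : ∀ n t h → 1 ≤ t → t ≤ h → h ≤ n → h ≤ 2 * (t * ∑< n (λ i → 𝟙 (t * suc i ≤? h)))
  multiples≥ n t@(suc _) h _ t≤h h≤n = begin
    h                        ≤⟨ <⇒≤ (h<t+ft ) ⟩
    t + f * t                ≤⟨ +-monoˡ-≤ (f * t) (≤-trans (≤-reflexive (sym (*-identityˡ t))) (*-monoˡ-≤ t 1≤f)) ⟩
    f * t + f * t            ≡⟨ lem f t ⟩
    2 * (t * f)              ≡⟨ cong (λ x → 2 * (t * x)) (sym (trans (∑<-const f 1) (*-identityʳ f))) ⟩
    2 * (t * ∑< f (λ _ → 1)) ≤⟨ *-monoʳ-≤ 2 (*-monoʳ-≤ t (∑<-mono f (λ i i<f → ≤-reflexive (sym (𝟙-yes (t * suc i ≤? h) (ti≤h i i<f)))))) ⟩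
    2 * (t * ∑< f (λ i → 𝟙 (t * suc i ≤? h))) ≤⟨ *-monoʳ-≤ 2 (*-monoʳ-≤ t (∑<-monoˡ _ (≤-trans (m/n≤m h t) h≤n))) ⟩
    2 * (t * ∑< n (λ i → 𝟙 (t * suc i ≤? h))) ∎
    where
    open ≤-Reasoning
    f = h / t
    h<t+ft : h < t + f * t
    h<t+ft = ≤-trans (s≤s (≤-reflexive (m≡m%n+[m/n]*n h t))) (+-monoˡ-≤ (f * t) (m%n<n h t))
    1≤f : 1 ≤ f
    1≤f with h / t | h<t+ft
    ... | zero  | q = ⊥-elim (<⇒≱ q (≤-trans (≤-reflexive (+-identityʳ t)) t≤h))
    ... | suc _ | _ = s≤s z≤n
    ti≤h : ∀ i → i < f → t * suc i ≤ h
    ti≤h i i<f = ≤-trans (*-monoʳ-≤ t i<f) (≤-trans (≤-reflexive (*-comm t f)) (m/n*n≤m h t))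
    lem : ∀ f t → f * t + f * t ≡ 2 * (t * f)
    lem = solve-∀

  -- Phrased through `shift`, so that an index dropping below 0 gives the value 0 and needs no side
  -- condition.
  Mono : Seq → Set
  Mono b = ∀ {i k s} → i ≤ k → s < B → shift k b s ≤ shift i b s

  -- Multiplication by 1/(1 - q) replaces coefficients by their partial sums, so one unfolding of
  -- the series exhibits each increment as a natural number.
  geo1-mono : ∀ a → Mono (geo 1 a)
  geo1-mono a {i} {k} {s} i≤k s<B = subst (λ x → shift x b s ≤ shift i b s) (m+[n∸m]≡n i≤k) (go (k ∸ i))
    where
    b = geo 1 a
    step : ∀ i → shift (suc i) b s ≤ shift i b s
    step i = ≤-trans (≤-reflexive (trans (cong (λ x → shift x b s) (+-comm 1 i)) (shift-+ i 1 b s)))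
      (shift-mono i s (λ s' s'≤s → ≤-trans (m≤n+m _ (a s')) (≤-reflexive (sym (geo-unfold a ≤-refl (≤-<-trans s'≤s s<B))))))
    go : ∀ e → shift (i + e) b s ≤ shift i b s
    go zero    = ≤-reflexive (cong (λ x → shift x b s) (+-identityʳ i))
    go (suc e) = ≤-trans (≤-reflexive (cong (λ x → shift x b s) (+-suc i e))) (≤-trans (step (i + e)) (go e))

  -- Each part size occurs in two colours, one for the columns A_j and one for the rows B_j.
  dup : ℕ → ℕ → List ℕ
  dup j zero    = []
  dup j (suc r) = j ∷ j ∷ dup (suc j) r

  dup-positive : ∀ {j} r → 1 ≤ j → All (1 ≤_) (dup j r)
  dup-positive zero    p = []
  dup-positive (suc r) p = p ∷ p ∷ dup-positive r (m≤n⇒m≤1+n p)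

  length-dup : ∀ j r → length (dup j r) ≡ 2 * r
  length-dup j zero    = refl
  length-dup j (suc r) = trans (cong (λ x → suc (suc x)) (length-dup (suc j) r)) (sym (*-suc 2 r))

  ∑-dup : ∀ j r f → ∑ (dup j r) f ≡ 2 * ∑< r (λ p → f (j + p))
  ∑-dup j zero    f = refl
  ∑-dup j (suc r) f = begin
    f j + (f j + ∑ (dup (suc j) r) f)           ≡⟨ cong (λ x → f j + (f j + x)) (∑-dup (suc j) r f) ⟩
    f j + (f j + 2 * ∑< r (λ p → f (suc j + p))) ≡⟨ lem (f j) (∑< r (λ p → f (suc j + p))) ⟩
    2 * (f j + ∑< r (λ p → f (suc j + p)))      ≡⟨ cong (2 *_) (cong₂ _+_ (cong f (sym (+-identityʳ j))) (∑-cong (upTo r) (λ p → cong f (sym (+-suc j p))))) ⟩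
    2 * (f (j + 0) + ∑< r (λ p → f (j + suc p))) ≡⟨ cong (2 *_) (sym (∑<-front r (λ p → f (j + p)))) ⟩
    2 * ∑< (suc r) (λ p → f (j + p)) ∎
    where
    open ≡-Reasoning
    lem : ∀ x y → x + (x + 2 * y) ≡ 2 * (x + y)
    lem = solve-∀

  -- Coefficients of 1/∏_{j ≤ d}(1 - q^j)² and, for Q, of the same product with one factor 1 - q cancelled.

  G Q : ℕ → Seq
  G d = cnt (dup 1 d)
  Q d = cnt (1 ∷ dup 2 (pred d))

  G-mono : ∀ {d} → 1 ≤ d → Mono (G d)
  G-mono {suc d} _ = geo1-mono (Q (suc d))

  Q-mono : ∀ d → Mono (Q d)
  Q-mono d = geo1-mono (cnt (dup 2 (pred d)))

  G-positive : ∀ {d s} → 1 ≤ d → s < B → 1 ≤ G d s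
  G-positive {d} {s} 1≤d s<B = ≤-trans (cnt0 (dup 1 d) (≤-trans (s≤s z≤n) s<B)) (≤-trans (≤-reflexive (sym e)) (G-mono 1≤d {0} {s} z≤n s<B))
    where
    e : shift s (G d) s ≡ G d 0
    e = trans (cong (shift s (G d)) (sym (+-identityʳ s))) (shift-plus s (G d) 0)
    geo0 : ∀ t a → 1 ≤ B → a 0 ≤ geo t a 0
    geo0 t a 1≤B = ≤-trans (≤-trans (≤-reflexive (cong (λ x → shift x a 0) (sym (*-zeroʳ t)))) (m≤m+n _ 0)) (∑<-monoˡ (λ i → shift (t * i) a 0) 1≤B)
    cnt0 : ∀ ts → 1 ≤ B → 1 ≤ cnt ts 0
    cnt0 []       _ = ≤-refl
    cnt0 (t ∷ ts) p = ≤-trans (cnt0 ts p) (geo0 t (cnt ts) p)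

  -- Every part j ≤ e contributes at least x copies of G (s - x) to the Euler identity.
  decay : ∀ {d s e x S} → 1 ≤ d → s < B → s ≤ S → e ≤ d → e ≤ x → 1 ≤ x → 2 * S ≤ e * x → 2 * shift x (G d) s ≤ G d s
  decay {d} {s} {e} {x} {S} 1≤d s<B s≤S e≤d e≤x 1≤x 2S≤ex with x ≤? s
  ... | no  x≰s = ≤-trans (≤-reflexive (cong (2 *_) (shift-> (G d) (≰⇒> x≰s)))) z≤n
  ... | yes x≤s = *-cancelˡ-≤ s {{>-nonZero (≤-trans 1≤x x≤s)}} (begin
    s * (2 * g)                                        ≡⟨ lem s g ⟩
    2 * s * g                                          ≤⟨ *-monoˡ-≤ g (≤-trans (*-monoʳ-≤ 2 s≤S) 2S≤ex) ⟩
    e * x * g                                          ≡⟨ *-assoc e x g ⟩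
    e * (x * g)                                        ≡⟨ sym (∑<-const e (x * g)) ⟩
    ∑< e (λ _ → x * g)                                 ≤⟨ ∑<-mono e (λ p p<e → part p p<e) ⟩
    ∑< e (λ p → 2 * (suc p * geo⁺ (suc p) (G d) s))    ≡⟨ ∑-*ˡ (upTo e) 2 _ ⟩
    2 * ∑< e (λ p → suc p * geo⁺ (suc p) (G d) s)      ≤⟨ *-monoʳ-≤ 2 (∑<-monoˡ _ e≤d) ⟩
    -- The two colours of every part make up for the factor 2 lost in `multiples≥`.
    2 * ∑< d (λ p → suc p * geo⁺ (suc p) (G d) s)      ≡⟨ sym (∑-dup 1 d _) ⟩
    ∑ (dup 1 d) (λ t → t * geo⁺ t (G d) s)             ≡⟨ sym (euler (dup-positive d ≤-refl) s<B) ⟩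
    s * G d s                                          ∎)
    where
    open ≤-Reasoning
    g = shift x (G d) s
    lem : ∀ s g → s * (2 * g) ≡ 2 * s * g
    lem = solve-∀
    part : ∀ p → p < e → x * g ≤ 2 * (suc p * geo⁺ (suc p) (G d) s)
    part p p<e = begin
      x * g                                                       ≤⟨ *-monoˡ-≤ g (multiples≥ B (suc p) x (s≤s z≤n) (≤-trans p<e e≤x) (≤-trans x≤s (<⇒≤ s<B))) ⟩
      2 * (suc p * ∑< B (λ i → 𝟙 (suc p * suc i ≤? x))) * g       ≡⟨ assoc3 2 (suc p) (∑< B (λ i → 𝟙 (suc p * suc i ≤? x))) g ⟩
      2 * (suc p * (∑< B (λ i → 𝟙 (suc p * suc i ≤? x)) * g))     ≡⟨ cong (λ y → 2 * (suc p * y)) (sym (∑-*ʳ (upTo B) g _)) ⟩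
      2 * (suc p * ∑< B (λ i → 𝟙 (suc p * suc i ≤? x) * g))       ≤⟨ *-monoʳ-≤ 2 (*-monoʳ-≤ (suc p) (∑<-mono B (λ i _ → one i))) ⟩
      2 * (suc p * geo⁺ (suc p) (G d) s) ∎
      where
      assoc3 : ∀ a b c d → a * (b * c) * d ≡ a * (b * (c * d))
      assoc3 = solve-∀
      one : ∀ i → 𝟙 (suc p * suc i ≤? x) * g ≤ shift (suc p * suc i) (G d) s
      one i with suc p * suc i ≤? x
      ... | yes q = ≤-trans (≤-reflexive (*-identityˡ g)) (G-mono 1≤d q s<B)
      ... | no  _ = z≤n

  -- The condition involves only an upper bound S for s, so it survives every shift and `decay` can
  -- be iterated. With x of order S/e this is a tail bound; combined with `G-positive` it also
  -- bounds `G d s` from below by 2^r.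
  decay^ : ∀ {d s e x S} r → 1 ≤ d → s < B → s ≤ S → e ≤ d → e ≤ x → 1 ≤ x → 2 * S ≤ e * x →
    2 ^ r * shift (r * x) (G d) s ≤ G d s
  decay^ zero 1≤d s<B s≤S e≤d e≤x 1≤x 2S≤ex = ≤-reflexive (+-identityʳ _)
  decay^ {d} {s} {e} {x} {S} (suc r) 1≤d s<B s≤S e≤d e≤x 1≤x 2S≤ex = begin
    2 * 2 ^ r * shift (x + r * x) (G d) s           ≡⟨ cong (2 * 2 ^ r *_) (shift-+ x (r * x) (G d) s) ⟩
    2 * 2 ^ r * shift x (shift (r * x) (G d)) s     ≡⟨ *-assoc 2 (2 ^ r) _ ⟩
    2 * (2 ^ r * shift x (shift (r * x) (G d)) s)   ≡⟨ cong (2 *_) (sym (shift-* x (2 ^ r) (shift (r * x) (G d)) s)) ⟩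
    2 * shift x (λ s' → 2 ^ r * shift (r * x) (G d) s') s ≤⟨ *-monoʳ-≤ 2 (shift-mono x s (λ s' s'≤s → decay^ r 1≤d (≤-<-trans s'≤s s<B) (≤-trans s'≤s s≤S) e≤d e≤x 1≤x 2S≤ex)) ⟩
    2 * shift x (G d) s                             ≤⟨ decay 1≤d s<B s≤S e≤d e≤x 1≤x 2S≤ex ⟩
    G d s                                           ∎
    where open ≤-Reasoning

  -- The Euler identity for Q: parts t m ≤ H are charged to Q (s - t), the others to Q (s - H).
  Q-bound : ∀ {d s} H → 1 ≤ d → d ≤ B → s < B → s * Q d s ≤ 2 * H * G d s + 2 * d * s * shift H (Q d) s
  Q-bound {suc r} {s} H _ d≤B s<B = begin
    s * q s                                                        ≡⟨ euler {ts} (s≤s z≤n ∷ dup-positive r (s≤s z≤n)) s<B ⟩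
    ∑ ts (λ t → t * geo⁺ t q s)                                    ≤⟨ part-all ts ⟩
    ∑ ts (λ t → H * shift t q s + s * shift H q s)                 ≡⟨ trans (∑-+ ts (λ t → H * shift t q s) (λ _ → s * shift H q s)) (cong₂ _+_ (∑-*ˡ ts H (λ t → shift t q s)) (∑-const ts (s * shift H q s))) ⟩
    H * ∑ ts (λ t → shift t q s) + length ts * (s * shift H q s)   ≤⟨ +-mono-≤ (*-monoʳ-≤ H first) (*-monoˡ-≤ (s * shift H q s) len) ⟩
    H * (2 * G (suc r) s) + 2 * suc r * (s * shift H q s)          ≡⟨ lem H (G (suc r) s) (suc r) s (shift H q s) ⟩
    2 * H * G (suc r) s + 2 * suc r * s * shift H q s              ∎
    where
    open ≤-Reasoning
    ts = 1 ∷ dup 2 r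
    q = Q (suc r)
    lem : ∀ h g d s x → h * (2 * g) + 2 * d * (s * x) ≡ 2 * h * g + 2 * d * s * x
    lem = solve-∀
    len : length ts ≤ 2 * suc r
    len = ≤-trans (s≤s (≤-reflexive (length-dup 2 r))) (≤-trans (n≤1+n _) (≤-reflexive (sym (*-suc 2 r))))
    -- Since G = Q/(1 - q), the coefficient of G at s is the sum of all Q (s - t); two colours give
    -- the factor 2.
    first : ∑ ts (λ t → shift t q s) ≤ 2 * G (suc r) s
    first = begin
      shift 1 q s + ∑ (dup 2 r) (λ t → shift t q s)            ≤⟨ m≤n+m _ (shift 1 q s) ⟩
      ∑ (dup 1 (suc r)) (λ t → shift t q s)                    ≡⟨ ∑-dup 1 (suc r) (λ t → shift t q s) ⟩
      2 * ∑< (suc r) (λ p → shift (suc p) q s)                 ≤⟨ *-monoʳ-≤ 2 (∑<-mono (suc r) (λ p _ → ≤-trans (Q-mono (suc r) (n≤1+n p) s<B) (≤-reflexive (cong (λ x → shift x q s) (sym (*-identityˡ p)))))) ⟩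
      2 * ∑< (suc r) (λ p → shift (1 * p) q s)                 ≤⟨ *-monoʳ-≤ 2 (∑<-monoˡ _ d≤B) ⟩
      2 * geo 1 q s                                            ∎
    part : ∀ t → t * geo⁺ t q s ≤ H * shift t q s + s * shift H q s
    part t = begin
      t * geo⁺ t q s
        ≤⟨ *-monoʳ-≤ t (∑<-mono B (λ i _ → one i)) ⟩
      t * ∑< B (λ i → 𝟙 (t * suc i ≤? H) * shift t q s + 𝟙 (t * suc i ≤? s) * shift H q s)
        ≡⟨ cong (t *_) (trans (∑-+ (upTo B) _ _) (cong₂ _+_ (∑-*ʳ (upTo B) (shift t q s) _) (∑-*ʳ (upTo B) (shift H q s) _))) ⟩
      t * (∑< B (λ i → 𝟙 (t * suc i ≤? H)) * shift t q s + ∑< B (λ i → 𝟙 (t * suc i ≤? s)) * shift H q s)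
        ≡⟨ dist t _ (shift t q s) _ (shift H q s) ⟩
      t * ∑< B (λ i → 𝟙 (t * suc i ≤? H)) * shift t q s + t * ∑< B (λ i → 𝟙 (t * suc i ≤? s)) * shift H q s
        ≤⟨ +-mono-≤ (*-monoˡ-≤ (shift t q s) (multiples≤ B t H)) (*-monoˡ-≤ (shift H q s) (multiples≤ B t s)) ⟩
      H * shift t q s + s * shift H q s ∎
      where
      dist : ∀ t a x b y → t * (a * x + b * y) ≡ t * a * x + t * b * y
      dist = solve-∀
      one : ∀ i → shift (t * suc i) q s ≤ 𝟙 (t * suc i ≤? H) * shift t q s + 𝟙 (t * suc i ≤? s) * shift H q s
      one i with t * suc i ≤? s
      ... | no  ¬p = ≤-trans (≤-reflexive (shift-> q (≰⇒> ¬p))) z≤n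
      ... | yes _ with t * suc i ≤? H
      ...   | yes _ = ≤-trans (Q-mono (suc r) (m≤m*n t (suc i)) s<B) (≤-trans (≤-reflexive (sym (*-identityˡ _))) (m≤m+n _ _))
      ...   | no ¬h = ≤-trans (Q-mono (suc r) (<⇒≤ (≰⇒> ¬h)) s<B) (≤-reflexive (sym (*-identityˡ _)))
    part-all : ∀ us → ∑ us (λ t → t * geo⁺ t q s) ≤ ∑ us (λ t → H * shift t q s + s * shift H q s)
    part-all us = ∑-mono us part

  Q≤G : ∀ {d s} → 1 ≤ d → s < B → Q d s ≤ G d s
  Q≤G {d@(suc _)} {s} _ s<B = ≤-trans (m≤m+n _ _) (≤-reflexive (sym (geo-unfold (Q d) ≤-refl s<B)))

  -- Q is the first difference of G, because G = Q/(1 - q). The telescoping sum has x terms, each at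
  -- most `Q d s`. This turns a bound on Q into a bound on the probability that a single c_j is
  -- small.
  G-increment : ∀ {d s} x → 1 ≤ d → s < B → G d s ≤ shift x (G d) s + x * Q d s
  G-increment zero _ _ = m≤m+n _ _
  G-increment {d@(suc _)} {s} (suc x) 1≤d s<B = begin
    G d s                                          ≤⟨ G-increment x 1≤d s<B ⟩
    shift x (G d) s + x * Q d s                    ≡⟨ cong (_+ x * Q d s) eq ⟩
    shift x (Q d) s + shift (suc x) (G d) s + x * Q d s ≤⟨ +-monoˡ-≤ (x * Q d s) (+-monoˡ-≤ _ (Q-mono d {0} {x} z≤n s<B)) ⟩
    Q d s + shift (suc x) (G d) s + x * Q d s      ≡⟨ lem (Q d s) _ (x * Q d s) ⟩
    shift (suc x) (G d) s + (Q d s + x * Q d s)    ∎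
    where
    open ≤-Reasoning
    lem : ∀ a b c → a + b + c ≡ b + (a + c)
    lem = solve-∀
    shift-add : ∀ t a b s → shift t (λ s' → a s' + b s') s ≡ shift t a s + shift t b s
    shift-add zero    a b s       = refl
    shift-add (suc t) a b zero    = refl
    shift-add (suc t) a b (suc s) = shift-add t a b s
    eq : shift x (G d) s ≡ shift x (Q d) s + shift (suc x) (G d) s
    eq = trans (shift-cong x s (λ s' s'≤s → geo-unfold (Q d) ≤-refl (≤-<-trans s'≤s s<B)))
      (trans (shift-add x (Q d) (shift 1 (G d)) s)
        (cong (shift x (Q d) s +_) (trans (sym (shift-+ x 1 (G d) s)) (cong (λ y → shift y (G d) s) (+-comm x 1)))))

  cnt-dup≤ : ∀ j r s → cnt (dup j r) s ≤ B ^ (2 * r)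
  cnt-dup≤ j zero    zero    = ≤-refl
  cnt-dup≤ j zero    (suc s) = z≤n
  cnt-dup≤ j (suc r) s = ≤-trans
    (geo-bound j s (λ s' _ → geo-bound j s' (λ s'' _ → cnt-dup≤ (suc j) r s'')))
    (≤-reflexive (cong (B ^_) (sym (*-suc 2 r))))

  geo-big : ∀ {t s} a → 1 ≤ t → s < B → s < t → geo t a s ≡ a s
  geo-big a 1≤t s<B s<t = trans (geo-unfold a 1≤t s<B) (trans (cong (a _ +_) (shift-> _ s<t)) (+-identityʳ _))

  -- Parts larger than s cannot occur, so at most m part sizes contribute factors, however long the
  -- list is.
  cnt-dup-small≤ : ∀ j r m s → 1 ≤ j → s < B → s < j + m → cnt (dup j r) s ≤ B ^ (2 * m)
  cnt-dup-small≤ j zero m zero    1≤j s<B _ = ^-monoʳ-≤ B {{>-nonZero s<B}} {0} {2 * m} z≤n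
  cnt-dup-small≤ j zero m (suc s) _ _ _ = z≤n
  cnt-dup-small≤ j (suc r) zero s 1≤j s<B s<j = ≤-trans (≤-reflexive (trans (geo-big _ 1≤j s<B s<j') (geo-big _ 1≤j s<B s<j')))
      (cnt-dup-small≤ (suc j) r zero s (s≤s z≤n) s<B (m≤n⇒m≤1+n s<j))
    where
    s<j' : s < j
    s<j' = ≤-trans s<j (≤-reflexive (+-identityʳ j))
  cnt-dup-small≤ j (suc r) (suc m) s 1≤j s<B s<j = ≤-trans
    (geo-bound j s (λ s' s'≤s → geo-bound j s' (λ s'' s''≤s' → let l = ≤-trans s''≤s' s'≤s in
      cnt-dup-small≤ (suc j) r m s'' (s≤s z≤n) (≤-<-trans l s<B) (≤-<-trans l (≤-trans s<j (≤-reflexive (+-suc j m)))))))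
    (≤-reflexive (cong (B ^_) (sym (*-suc 2 m))))

-- Vectors of column counts, weighted by their numbers of splittings

prod : List (List A) → List (List A)
prod []         = [] ∷ []
prod (xs ∷ xss) = concatMap (λ x → map (x ∷_) (prod xss)) xs

∑-prod : ∀ (xs : List A) xss f → ∑ (prod (xs ∷ xss)) f ≡ ∑ xs (λ x → ∑ (prod xss) (λ y → f (x ∷ y)))
∑-prod xs xss f = trans (∑-concatMap _ xs f) (∑-cong xs (λ x → ∑-map (x ∷_) (prod xss) f))

-- The number of ways of splitting every entry c as a + b.
ways : List ℕ → ℕ
ways []       = 1
ways (c ∷ cs) = suc c * ways cs

size : ℕ → List ℕ → ℕ
size j []       = 0
size j (c ∷ cs) = j * c + size (suc j) cs

nth : ℕ → List ℕ → ℕ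
nth p       []       = 0
nth zero    (c ∷ cs) = c
nth (suc p) (c ∷ cs) = nth p cs

-- The number of pairs (A, B) with A + B = c if c has total size s, and 0 otherwise. The indicator
-- is a shifted `δ₀` so that the laws of `shift` apply to it.
wt : ℕ → ℕ → List ℕ → ℕ
wt j s c = ways c * shift (size j c) δ₀ s

module Boxed (B : ℕ) where
  open Truncated B

  box : ℕ → List (List ℕ)
  box r = prod (replicate r (upTo B))

  -- The weight factors over the coordinates. The test function ψ stays arbitrary so that one
  -- recursion serves both the total and the marginals.
  ∑-box : ∀ j r s (ψ : List ℕ → ℕ) → ∑ (box (suc r)) (λ c → ψ c * wt j s c) ≡
    ∑< B (λ m → suc m * shift (j * m) (λ s' → ∑ (box r) (λ c → ψ (m ∷ c) * wt (suc j) s' c)) s)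
  ∑-box j r s ψ = trans (∑-prod (upTo B) (replicate r (upTo B)) _) (∑-cong (upTo B) (λ m → begin
    ∑ (box r) (λ c → ψ (m ∷ c) * (suc m * ways c * shift (j * m + size (suc j) c) δ₀ s))
      ≡⟨ ∑-cong (box r) (λ c → trans (cong (λ x → ψ (m ∷ c) * (suc m * ways c * x)) (shift-+ (j * m) (size (suc j) c) δ₀ s)) (lem (ψ (m ∷ c)) (suc m) (ways c) _)) ⟩
    ∑ (box r) (λ c → suc m * (ψ (m ∷ c) * ways c * shift (j * m) (shift (size (suc j) c) δ₀) s))
      ≡⟨ ∑-*ˡ (box r) (suc m) _ ⟩
    suc m * ∑ (box r) (λ c → ψ (m ∷ c) * ways c * shift (j * m) (shift (size (suc j) c) δ₀) s)
      ≡⟨ cong (suc m *_) (∑-cong (box r) (λ c → trans (sym (shift-* (j * m) (ψ (m ∷ c) * ways c) (shift (size (suc j) c) δ₀) s))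
           (shift-cong (j * m) s (λ s' _ → *-assoc (ψ (m ∷ c)) (ways c) _)))) ⟩
    suc m * ∑ (box r) (λ c → shift (j * m) (λ s' → ψ (m ∷ c) * wt (suc j) s' c) s)
      ≡⟨ cong (suc m *_) (sym (shift-∑ (j * m) (box r) _ s)) ⟩
    suc m * shift (j * m) (λ s' → ∑ (box r) (λ c → ψ (m ∷ c) * wt (suc j) s' c)) s ∎))
    where
    open ≡-Reasoning
    lem : ∀ a b c d → a * (b * c * d) ≡ b * (a * c * d)
    lem = solve-∀

  -- The m + 1 splittings of one coordinate are the coefficients of 1/(1 - q^j)², so each coordinate
  -- accounts for two equal factors.
  box-total : ∀ j r s → 1 ≤ j → s < B → ∑ (box r) (λ c → 1 * wt j s c) ≡ cnt (dup j r) s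
  box-total j zero    s 1≤j s<B = lem (δ₀ s)
    where
    lem : ∀ x → x + 0 + 0 + 0 ≡ x
    lem = solve-∀
  box-total j (suc r) s 1≤j s<B = trans (∑-box j r s (λ _ → 1)) (trans
    (∑-cong (upTo B) (λ m → cong (suc m *_) (shift-cong (j * m) s (λ s' s'≤s → box-total (suc j) r s' (s≤s z≤n) (≤-<-trans s'≤s s<B)))))
    (sym (geo-geo (cnt (dup (suc j) r)) 1≤j s<B)))

  -- The series `a` carries the total weight of all coordinates except the p-th. The tail bounds
  -- need only that it is the same for every φ and s.
  Marginal : (j r p : ℕ) → Seq → Set
  Marginal j r p a = ∀ (φ : ℕ → ℕ) s →
    ∑ (box r) (λ c → φ (nth p c) * wt j s c) ≡ ∑< B (λ m → φ m * (suc m * shift ((j + p) * m) a s))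

  marginal : ∀ j r p → p < r → ∃ (Marginal j r p)
  marginal j (suc r) zero _ = a , λ φ s → trans (∑-box j r s (λ c → φ (nth 0 c))) (∑-cong (upTo B) (λ m → begin
      suc m * shift (j * m) (λ s' → ∑ (box r) (λ c → φ m * wt (suc j) s' c)) s
        ≡⟨ cong (suc m *_) (trans (shift-cong (j * m) s (λ s' _ → ∑-*ˡ (box r) (φ m) _)) (shift-* (j * m) (φ m) a s)) ⟩
      suc m * (φ m * shift (j * m) a s)
        ≡⟨ lem (suc m) (φ m) _ ⟩
      φ m * (suc m * shift (j * m) a s)
        ≡⟨ cong (λ x → φ m * (suc m * shift (x * m) a s)) (sym (+-identityʳ j)) ⟩
      φ m * (suc m * shift ((j + 0) * m) a s) ∎))
    where
    open ≡-Reasoning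
    a : Seq
    a s = ∑ (box r) (wt (suc j) s)
    lem : ∀ a b c → a * (b * c) ≡ b * (a * c)
    lem = solve-∀
  marginal j (suc r) (suc p) (s≤s p<r) with marginal (suc j) r p p<r
  ... | b , e = a , λ φ s → begin
      ∑ (box (suc r)) (λ c → φ (nth (suc p) c) * wt j s c)
        ≡⟨ ∑-box j r s (λ c → φ (nth (suc p) c)) ⟩
      ∑< B (λ m → suc m * shift (j * m) (λ s' → ∑ (box r) (λ c → φ (nth p c) * wt (suc j) s' c)) s)
        ≡⟨ ∑-cong (upTo B) (λ m → cong (suc m *_) (trans (shift-cong (j * m) s (λ s' _ → e φ s')) (shift-∑ (j * m) (upTo B) _ s))) ⟩
      ∑< B (λ m → suc m * ∑< B (λ k → shift (j * m) (λ s' → φ k * (suc k * shift ((suc j + p) * k) b s')) s))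
        ≡⟨ ∑-cong (upTo B) (λ m → trans (sym (∑-*ˡ (upTo B) (suc m) _)) (∑-cong (upTo B) (λ k → term φ s m k))) ⟩
      ∑< B (λ m → ∑< B (λ k → φ k * (suc k * (suc m * shift ((j + suc p) * k) (shift (j * m) b) s))))
        ≡⟨ ∑-swap (upTo B) (upTo B) _ ⟩
      ∑< B (λ k → ∑< B (λ m → φ k * (suc k * (suc m * shift ((j + suc p) * k) (shift (j * m) b) s))))
        ≡⟨ ∑-cong (upTo B) (λ k → trans (∑-*ˡ (upTo B) (φ k) _) (cong (φ k *_) (trans (∑-*ˡ (upTo B) (suc k) _)
             (cong (suc k *_) (trans (∑-cong (upTo B) (λ m → sym (shift-* ((j + suc p) * k) (suc m) (shift (j * m) b) s)))
               (sym (shift-∑ ((j + suc p) * k) (upTo B) _ s))))))) ⟩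
      ∑< B (λ k → φ k * (suc k * shift ((j + suc p) * k) a s)) ∎
    where
    open ≡-Reasoning
    a : Seq
    a s = ∑< B (λ m → suc m * shift (j * m) b s)
    lem : ∀ m f k x → m * (f * (k * x)) ≡ f * (k * (m * x))
    lem = solve-∀
    term : ∀ (φ : ℕ → ℕ) s m k → suc m * shift (j * m) (λ s' → φ k * (suc k * shift ((suc j + p) * k) b s')) s
         ≡ φ k * (suc k * (suc m * shift ((j + suc p) * k) (shift (j * m) b) s))
    term φ s m k = begin
      suc m * shift (j * m) (λ s' → φ k * (suc k * shift ((suc j + p) * k) b s')) s
        ≡⟨ cong (suc m *_) (trans (shift-* (j * m) (φ k) _ s) (cong (φ k *_) (shift-* (j * m) (suc k) _ s))) ⟩
      suc m * (φ k * (suc k * shift (j * m) (shift ((suc j + p) * k) b) s))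
        ≡⟨ lem (suc m) (φ k) (suc k) _ ⟩
      φ k * (suc k * (suc m * shift (j * m) (shift ((suc j + p) * k) b) s))
        ≡⟨ cong (λ x → φ k * (suc k * (suc m * x))) (trans (shift-comm (j * m) ((suc j + p) * k) b s)
             (cong (λ x → shift (x * k) (shift (j * m) b) s) (sym (+-suc j p)))) ⟩
      φ k * (suc k * (suc m * shift ((j + suc p) * k) (shift (j * m) b) s)) ∎

  module Tail {j r p a} (1≤j : 1 ≤ j) (mg : Marginal j r p a) where
    t = j + p
    1≤t : 1 ≤ t
    1≤t = ≤-trans 1≤j (m≤m+n j p)
    g = cnt (dup j r)

    total : ∀ {s} → s < B → g s ≡ ∑< B (λ m → suc m * shift (t * m) a s)
    total {s} s<B = trans (sym (box-total j r s 1≤j s<B)) (trans (mg (λ _ → 1) s) (∑-cong (upTo B) (λ m → *-identityˡ _)))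

    -- Removing i copies of t from coordinate p lowers its multiplicity from m + 1 to m - i + 1.
    -- Both tail bounds compare these two numbers.
    shift-total : ∀ {s} i → s < B → shift (t * i) g s ≡ ∑< B (λ m → 𝟙 (i ≤? m) * (suc (m ∸ i) * shift (t * m) a s))
    shift-total {s} i s<B = begin
      shift (t * i) g s
        ≡⟨ trans (shift-cong (t * i) s (λ s' s'≤s → total (≤-<-trans s'≤s s<B))) (shift-∑ (t * i) (upTo B) _ s) ⟩
      ∑< B (λ m → shift (t * i) (λ s' → suc m * shift (t * m) a s') s)
        ≡⟨ ∑-cong (upTo B) (λ m → trans (shift-* (t * i) (suc m) _ s) (cong₂ _*_ (cong suc (sym (m+n∸m≡n i m)))
             (trans (sym (shift-+ (t * i) (t * m) a s)) (cong (λ x → shift x a s) (sym (*-distribˡ-+ t i m)))))) ⟩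
      ∑< B (λ m → suc (i + m ∸ i) * shift (t * (i + m)) a s)
        ≡⟨ ∑<-reindex B i {λ m → suc (m ∸ i) * shift (t * m) a s} (λ m B≤m → trans (cong (suc (m ∸ i) *_) (term-vanish a 1≤t s<B m B≤m)) (*-zeroʳ (suc (m ∸ i)))) ⟩
      ∑< B (λ m → 𝟙 (i ≤? m) * (suc (m ∸ i) * shift (t * m) a s)) ∎
      where open ≡-Reasoning

    -- For m ≥ y the multiplicity m - y + 1 left after removing y copies is at most m + 1, so
    -- `shift (t * y) g s` is covered by the vectors outside the tail.
    lower-tail : ∀ {s} y → s < B → ∑ (box r) (λ c → 𝟙 (nth p c <? y) * wt j s c) + shift (t * y) g s ≤ g s
    lower-tail {s} y s<B = begin
      ∑ (box r) (λ c → 𝟙 (nth p c <? y) * wt j s c) + shift (t * y) g s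
        ≡⟨ cong₂ _+_ (mg (λ m → 𝟙 (m <? y)) s) (shift-total y s<B) ⟩
      ∑< B (λ m → 𝟙 (m <? y) * (suc m * x m)) + ∑< B (λ m → 𝟙 (y ≤? m) * (suc (m ∸ y) * x m))
        ≡⟨ sym (∑-+ (upTo B) _ _) ⟩
      ∑< B (λ m → 𝟙 (m <? y) * (suc m * x m) + 𝟙 (y ≤? m) * (suc (m ∸ y) * x m))
        ≤⟨ ∑-mono (upTo B) one ⟩
      ∑< B (λ m → suc m * x m)
        ≡⟨ sym (total s<B) ⟩
      g s ∎
      where
      open ≤-Reasoning
      x : ℕ → ℕ
      x m = shift (t * m) a s
      one : ∀ m → 𝟙 (m <? y) * (suc m * x m) + 𝟙 (y ≤? m) * (suc (m ∸ y) * x m) ≤ suc m * x m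
      one m with m <? y | y ≤? m
      ... | yes m<y | yes y≤m = ⊥-elim (<⇒≱ m<y y≤m)
      ... | yes _   | no _    = ≤-reflexive (trans (+-identityʳ _) (*-identityˡ _))
      ... | no _    | yes _   = ≤-trans (≤-reflexive (*-identityˡ _)) (*-monoˡ-≤ (x m) (s≤s (m∸n≤m m y)))
      ... | no _    | no _    = z≤n

    ceiling : ∀ h → ∃ λ i → h ≤ t * i × t * i < h + t
    ceiling zero    = 0 , z≤n , ≤-trans (≤-reflexive (cong suc (*-zeroʳ t))) 1≤t
    ceiling (suc h) with ceiling h
    ... | i , p , q with suc h ≤? t * i
    ...   | yes h<ti = i , h<ti , m≤n⇒m≤1+n q
    ...   | no  h≮ti = suc i ,
            ≤-trans (+-mono-≤ 1≤t p) (≤-reflexive (sym (*-suc t i))) ,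
            ≤-trans (s≤s (≤-trans (≤-reflexive (*-suc t i)) (≤-trans (+-monoʳ-≤ t (≤-pred (≰⇒> h≮ti))) (≤-reflexive (+-comm t h))))) ≤-refl

    -- Only i = ⌈h/t⌉ copies are removed, about half of those present. Then 2 i ≤ m + 1, so at least
    -- half of the multiplicity m + 1 survives: hence the 2 on either side.
    upper-tail : ∀ {s} h → Mono g → s < B → ∑ (box r) (λ c → 𝟙 (2 * h ≤? t * nth p c) * wt j s c) ≤ 2 * shift h g s
    upper-tail {s} h mono s<B with ceiling h
    ... | i , h≤ti , ti<h+t = begin
      ∑ (box r) (λ c → 𝟙 (2 * h ≤? t * nth p c) * wt j s c)
        ≡⟨ mg (λ m → 𝟙 (2 * h ≤? t * m)) s ⟩
      ∑< B (λ m → 𝟙 (2 * h ≤? t * m) * (suc m * x m))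
        ≤⟨ ∑-mono (upTo B) one ⟩
      ∑< B (λ m → 2 * (𝟙 (i ≤? m) * (suc (m ∸ i) * x m)))
        ≡⟨ ∑-*ˡ (upTo B) 2 _ ⟩
      2 * ∑< B (λ m → 𝟙 (i ≤? m) * (suc (m ∸ i) * x m))
        ≡⟨ cong (2 *_) (sym (shift-total i s<B)) ⟩
      2 * shift (t * i) g s
        ≤⟨ *-monoʳ-≤ 2 (mono h≤ti s<B) ⟩
      2 * shift h g s ∎
      where
      open ≤-Reasoning
      x : ℕ → ℕ
      x m = shift (t * m) a s
      half : ∀ m → 2 * h ≤ t * m → 2 * i ≤ suc m
      half m q = ≤-pred (*-cancelˡ-< t (2 * i) (suc (suc m)) (begin-strict
        t * (2 * i)     ≡⟨ swap t i ⟩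
        2 * (t * i)     <⟨ *-monoʳ-< 2 ti<h+t ⟩
        2 * (h + t)     ≡⟨ *-distribˡ-+ 2 h t ⟩
        2 * h + 2 * t   ≤⟨ +-monoˡ-≤ (2 * t) q ⟩
        t * m + 2 * t   ≡⟨ expand t m ⟩
        t * suc (suc m) ∎))
        where
        swap : ∀ t i → t * (2 * i) ≡ 2 * (t * i)
        swap = solve-∀
        expand : ∀ t m → t * m + 2 * t ≡ t * (2 + m)
        expand = solve-∀
      one : ∀ m → 𝟙 (2 * h ≤? t * m) * (suc m * x m) ≤ 2 * (𝟙 (i ≤? m) * (suc (m ∸ i) * x m))
      one m with 2 * h ≤? t * m
      ... | no  _ = z≤n
      ... | yes q with i ≤? m
      ...   | no i≰m = ⊥-elim (<⇒≱ (≤-trans (*-monoʳ-≤ 2 (≰⇒> i≰m)) (half m q)) (≤-trans (≤-reflexive (sym (*-identityˡ (suc m)))) (m≤n+m (1 * suc m) m)))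
      ...   | yes i≤m = begin
              1 * (suc m * x m)                ≡⟨ *-identityˡ _ ⟩
              suc m * x m                      ≤⟨ *-monoˡ-≤ (x m) (+-cancelˡ-≤ (suc m) _ _ (begin
                suc m + suc m                   ≡⟨ cong (suc m +_) (cong suc (sym (m+[n∸m]≡n i≤m))) ⟩
                suc m + suc (i + (m ∸ i))       ≡⟨ cong (_+ suc (i + (m ∸ i))) (cong suc (sym (m+[n∸m]≡n i≤m))) ⟩
                suc (i + (m ∸ i)) + suc (i + (m ∸ i)) ≡⟨ arr i (m ∸ i) ⟩
                2 * i + 2 * suc (m ∸ i)         ≤⟨ +-monoˡ-≤ _ (half m q) ⟩
                suc m + 2 * suc (m ∸ i)         ∎)) ⟩
              2 * suc (m ∸ i) * x m            ≡⟨ reas (suc (m ∸ i)) (x m) ⟩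
              2 * (1 * (suc (m ∸ i) * x m))    ∎
        where
        arr : ∀ i k → suc (i + k) + suc (i + k) ≡ 2 * i + 2 * suc k
        arr = solve-∀
        reas : ∀ a b → 2 * a * b ≡ 2 * (1 * (a * b))
        reas = solve-∀

-- Random splittings of fixed column counts

split : ℕ → List (ℕ × ℕ)
split c = map (λ a → a , c ∸ a) (upTo (suc c))

cfgs : List ℕ → List (List (ℕ × ℕ))
cfgs cs = prod (map split cs)

diff : ℕ × ℕ → ℤ
diff (a , b) = a ⊖ b

dot : (ℕ → ℕ) → ℕ → List (ℕ × ℕ) → ℤ
dot w j []       = ℤ.+ 0
dot w j (p ∷ xs) = ℤ.+ w j ℤ.* diff p ℤ.+ dot w (suc j) xs

sq : ℤ → ℕ
sq y = ∣ y ∣ * ∣ y ∣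

variation : (ℕ → ℕ) → ℕ → List ℕ → ℕ
variation w j []       = 0
variation w j (c ∷ cs) = (w j * c) * (w j * c) + variation w (suc j) cs

+sq : ∀ y → ℤ.+ sq y ≡ y ℤ.* y
+sq (ℤ.+ n)    = ℤ.pos-* n n
+sq -[1+ n ] = refl

∑-split : ∀ c f → ∑ (split c) f ≡ ∑< (suc c) (λ a → f (a , c ∸ a))
∑-split c f = ∑-map (λ a → a , c ∸ a) (upTo (suc c)) f

split-sym : ∀ c (h : ℤ → ℕ) → ∑ (split c) (h ∘ diff) ≡ ∑ (split c) (λ p → h (ℤ.- diff p))
split-sym c h = begin
  ∑ (split c) (h ∘ diff)                            ≡⟨ ∑-split c _ ⟩
  ∑< (suc c) (λ a → h (a ⊖ (c ∸ a)))                ≡⟨ ∑<-reverse c _ ⟩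
  ∑< (suc c) (λ a → h ((c ∸ a) ⊖ (c ∸ (c ∸ a))))    ≡⟨ ∑<-cong (suc c) (λ a a≤c → cong h (trans (cong ((c ∸ a) ⊖_) (m∸[m∸n]≡n (≤-pred a≤c))) (ℤ.⊖-swap (c ∸ a) a))) ⟩
  ∑< (suc c) (λ a → h (ℤ.- (a ⊖ (c ∸ a))))          ≡⟨ sym (∑-split c _) ⟩
  ∑ (split c) (λ p → h (ℤ.- diff p))                ∎
  where open ≡-Reasoning

pairing : ∀ c (h : ℤ → ℕ) → 2 * ∑ (split c) (h ∘ diff) ≡ ∑ (split c) (λ p → h (diff p) + h (ℤ.- diff p))
pairing c h = trans (cong (S +_) (trans (+-identityʳ S) (split-sym c h))) (sym (∑-+ (split c) (h ∘ diff) _))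
  where S = ∑ (split c) (h ∘ diff)

∑-cfgs : ∀ c cs f → ∑ (cfgs (c ∷ cs)) f ≡ ∑ (split c) (λ p → ∑ (cfgs cs) (λ x → f (p ∷ x)))
∑-cfgs c cs f = ∑-prod (split c) (map split cs) f

length-split : ∀ c → length (split c) ≡ suc c
length-split c = trans (length-map _ (upTo (suc c))) (length-upTo (suc c))

∑-cfgs-const : ∀ cs k → ∑ (cfgs cs) (λ _ → k) ≡ ways cs * k
∑-cfgs-const []       k = refl
∑-cfgs-const (c ∷ cs) k = begin
  ∑ (cfgs (c ∷ cs)) (λ _ → k)                   ≡⟨ ∑-cfgs c cs (λ _ → k) ⟩
  ∑ (split c) (λ _ → ∑ (cfgs cs) (λ _ → k))     ≡⟨ ∑-const (split c) _ ⟩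
  length (split c) * ∑ (cfgs cs) (λ _ → k)      ≡⟨ cong₂ _*_ (length-split c) (∑-cfgs-const cs k) ⟩
  suc c * (ways cs * k)                         ≡⟨ sym (*-assoc (suc c) (ways cs) k) ⟩
  suc c * ways cs * k                           ∎
  where open ≡-Reasoning

-- Averaging over the swap of the two entries of the first pair leaves only even powers.
even-average : ∀ (f : ℤ → ℕ) (k : ℕ → ℕ → ℕ) → (∀ z y → f (z ℤ.+ y) + f (ℤ.- z ℤ.+ y) ≡ 2 * k (sq z) (sq y)) →
  ∀ w j c cs → ∑ (cfgs (c ∷ cs)) (f ∘ dot w j) ≡
    ∑ (split c) (λ p → ∑ (cfgs cs) (λ x → k (sq (ℤ.+ w j ℤ.* diff p)) (sq (dot w (suc j) x))))
even-average f k e w j c cs = *-cancelˡ-≡ _ _ 2 (begin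
  2 * ∑ (cfgs (c ∷ cs)) (f ∘ dot w j)
    ≡⟨ cong (2 *_) (∑-cfgs c cs _) ⟩
  2 * ∑ (split c) (h ∘ diff)
    ≡⟨ pairing c h ⟩
  ∑ (split c) (λ p → h (diff p) + h (ℤ.- diff p))
    ≡⟨ ∑-cong (split c) (λ p → trans (sym (∑-+ (cfgs cs) _ _)) (trans
         (∑-cong (cfgs cs) (λ x → trans (cong (λ u → f (ℤ.+ w j ℤ.* diff p ℤ.+ dot w (suc j) x) + f (u ℤ.+ dot w (suc j) x)) (sym (ℤ.neg-distribʳ-* (ℤ.+ w j) (diff p))))
           (e (ℤ.+ w j ℤ.* diff p) (dot w (suc j) x))))
         (∑-*ˡ (cfgs cs) 2 _))) ⟩
  ∑ (split c) (λ p → 2 * ∑ (cfgs cs) (λ x → k (sq (ℤ.+ w j ℤ.* diff p)) (sq (dot w (suc j) x))))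
    ≡⟨ ∑-*ˡ (split c) 2 (λ p → ∑ (cfgs cs) (λ x → k (sq (ℤ.+ w j ℤ.* diff p)) (sq (dot w (suc j) x)))) ⟩
  2 * ∑ (split c) (λ p → ∑ (cfgs cs) (λ x → k (sq (ℤ.+ w j ℤ.* diff p)) (sq (dot w (suc j) x)))) ∎)
  where
  open ≡-Reasoning
  h : ℤ → ℕ
  h d = ∑ (cfgs cs) (λ x → f (ℤ.+ w j ℤ.* d ℤ.+ dot w (suc j) x))

sq-average : ∀ z y → sq (z ℤ.+ y) + sq (ℤ.- z ℤ.+ y) ≡ 2 * (sq z + sq y)
sq-average z y = ℤ.+-injective (begin
  ℤ.+ sq (z ℤ.+ y) ℤ.+ ℤ.+ sq (ℤ.- z ℤ.+ y)                         ≡⟨ cong₂ ℤ._+_ (+sq (z ℤ.+ y)) (+sq (ℤ.- z ℤ.+ y)) ⟩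
  (z ℤ.+ y) ℤ.* (z ℤ.+ y) ℤ.+ (ℤ.- z ℤ.+ y) ℤ.* (ℤ.- z ℤ.+ y)   ≡⟨ lem z y ⟩
  ℤ.+ 2 ℤ.* (z ℤ.* z ℤ.+ y ℤ.* y)                                 ≡⟨ cong (ℤ.+ 2 ℤ.*_) (cong₂ ℤ._+_ (sym (+sq z)) (sym (+sq y))) ⟩
  ℤ.+ 2 ℤ.* ℤ.+ (sq z + sq y)                                       ≡⟨ sym (ℤ.pos-* 2 (sq z + sq y)) ⟩
  ℤ.+ (2 * (sq z + sq y))                                         ∎)
  where
  open ≡-Reasoning
  lem : ∀ z y → (z ℤ.+ y) ℤ.* (z ℤ.+ y) ℤ.+ (ℤ.- z ℤ.+ y) ℤ.* (ℤ.- z ℤ.+ y) ≡ ℤ.+ 2 ℤ.* (z ℤ.* z ℤ.+ y ℤ.* y)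
  lem = ℤ-Ring.solve-∀

quartic : ℤ → ℕ
quartic y = sq y * sq y

quartic-average : ∀ z y → quartic (z ℤ.+ y) + quartic (ℤ.- z ℤ.+ y) ≡ 2 * (sq z * sq z + 6 * (sq z * sq y) + sq y * sq y)
quartic-average z y = ℤ.+-injective (begin
  ℤ.+ quartic (z ℤ.+ y) ℤ.+ ℤ.+ quartic (ℤ.- z ℤ.+ y)
    ≡⟨ cong₂ ℤ._+_ (+quartic (z ℤ.+ y)) (+quartic (ℤ.- z ℤ.+ y)) ⟩
  _ ≡⟨ lem z y ⟩
  ℤ.+ 2 ℤ.* (Z ℤ.* Z ℤ.+ ℤ.+ 6 ℤ.* (Z ℤ.* Y) ℤ.+ Y ℤ.* Y)
    ≡⟨ cong (ℤ.+ 2 ℤ.*_) (cong₂ ℤ._+_ (cong₂ ℤ._+_ (mul z z) (trans (cong (ℤ.+ 6 ℤ.*_) (mul z y)) (sym (ℤ.pos-* 6 (sq z * sq y))))) (mul y y)) ⟩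
  ℤ.+ 2 ℤ.* ℤ.+ (sq z * sq z + 6 * (sq z * sq y) + sq y * sq y)
    ≡⟨ sym (ℤ.pos-* 2 (sq z * sq z + 6 * (sq z * sq y) + sq y * sq y)) ⟩
  ℤ.+ (2 * (sq z * sq z + 6 * (sq z * sq y) + sq y * sq y)) ∎)
  where
  open ≡-Reasoning
  Z = z ℤ.* z
  Y = y ℤ.* y
  mul : ∀ a b → (a ℤ.* a) ℤ.* (b ℤ.* b) ≡ ℤ.+ (sq a * sq b)
  mul a b = trans (cong₂ ℤ._*_ (sym (+sq a)) (sym (+sq b))) (sym (ℤ.pos-* (sq a) (sq b)))
  +quartic : ∀ y → ℤ.+ quartic y ≡ (y ℤ.* y) ℤ.* (y ℤ.* y)
  +quartic y = sym (mul y y)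
  lem : ∀ z y → ((z ℤ.+ y) ℤ.* (z ℤ.+ y)) ℤ.* ((z ℤ.+ y) ℤ.* (z ℤ.+ y)) ℤ.+ ((ℤ.- z ℤ.+ y) ℤ.* (ℤ.- z ℤ.+ y)) ℤ.* ((ℤ.- z ℤ.+ y) ℤ.* (ℤ.- z ℤ.+ y))
    ≡ ℤ.+ 2 ℤ.* ((z ℤ.* z) ℤ.* (z ℤ.* z) ℤ.+ ℤ.+ 6 ℤ.* ((z ℤ.* z) ℤ.* (y ℤ.* y)) ℤ.+ (y ℤ.* y) ℤ.* (y ℤ.* y))
  lem = ℤ-Ring.solve-∀

-- Moments of a linear form in independent variables uniform on {-c, -c+2, ..., c}

sq-scale : ∀ w d → sq (ℤ.+ w ℤ.* d) ≡ (w * w) * sq d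
sq-scale w d = trans (cong₂ _*_ (ℤ.abs-* (ℤ.+ w) d) (ℤ.abs-* (ℤ.+ w) d)) (lem w ∣ d ∣)
  where
  lem : ∀ w d → (w * d) * (w * d) ≡ (w * w) * (d * d)
  lem = solve-∀

diff-bound : ∀ {c p} → p ∈ split c → ∣ diff p ∣ ≤ c
diff-bound {c} p∈ with ∈-map⁻ (λ a → a , c ∸ a) p∈
... | a , a∈ , refl = ≤-trans (ℤ.∣m⊝n∣≤m⊔n a (c ∸ a)) (⊔-lub (≤-pred (∈-upTo⁻ a∈)) (m∸n≤m c a))

sq-diff-bound : ∀ w {c p} → p ∈ split c → sq (ℤ.+ w ℤ.* diff p) ≤ (w * c) * (w * c)
sq-diff-bound w {c} {p} p∈ = ≤-trans (≤-reflexive (cong₂ _*_ (ℤ.abs-* (ℤ.+ w) (diff p)) (ℤ.abs-* (ℤ.+ w) (diff p)))) (*-mono-≤ b b)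
  where
  b : w * ∣ diff p ∣ ≤ w * c
  b = *-monoʳ-≤ w (diff-bound p∈)

moment₂ moment₄ : (ℕ → ℕ) → ℕ → List ℕ → ℕ
moment₂ w j cs = ∑ (cfgs cs) (sq ∘ dot w j)
moment₄ w j cs = ∑ (cfgs cs) (quartic ∘ dot w j)

moment₂-step : ∀ w j c cs → moment₂ w j (c ∷ cs) ≡ ∑ (split c) (λ p → sq (ℤ.+ w j ℤ.* diff p)) * ways cs + suc c * moment₂ w (suc j) cs
moment₂-step w j c cs = begin
  moment₂ w j (c ∷ cs)
    ≡⟨ even-average sq _+_ sq-average w j c cs ⟩
  ∑ (split c) (λ p → ∑ (cfgs cs) (λ x → Z p + sq (dot w (suc j) x)))
    ≡⟨ ∑-cong (split c) (λ p → trans (∑-+ (cfgs cs) _ _) (cong (_+ moment₂ w (suc j) cs) (trans (∑-cfgs-const cs (Z p)) (*-comm (ways cs) (Z p))))) ⟩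
  ∑ (split c) (λ p → Z p * ways cs + moment₂ w (suc j) cs)
    ≡⟨ trans (∑-+ (split c) (λ p → Z p * ways cs) (λ _ → moment₂ w (suc j) cs)) (cong₂ _+_ (∑-*ʳ (split c) (ways cs) Z) (trans (∑-const (split c) (moment₂ w (suc j) cs)) (cong (_* moment₂ w (suc j) cs) (length-split c)))) ⟩
  ∑ (split c) Z * ways cs + suc c * moment₂ w (suc j) cs ∎
  where
  open ≡-Reasoning
  Z : ℕ × ℕ → ℕ
  Z p = sq (ℤ.+ w j ℤ.* diff p)

moment₂-upper : ∀ w j cs → moment₂ w j cs ≤ ways cs * variation w j cs
moment₂-upper w j []       = z≤n
moment₂-upper w j (c ∷ cs) = begin
  moment₂ w j (c ∷ cs)
    ≡⟨ moment₂-step w j c cs ⟩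
  ∑ (split c) (λ p → sq (ℤ.+ w j ℤ.* diff p)) * ways cs + suc c * moment₂ w (suc j) cs
    ≤⟨ +-mono-≤ (*-monoˡ-≤ (ways cs) (≤-trans (∑-bound (split c) u (sq-diff-bound (w j))) (≤-reflexive (cong (_* u) (length-split c))))) (*-monoʳ-≤ (suc c) (moment₂-upper w (suc j) cs)) ⟩
  suc c * u * ways cs + suc c * (ways cs * variation w (suc j) cs)
    ≡⟨ lem (suc c) u (ways cs) (variation w (suc j) cs) ⟩
  suc c * ways cs * (u + variation w (suc j) cs) ∎
  where
  open ≤-Reasoning
  u = (w j * c) * (w j * c)
  lem : ∀ c u n v → c * u * n + c * (n * v) ≡ c * n * (u + v)
  lem = solve-∀

-- The constant 3 closes the induction: u² + 6uv + 3v² ≤ 3(u + v)², where u bounds the square of the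
-- first term and v is the variation of the rest.
moment₄-upper : ∀ w j cs → moment₄ w j cs ≤ 3 * (ways cs * (variation w j cs * variation w j cs))
moment₄-upper w j []       = z≤n
moment₄-upper w j (c ∷ cs) = begin
  moment₄ w j (c ∷ cs)
    ≡⟨ even-average quartic (λ a b → a * a + 6 * (a * b) + b * b) quartic-average w j c cs ⟩
  ∑ (split c) (λ p → ∑ (cfgs cs) (λ x → Z p * Z p + 6 * (Z p * Y x) + Y x * Y x))
    ≤⟨ ∑-bound (split c) _ (λ {p} p∈ → inner {p} (sq-diff-bound (w j) p∈)) ⟩
  length (split c) * (n * (u * u) + 6 * u * (n * v) + 3 * (n * (v * v)))
    ≡⟨ cong (_* (n * (u * u) + 6 * u * (n * v) + 3 * (n * (v * v)))) (length-split c) ⟩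
  suc c * (n * (u * u) + 6 * u * (n * v) + 3 * (n * (v * v)))
    ≤⟨ m≤m+n _ (2 * (suc c * (n * (u * u)))) ⟩
  suc c * (n * (u * u) + 6 * u * (n * v) + 3 * (n * (v * v))) + 2 * (suc c * (n * (u * u)))
    ≡⟨ lem (suc c) n u v ⟩
  3 * (suc c * n * ((u + v) * (u + v))) ∎
  where
  open ≤-Reasoning
  n = ways cs
  u = (w j * c) * (w j * c)
  v = variation w (suc j) cs
  Z : ℕ × ℕ → ℕ
  Z p = sq (ℤ.+ w j ℤ.* diff p)
  Y : List (ℕ × ℕ) → ℕ
  Y x = sq (dot w (suc j) x)
  lem : ∀ c n u v → c * (n * (u * u) + 6 * u * (n * v) + 3 * (n * (v * v))) + 2 * (c * (n * (u * u))) ≡ 3 * (c * n * ((u + v) * (u + v)))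
  lem = solve-∀
  inner : ∀ {p} → Z p ≤ u → ∑ (cfgs cs) (λ x → Z p * Z p + 6 * (Z p * Y x) + Y x * Y x) ≤ n * (u * u) + 6 * u * (n * v) + 3 * (n * (v * v))
  inner {p} z≤u = begin
    ∑ (cfgs cs) (λ x → Z p * Z p + 6 * (Z p * Y x) + Y x * Y x)
      ≤⟨ ∑-mono (cfgs cs) (λ x → +-monoˡ-≤ (Y x * Y x) (+-mono-≤ (*-mono-≤ z≤u z≤u) (≤-trans (*-monoʳ-≤ 6 (*-monoˡ-≤ (Y x) z≤u)) (≤-reflexive (sym (*-assoc 6 u (Y x))))))) ⟩
    ∑ (cfgs cs) (λ x → u * u + 6 * u * Y x + Y x * Y x)
      ≡⟨ trans (∑-+ (cfgs cs) _ _) (cong (_+ moment₄ w (suc j) cs) (trans (∑-+ (cfgs cs) _ _) (cong₂ _+_ (∑-cfgs-const cs (u * u)) (∑-*ˡ (cfgs cs) (6 * u) Y)))) ⟩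
    n * (u * u) + 6 * u * moment₂ w (suc j) cs + moment₄ w (suc j) cs
      ≤⟨ +-mono-≤ (+-monoʳ-≤ (n * (u * u)) (*-monoʳ-≤ (6 * u) (moment₂-upper w (suc j) cs))) (moment₄-upper w (suc j) cs) ⟩
    n * (u * u) + 6 * u * (n * v) + 3 * (n * (v * v)) ∎

∑-id : ∀ c → 2 * ∑< (suc c) id ≡ suc c * c
∑-id zero    = refl
∑-id (suc c) = begin
  2 * ∑< (suc (suc c)) id            ≡⟨ cong (2 *_) (∑<-last (suc c) id) ⟩
  2 * (∑< (suc c) id + suc c)        ≡⟨ *-distribˡ-+ 2 (∑< (suc c) id) (suc c) ⟩
  2 * ∑< (suc c) id + 2 * suc c      ≡⟨ cong (_+ 2 * suc c) (∑-id c) ⟩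
  suc c * c + 2 * suc c              ≡⟨ lem c ⟩
  suc (suc c) * suc c                ∎
  where
  open ≡-Reasoning
  lem : ∀ c → suc c * c + 2 * suc c ≡ suc (suc c) * suc c
  lem = solve-∀

-- The exact value of the left-hand side is (c - 1) c (c + 1); the weaker bound avoids truncated
-- subtraction.
∑-products : ∀ c → 6 * ∑< (suc c) (λ a → a * (c ∸ a)) ≤ suc c * (c * c)
∑-products zero    = z≤n
∑-products (suc c) = begin
  6 * ∑< (suc (suc c)) (λ a → a * (suc c ∸ a))
    ≡⟨ cong (6 *_) (trans (∑<-last (suc c) (λ a → a * (suc c ∸ a))) (trans (cong (∑< (suc c) (λ a → a * (suc c ∸ a)) +_) (trans (cong (suc c *_) (n∸n≡0 (suc c))) (*-zeroʳ (suc c)))) (+-identityʳ _))) ⟩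
  6 * ∑< (suc c) (λ a → a * (suc c ∸ a))
    ≡⟨ cong (6 *_) (∑<-cong (suc c) (λ a a≤c → trans (cong (a *_) (+-∸-assoc 1 (≤-pred a≤c))) (*-suc a (c ∸ a)))) ⟩
  6 * ∑< (suc c) (λ a → a + a * (c ∸ a))
    ≡⟨ cong (6 *_) (∑-+ (upTo (suc c)) id (λ a → a * (c ∸ a))) ⟩
  6 * (∑< (suc c) id + ∑< (suc c) (λ a → a * (c ∸ a)))
    ≡⟨ lem₁ (∑< (suc c) id) _ ⟩
  3 * (2 * ∑< (suc c) id) + 6 * ∑< (suc c) (λ a → a * (c ∸ a))
    ≤⟨ +-mono-≤ (≤-reflexive (cong (3 *_) (∑-id c))) (∑-products c) ⟩
  3 * (suc c * c) + suc c * (c * c)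
    ≤⟨ m≤m+n _ (2 * suc c) ⟩
  3 * (suc c * c) + suc c * (c * c) + 2 * suc c
    ≡⟨ lem₂ c ⟩
  suc (suc c) * (suc c * suc c) ∎
  where
  open ≤-Reasoning
  lem₁ : ∀ x y → 6 * (x + y) ≡ 3 * (2 * x) + 6 * y
  lem₁ = solve-∀
  lem₂ : ∀ c → 3 * (suc c * c) + suc c * (c * c) + 2 * suc c ≡ suc (suc c) * (suc c * suc c)
  lem₂ = solve-∀

sq-⊖ : ∀ a b → sq (a ⊖ b) + 4 * (a * b) ≡ (a + b) * (a + b)
sq-⊖ a b with ≤-total a b
... | inj₁ a≤b = begin
  sq (a ⊖ b) + 4 * (a * b)                         ≡⟨ cong (λ x → x * x + 4 * (a * b)) (trans (cong ∣_∣ (ℤ.⊖-≤ a≤b)) (ℤ.∣-i∣≡∣i∣ (ℤ.+ (b ∸ a)))) ⟩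
  (b ∸ a) * (b ∸ a) + 4 * (a * b)                  ≡⟨ cong (λ x → (b ∸ a) * (b ∸ a) + 4 * (a * x)) (sym (m+[n∸m]≡n a≤b)) ⟩
  (b ∸ a) * (b ∸ a) + 4 * (a * (a + (b ∸ a)))      ≡⟨ lem a (b ∸ a) ⟩
  (a + (a + (b ∸ a))) * (a + (a + (b ∸ a)))        ≡⟨ cong (λ x → (a + x) * (a + x)) (m+[n∸m]≡n a≤b) ⟩
  (a + b) * (a + b)                                ∎
  where
  open ≡-Reasoning
  lem : ∀ a k → k * k + 4 * (a * (a + k)) ≡ (a + (a + k)) * (a + (a + k))
  lem = solve-∀
... | inj₂ b≤a = begin
  sq (a ⊖ b) + 4 * (a * b)                         ≡⟨ cong (λ x → x * x + 4 * (a * b)) (cong ∣_∣ (ℤ.⊖-≥ b≤a)) ⟩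
  (a ∸ b) * (a ∸ b) + 4 * (a * b)                  ≡⟨ cong (λ x → (a ∸ b) * (a ∸ b) + 4 * (x * b)) (sym (m+[n∸m]≡n b≤a)) ⟩
  (a ∸ b) * (a ∸ b) + 4 * ((b + (a ∸ b)) * b)      ≡⟨ lem b (a ∸ b) ⟩
  (b + (a ∸ b) + b) * (b + (a ∸ b) + b)            ≡⟨ cong (λ x → (x + b) * (x + b)) (m+[n∸m]≡n b≤a) ⟩
  (a + b) * (a + b)                                ∎
  where
  open ≡-Reasoning
  lem : ∀ b k → k * k + 4 * ((b + k) * b) ≡ (b + k + b) * (b + k + b)
  lem = solve-∀

-- Here (a - b)² = c² - 4ab, and by `∑-products` the sum of 4ab is at most two thirds of (c + 1) c².
sq-diff-lower : ∀ c → suc c * (c * c) ≤ 3 * ∑ (split c) (sq ∘ diff)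
sq-diff-lower c = +-cancelˡ-≤ (2 * (suc c * (c * c))) _ _ (begin
  2 * (suc c * (c * c)) + suc c * (c * c)            ≡⟨ lem₁ (suc c * (c * c)) ⟩
  3 * (suc c * (c * c))                              ≡⟨ cong (3 *_) (sym total) ⟩
  3 * (S + 4 * P)                                    ≡⟨ lem₂ S P ⟩
  2 * (6 * P) + 3 * S                                ≤⟨ +-monoˡ-≤ (3 * S) (*-monoʳ-≤ 2 (∑-products c)) ⟩
  2 * (suc c * (c * c)) + 3 * S                      ∎)
  where
  open ≤-Reasoning
  S = ∑ (split c) (sq ∘ diff)
  P = ∑< (suc c) (λ a → a * (c ∸ a))
  lem₁ : ∀ x → 2 * x + x ≡ 3 * x
  lem₁ = solve-∀
  lem₂ : ∀ s p → 3 * (s + 4 * p) ≡ 2 * (6 * p) + 3 * s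
  lem₂ = solve-∀
  total : S + 4 * P ≡ suc c * (c * c)
  total = trans (cong₂ _+_ (∑-split c (sq ∘ diff)) (sym (∑-*ˡ (upTo (suc c)) 4 (λ a → a * (c ∸ a))))) (trans (sym (∑-+ (upTo (suc c)) (λ a → sq (a ⊖ (c ∸ a))) (λ a → 4 * (a * (c ∸ a)))))
    (trans (∑<-cong (suc c) (λ a a≤c → trans (sq-⊖ a (c ∸ a)) (cong (λ x → x * x) (m+[n∸m]≡n (≤-pred a≤c))))) (∑<-const (suc c) (c * c))))

moment₂-lower : ∀ w j cs → ways cs * variation w j cs ≤ 3 * moment₂ w j cs
moment₂-lower w j []       = z≤n
moment₂-lower w j (c ∷ cs) = begin
  suc c * n * ((w j * c) * (w j * c) + v)                              ≡⟨ lem₁ (suc c) n (w j) c v ⟩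
  (w j * w j) * (suc c * (c * c)) * n + suc c * (n * v)                ≤⟨ +-mono-≤ (*-monoˡ-≤ n (*-monoʳ-≤ (w j * w j) (sq-diff-lower c))) (*-monoʳ-≤ (suc c) (moment₂-lower w (suc j) cs)) ⟩
  (w j * w j) * (3 * S) * n + suc c * (3 * moment₂ w (suc j) cs)       ≡⟨ lem₂ (w j * w j) S n (suc c) (moment₂ w (suc j) cs) ⟩
  3 * ((w j * w j) * S * n + suc c * moment₂ w (suc j) cs)             ≡⟨ cong (λ x → 3 * (x * n + suc c * moment₂ w (suc j) cs)) (sym (trans (∑-cong (split c) (λ p → sq-scale (w j) (diff p))) (∑-*ˡ (split c) (w j * w j) _))) ⟩
  3 * (∑ (split c) (λ p → sq (ℤ.+ w j ℤ.* diff p)) * n + suc c * moment₂ w (suc j) cs) ≡⟨ cong (3 *_) (sym (moment₂-step w j c cs)) ⟩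
  3 * moment₂ w j (c ∷ cs) ∎
  where
  open ≤-Reasoning
  n = ways cs
  v = variation w (suc j) cs
  S = ∑ (split c) (sq ∘ diff)
  lem₁ : ∀ c' n w c v → c' * n * ((w * c) * (w * c) + v) ≡ (w * w) * (c' * (c * c)) * n + c' * (n * v)
  lem₁ = solve-∀
  lem₂ : ∀ w s n c m → w * (3 * s) * n + c * (3 * m) ≡ 3 * (w * s * n + c * m)
  lem₂ = solve-∀

-- Anticoncentration: E Y² ≥ V/3 and E Y⁴ ≤ 3V² force |Y| > √(V/12) with probability at least 1/216.

large-deviation : ∀ w j cs → 1 ≤ variation w j cs →
  ways cs ≤ 216 * ∑ (cfgs cs) (λ x → 𝟙 (variation w j cs <? 12 * sq (dot w j x)))
large-deviation w j cs 1≤V = *-cancelˡ-≤ (3 * (V * V)) {{>-nonZero (*-mono-≤ {1} {3} (s≤s z≤n) (*-mono-≤ 1≤V 1≤V))}}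
  (+-cancelˡ-≤ (9 * (n * (V * V))) _ _ (begin
    9 * (n * (V * V)) + 3 * (V * V) * n                       ≡⟨ lem₁ n V ⟩
    12 * V * (n * V)                                          ≤⟨ *-monoʳ-≤ (12 * V) (moment₂-lower w j cs) ⟩
    12 * V * (3 * moment₂ w j cs)                             ≡⟨ lem₂ V (moment₂ w j cs) ⟩
    36 * V * moment₂ w j cs                                   ≡⟨ sym (∑-*ˡ (cfgs cs) (36 * V) _) ⟩
    ∑ (cfgs cs) (λ x → 36 * V * Y x)                          ≤⟨ ∑-mono (cfgs cs) (λ x → pointwise (Y x)) ⟩
    ∑ (cfgs cs) (λ x → 3 * (V * V) + 648 * (V * V) * I x + 2 * (Y x * Y x))
      ≡⟨ trans (∑-+ (cfgs cs) _ _) (cong₂ _+_ (trans (∑-+ (cfgs cs) _ _) (cong₂ _+_ (∑-cfgs-const cs (3 * (V * V))) (∑-*ˡ (cfgs cs) (648 * (V * V)) I))) (∑-*ˡ (cfgs cs) 2 _)) ⟩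
    n * (3 * (V * V)) + 648 * (V * V) * ∑ (cfgs cs) I + 2 * moment₄ w j cs
      ≤⟨ +-monoʳ-≤ (n * (3 * (V * V)) + 648 * (V * V) * ∑ (cfgs cs) I) (*-monoʳ-≤ 2 (moment₄-upper w j cs)) ⟩
    n * (3 * (V * V)) + 648 * (V * V) * ∑ (cfgs cs) I + 2 * (3 * (n * (V * V)))
      ≡⟨ lem₃ n V (∑ (cfgs cs) I) ⟩
    9 * (n * (V * V)) + 3 * (V * V) * (216 * ∑ (cfgs cs) I) ∎))
  where
  open ≤-Reasoning
  n = ways cs
  V = variation w j cs
  Y I : List (ℕ × ℕ) → ℕ
  Y x = sq (dot w j x)
  I x = 𝟙 (V <? 12 * Y x)
  lem₁ : ∀ n V → 9 * (n * (V * V)) + 3 * (V * V) * n ≡ 12 * V * (n * V)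
  lem₁ = solve-∀
  lem₂ : ∀ V m → 12 * V * (3 * m) ≡ 36 * V * m
  lem₂ = solve-∀
  lem₃ : ∀ n V i → n * (3 * (V * V)) + 648 * (V * V) * i + 2 * (3 * (n * (V * V))) ≡ 9 * (n * (V * V)) + 3 * (V * V) * (216 * i)
  lem₃ = solve-∀
  -- A pointwise second-moment argument with cuts at V/12 and 18V: below V/12 the left side is at
  -- most 3V², up to 18V it is at most 648V², and beyond that the fourth power pays. Summed against
  -- the moment bounds this leaves 3V² ≤ 648V² times the probability, whence 216.
  pointwise : ∀ y → 36 * V * y ≤ 3 * (V * V) + 648 * (V * V) * 𝟙 (V <? 12 * y) + 2 * (y * y)
  pointwise y with V <? 12 * y
  ... | no V≮12y = begin
    36 * V * y              ≡⟨ lem V y ⟩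
    3 * (V * (12 * y))      ≤⟨ *-monoʳ-≤ 3 (*-monoʳ-≤ V (≮⇒≥ V≮12y)) ⟩
    3 * (V * V)             ≤⟨ m≤m+n _ _ ⟩
    3 * (V * V) + 648 * (V * V) * 0 ≤⟨ m≤m+n _ _ ⟩
    3 * (V * V) + 648 * (V * V) * 0 + 2 * (y * y) ∎
    where
    lem : ∀ V y → 36 * V * y ≡ 3 * (V * (12 * y))
    lem = solve-∀
  ... | yes _ with y ≤? 18 * V
  ...   | yes y≤18V = begin
    36 * V * y              ≤⟨ *-monoʳ-≤ (36 * V) y≤18V ⟩
    36 * V * (18 * V)       ≡⟨ lem V ⟩
    648 * (V * V) * 1       ≤⟨ m≤n+m _ (3 * (V * V)) ⟩
    3 * (V * V) + 648 * (V * V) * 1 ≤⟨ m≤m+n _ _ ⟩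
    3 * (V * V) + 648 * (V * V) * 1 + 2 * (y * y) ∎
    where
    lem : ∀ V → 36 * V * (18 * V) ≡ 648 * (V * V) * 1
    lem = solve-∀
  ...   | no y≰18V = begin
    36 * V * y              ≡⟨ lem V y ⟩
    2 * (18 * V * y)        ≤⟨ *-monoʳ-≤ 2 (*-monoˡ-≤ y (<⇒≤ (≰⇒> y≰18V))) ⟩
    2 * (y * y)             ≤⟨ m≤n+m _ (3 * (V * V) + 648 * (V * V) * 1) ⟩
    3 * (V * V) + 648 * (V * V) * 1 + 2 * (y * y) ∎
    where
    lem : ∀ V y → 36 * V * y ≡ 2 * (18 * V * y)
    lem = solve-∀

-- Exchanging the two entries in every pair permutes the splittings and negates the form.
dot-sym : ∀ (f : ℤ → ℕ) w j cs → ∑ (cfgs cs) (f ∘ dot w j) ≡ ∑ (cfgs cs) (λ x → f (ℤ.- dot w j x))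
dot-sym f w j []       = refl
dot-sym f w j (c ∷ cs) = begin
  ∑ (cfgs (c ∷ cs)) (f ∘ dot w j)
    ≡⟨ ∑-cfgs c cs _ ⟩
  ∑ (split c) (λ p → ∑ (cfgs cs) (λ x → f (ℤ.+ w j ℤ.* diff p ℤ.+ dot w (suc j) x)))
    ≡⟨ ∑-cong (split c) (λ p → dot-sym (λ y → f (ℤ.+ w j ℤ.* diff p ℤ.+ y)) w (suc j) cs) ⟩
  ∑ (split c) (λ p → ∑ (cfgs cs) (λ x → f (ℤ.+ w j ℤ.* diff p ℤ.+ ℤ.- dot w (suc j) x)))
    ≡⟨ split-sym c (λ d → ∑ (cfgs cs) (λ x → f (ℤ.+ w j ℤ.* d ℤ.+ ℤ.- dot w (suc j) x))) ⟩
  ∑ (split c) (λ p → ∑ (cfgs cs) (λ x → f (ℤ.+ w j ℤ.* (ℤ.- diff p) ℤ.+ ℤ.- dot w (suc j) x)))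
    ≡⟨ ∑-cong (split c) (λ p → ∑-cong (cfgs cs) (λ x → cong f (lem (ℤ.+ w j) (diff p) (dot w (suc j) x)))) ⟩
  ∑ (split c) (λ p → ∑ (cfgs cs) (λ x → f (ℤ.- (ℤ.+ w j ℤ.* diff p ℤ.+ dot w (suc j) x))))
    ≡⟨ sym (∑-cfgs c cs _) ⟩
  ∑ (cfgs (c ∷ cs)) (λ x → f (ℤ.- dot w j x)) ∎
  where
  open ≡-Reasoning
  lem : ∀ a d y → a ℤ.* (ℤ.- d) ℤ.+ ℤ.- y ≡ ℤ.- (a ℤ.* d ℤ.+ y)
  lem = ℤ-Ring.solve-∀

-- By symmetry at least half of the 1/216 from `large-deviation` lies on the positive side, and
-- there the form exceeds m because 12 m² ≤ V.
small-probability : ∀ w j cs m → 1 ≤ variation w j cs → 12 * (m * m) ≤ variation w j cs →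
  432 * ∑ (cfgs cs) (λ x → 𝟙 (dot w j x ℤ.≤? ℤ.+ m)) ≤ 431 * ways cs
small-probability w j cs m 1≤V m≤V = +-cancelˡ-≤ n _ _ (begin
  n + 432 * S                         ≤⟨ +-monoˡ-≤ (432 * S) (large-deviation w j cs 1≤V) ⟩
  216 * ∑ (cfgs cs) (λ x → 𝟙 (V <? 12 * sq (dot w j x))) + 432 * S
                                      ≤⟨ +-monoˡ-≤ (432 * S) (*-monoʳ-≤ 216 two-sided) ⟩
  216 * (L + L) + 432 * S             ≡⟨ lem L S ⟩
  432 * (L + S)                       ≡⟨ cong (432 *_) total ⟩
  432 * n                             ∎)
  where
  open ≤-Reasoning
  n = ways cs
  V = variation w j cs
  big small : ℤ → ℕ
  big y   = 𝟙 (ℤ.+ m ℤ.<? y)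
  small y = 𝟙 (y ℤ.≤? ℤ.+ m)
  S = ∑ (cfgs cs) (small ∘ dot w j)
  L = ∑ (cfgs cs) (big ∘ dot w j)
  lem : ∀ l s → 216 * (l + l) + 432 * s ≡ 432 * (l + s)
  lem = solve-∀
  complementary : ∀ y → big y + small y ≡ 1
  complementary y with ℤ.+ m ℤ.<? y | y ℤ.≤? ℤ.+ m
  ... | yes p | yes q = ⊥-elim (ℤ.<⇒≱ p q)
  ... | yes _ | no _  = refl
  ... | no _  | yes _ = refl
  ... | no p  | no q  = ⊥-elim (q (ℤ.≮⇒≥ p))
  total : L + S ≡ n
  total = trans (sym (∑-+ (cfgs cs) _ _)) (trans (∑-cong (cfgs cs) (λ x → complementary (dot w j x))) (trans (∑-cfgs-const cs 1) (*-identityʳ n)))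
  abs-large : ∀ y → V < 12 * sq y → m < ∣ y ∣
  abs-large y p = ≰⇒> (λ q → <⇒≱ p (≤-trans (*-monoʳ-≤ 12 (*-mono-≤ q q)) m≤V))
  sides : ∀ y → 𝟙 (V <? 12 * sq y) ≤ big y + big (ℤ.- y)
  sides y with V <? 12 * sq y
  ... | no _ = z≤n
  sides (ℤ.+ k)   | yes p = ≤-trans (≤-reflexive (sym (𝟙-yes (ℤ.+ m ℤ.<? ℤ.+ k) (ℤ.+<+ (abs-large (ℤ.+ k) p))))) (m≤m+n _ _)
  sides (-[1+ k ]) | yes p = ≤-trans (≤-reflexive (sym (𝟙-yes (ℤ.+ m ℤ.<? ℤ.+ suc k) (ℤ.+<+ (abs-large -[1+ k ] p))))) (m≤n+m _ (big -[1+ k ]))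
  two-sided : ∑ (cfgs cs) (λ x → 𝟙 (V <? 12 * sq (dot w j x))) ≤ L + L
  two-sided = begin
    ∑ (cfgs cs) (λ x → 𝟙 (V <? 12 * sq (dot w j x)))              ≤⟨ ∑-mono (cfgs cs) (λ x → sides (dot w j x)) ⟩
    ∑ (cfgs cs) (λ x → big (dot w j x) + big (ℤ.- dot w j x))     ≡⟨ ∑-+ (cfgs cs) _ _ ⟩
    L + ∑ (cfgs cs) (λ x → big (ℤ.- dot w j x))                   ≡⟨ cong (L +_) (sym (dot-sym big w j cs)) ⟩
    L + L ∎

chebyshev : ∀ w j cs m → (m * m) * ∑ (cfgs cs) (λ x → 𝟙 (m * m ≤? sq (dot w j x))) ≤ ways cs * variation w j cs
chebyshev w j cs m = begin
  (m * m) * ∑ (cfgs cs) (λ x → 𝟙 (m * m ≤? sq (dot w j x)))   ≡⟨ sym (∑-*ˡ (cfgs cs) (m * m) _) ⟩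
  ∑ (cfgs cs) (λ x → (m * m) * 𝟙 (m * m ≤? sq (dot w j x)))   ≤⟨ ∑-mono (cfgs cs) (λ x → one (sq (dot w j x))) ⟩
  moment₂ w j cs                                              ≤⟨ moment₂-upper w j cs ⟩
  ways cs * variation w j cs                                  ∎
  where
  open ≤-Reasoning
  one : ∀ y → (m * m) * 𝟙 (m * m ≤? y) ≤ y
  one y with m * m ≤? y
  ... | yes p = ≤-trans (≤-reflexive (*-identityʳ _)) p
  ... | no  _ = ≤-trans (≤-reflexive (*-zeroʳ (m * m))) z≤n

-- Independence of disjoint blocks

∑-prod-++ : ∀ (xss yss : List (List A)) f → ∑ (prod (xss ++ yss)) f ≡ ∑ (prod xss) (λ x → ∑ (prod yss) (λ y → f (x ++ y)))
∑-prod-++ []         yss f = sym (+-identityʳ _)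
∑-prod-++ (xs ∷ xss) yss f = trans (∑-prod xs (xss ++ yss) f)
  (trans (∑-cong xs (λ x → ∑-prod-++ xss yss (λ y → f (x ∷ y)))) (sym (∑-prod xs xss _)))

∈-prod⁻ : ∀ {x : List A} xss → x ∈ prod xss → Pointwise _∈_ x xss
∈-prod⁻ []         (here refl) = []
∈-prod⁻ (xs ∷ xss) x∈ with find (∈-concatMap⁻ (λ a → map (a ∷_) (prod xss)) {xs} x∈)
... | a , a∈ , x∈' with ∈-map⁻ (a ∷_) x∈'
...   | y , y∈ , refl = a∈ ∷ ∈-prod⁻ xss y∈

length-cfg : ∀ {x} cs → x ∈ cfgs cs → length x ≡ length cs
length-cfg cs x∈ = trans (Pointwise-length (∈-prod⁻ (map split cs) x∈)) (length-map split cs)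

ways-++ : ∀ bs cs → ways (bs ++ cs) ≡ ways bs * ways cs
ways-++ []       cs = sym (+-identityʳ _)
ways-++ (b ∷ bs) cs = trans (cong (suc b *_) (ways-++ bs cs)) (sym (*-assoc (suc b) (ways bs) (ways cs)))

ZeroOn : (ℕ → ℕ) → ℕ → ℕ → Set
ZeroOn w j k = ∀ i → j ≤ i → i < k → w i ≡ 0

zeroOn-tail : ∀ {w j k} → ZeroOn w j k → ZeroOn w (suc j) k
zeroOn-tail z i j<i = z i (<⇒≤ j<i)

dot-zero : ∀ w j x → ZeroOn w j (j + length x) → dot w j x ≡ ℤ.+ 0
dot-zero w j []       z = refl
dot-zero w j (p ∷ xs) z = cong₂ ℤ._+_
  (trans (cong (λ u → ℤ.+ u ℤ.* diff p) (z j ≤-refl (m<m+n j (s≤s z≤n)))) (ℤ.*-zeroˡ (diff p)))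
  (dot-zero w (suc j) xs (zeroOn-tail (subst (ZeroOn w j) (+-suc j (length xs)) z)))

dot-++ : ∀ w j x y → dot w j (x ++ y) ≡ dot w j x ℤ.+ dot w (j + length x) y
dot-++ w j []       y = trans (cong (λ k → dot w k y) (sym (+-identityʳ j))) (sym (ℤ.+-identityˡ _))
dot-++ w j (p ∷ xs) y = trans (cong (λ u → ℤ.+ w j ℤ.* diff p ℤ.+ u) (trans (dot-++ w (suc j) xs y)
  (cong (λ k → dot w (suc j) xs ℤ.+ dot w k y) (sym (+-suc j (length xs))))))
  (sym (ℤ.+-assoc (ℤ.+ w j ℤ.* diff p) _ _))

dot-++ˡ : ∀ {w j} x y → ZeroOn w (j + length x) (j + length x + length y) → dot w j (x ++ y) ≡ dot w j x
dot-++ˡ {w} {j} x y z = trans (dot-++ w j x y) (trans (cong (λ u → dot w j x ℤ.+ u) (dot-zero w (j + length x) y z)) (ℤ.+-identityʳ _))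

dot-++ʳ : ∀ {w j} x y → ZeroOn w j (j + length x) → dot w j (x ++ y) ≡ dot w (j + length x) y
dot-++ʳ {w} {j} x y z = trans (dot-++ w j x y) (trans (cong (ℤ._+ dot w (j + length x) y) (dot-zero w j x z)) (ℤ.+-identityˡ _))

variation-zero : ∀ w j x → ZeroOn w j (j + length x) → variation w j x ≡ 0
variation-zero w j []       z = refl
variation-zero w j (c ∷ cs) z = cong₂ _+_
  (cong (λ u → (u * c) * (u * c)) (z j ≤-refl (m<m+n j (s≤s z≤n))))
  (variation-zero w (suc j) cs (zeroOn-tail (subst (ZeroOn w j) (+-suc j (length cs)) z)))

variation-++ : ∀ w j x y → variation w j (x ++ y) ≡ variation w j x + variation w (j + length x) y
variation-++ w j []       y = cong (λ k → variation w k y) (sym (+-identityʳ j))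
variation-++ w j (c ∷ cs) y = trans (cong ((w j * c) * (w j * c) +_) (trans (variation-++ w (suc j) cs y)
  (cong (λ k → variation w (suc j) cs + variation w k y) (sym (+-suc j (length cs))))))
  (sym (+-assoc ((w j * c) * (w j * c)) _ _))

module Blocks (b : ℕ → ℕ) (b-mono : ∀ t → b t ≤ b (suc t)) (w : ℕ → ℕ → ℕ) (m : ℕ → ℕ)
  (w-below : ∀ t i → i < b t → w t i ≡ 0) (w-above : ∀ t i → b (suc t) ≤ i → w t i ≡ 0) where

  -- Written as a product of indicators so that it factors when the list is cut between two blocks.
  AllSmall : ℕ → ℕ → ℕ → List (ℕ × ℕ) → ℕ
  AllSmall t zero    j x = 1
  AllSmall t (suc r) j x = 𝟙 (dot (w t) j x ℤ.≤? ℤ.+ m t) * AllSmall (suc t) r j x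

  b-mono* : ∀ t i → b t ≤ b (t + i)
  b-mono* t zero    = ≤-reflexive (cong b (sym (+-identityʳ t)))
  b-mono* t (suc i) = ≤-trans (b-mono* t i) (≤-trans (b-mono (t + i)) (≤-reflexive (cong b (sym (+-suc t i)))))

  AllSmall-++ʳ : ∀ t r j x y → j + length x ≤ b t → AllSmall t r j (x ++ y) ≡ AllSmall t r (j + length x) y
  AllSmall-++ʳ t zero    j x y le = refl
  AllSmall-++ʳ t (suc r) j x y le = cong₂ _*_
    (cong (λ u → 𝟙 (u ℤ.≤? ℤ.+ m t)) (dot-++ʳ x y (λ i _ i< → w-below t i (<-≤-trans i< le))))
    (AllSmall-++ʳ (suc t) r j x y (≤-trans le (b-mono t)))

  -- Since `w t` vanishes outside its block, cutting the list at the end of that block separates the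
  -- variables: the first indicator depends on `take` alone, the later ones on `drop` alone. Each
  -- block contributes one factor 431/432.
  independence : ∀ r t cs → b (t + r) ≤ b t + length cs →
    (∀ i → t ≤ i → i < t + r → 1 ≤ variation (w i) (b t) cs × 12 * (m i * m i) ≤ variation (w i) (b t) cs) →
    432 ^ r * ∑ (cfgs cs) (AllSmall t r (b t)) ≤ 431 ^ r * ways cs
  independence zero    t cs le hyp = ≤-reflexive (trans (+-identityʳ _) (trans (∑-cfgs-const cs 1) (*-comm (ways cs) 1)))
  independence (suc r) t cs le hyp = begin
    432 * 432 ^ r * ∑ (cfgs cs) (AllSmall t (suc r) (b t))
      ≡⟨ cong (432 * 432 ^ r *_) factor ⟩
    432 * 432 ^ r * (P * ∑ (cfgs ds) (AllSmall (suc t) r (b (suc t))))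
      ≡⟨ lem 432 (432 ^ r) P _ ⟩
    (432 * P) * (432 ^ r * ∑ (cfgs ds) (AllSmall (suc t) r (b (suc t))))
      ≤⟨ *-mono-≤ (small-probability (w t) (b t) bs (m t) (proj₁ first) (proj₂ first)) (independence r (suc t) ds le' hyp') ⟩
    (431 * ways bs) * (431 ^ r * ways ds)
      ≡⟨ lem' 431 (ways bs) (431 ^ r) (ways ds) ⟩
    431 * 431 ^ r * (ways bs * ways ds)
      ≡⟨ cong (431 * 431 ^ r *_) (trans (sym (ways-++ bs ds)) (cong ways (take++drop≡id ℓ cs))) ⟩
    431 * 431 ^ r * ways cs ∎
    where
    open ≤-Reasoning
    lem : ∀ k a p q → k * a * (p * q) ≡ (k * p) * (a * q)
    lem = solve-∀
    lem' : ∀ k p a q → (k * p) * (a * q) ≡ k * a * (p * q)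
    lem' = solve-∀
    ℓ = b (suc t) ∸ b t
    bs = take ℓ cs
    ds = drop ℓ cs
    b+ℓ : b t + ℓ ≡ b (suc t)
    b+ℓ = m+[n∸m]≡n (b-mono t)
    ℓ≤ : ℓ ≤ length cs
    ℓ≤ = +-cancelˡ-≤ (b t) _ _ (≤-trans (≤-reflexive b+ℓ) (≤-trans (b-mono* (suc t) r) (≤-trans (≤-reflexive (cong b (sym (+-suc t r)))) le)))
    len-bs : length bs ≡ ℓ
    len-bs = trans (length-take ℓ cs) (m≤n⇒m⊓n≡m ℓ≤)
    next : b t + length bs ≡ b (suc t)
    next = trans (cong (b t +_) len-bs) b+ℓ
    P = ∑ (cfgs bs) (λ x → 𝟙 (dot (w t) (b t) x ℤ.≤? ℤ.+ m t))
    factor : ∑ (cfgs cs) (AllSmall t (suc r) (b t)) ≡ P * ∑ (cfgs ds) (AllSmall (suc t) r (b (suc t)))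
    factor = begin-equality
      ∑ (cfgs cs) f
        ≡⟨ cong (λ l → ∑ (cfgs l) f) (sym (take++drop≡id ℓ cs)) ⟩
      ∑ (cfgs (bs ++ ds)) f
        ≡⟨ cong (λ l → ∑ (prod l) f) (map-++ split bs ds) ⟩
      ∑ (prod (map split bs ++ map split ds)) f
        ≡⟨ ∑-prod-++ (map split bs) (map split ds) f ⟩
      ∑ (cfgs bs) (λ x → ∑ (cfgs ds) (λ y → f (x ++ y)))
        ≡⟨ ∑-cong∈ (cfgs bs) (λ {x} x∈ → let e = trans (cong (b t +_) (length-cfg bs x∈)) next in
             trans (∑-cong (cfgs ds) (λ y → cong₂ _*_
               (cong (λ u → 𝟙 (u ℤ.≤? ℤ.+ m t)) (dot-++ˡ x y (λ i le _ → w-above t i (≤-trans (≤-reflexive (sym e)) le))))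
               (trans (AllSmall-++ʳ (suc t) r (b t) x y (≤-reflexive e)) (cong (λ k → AllSmall (suc t) r k y) e))))
             (∑-*ˡ (cfgs ds) (𝟙 (dot (w t) (b t) x ℤ.≤? ℤ.+ m t)) _)) ⟩
      ∑ (cfgs bs) (λ x → 𝟙 (dot (w t) (b t) x ℤ.≤? ℤ.+ m t) * ∑ (cfgs ds) (AllSmall (suc t) r (b (suc t))))
        ≡⟨ ∑-*ʳ (cfgs bs) _ _ ⟩
      P * ∑ (cfgs ds) (AllSmall (suc t) r (b (suc t))) ∎
      where f = AllSmall t (suc r) (b t)
    var : ∀ i → variation (w i) (b t) cs ≡ variation (w i) (b t) bs + variation (w i) (b (suc t)) ds
    var i = trans (cong (variation (w i) (b t)) (sym (take++drop≡id ℓ cs))) (trans (variation-++ (w i) (b t) bs ds)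
      (cong (λ k → variation (w i) (b t) bs + variation (w i) k ds) next))
    var-first : variation (w t) (b t) cs ≡ variation (w t) (b t) bs
    var-first = trans (var t) (trans (cong (variation (w t) (b t) bs +_) (variation-zero (w t) (b (suc t)) ds (λ i le _ → w-above t i le))) (+-identityʳ _))
    var-later : ∀ i → suc t ≤ i → variation (w i) (b t) cs ≡ variation (w i) (b (suc t)) ds
    var-later i t<i = trans (var i) (cong (_+ variation (w i) (b (suc t)) ds) (variation-zero (w i) (b t) bs
      (λ k _ k< → w-below i k (<-≤-trans k< (≤-trans (≤-reflexive next) (≤-trans (b-mono* (suc t) (i ∸ suc t)) (≤-reflexive (cong b (m+[n∸m]≡n t<i)))))))))
    first : 1 ≤ variation (w t) (b t) bs × 12 * (m t * m t) ≤ variation (w t) (b t) bs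
    first = subst (λ v → 1 ≤ v × 12 * (m t * m t) ≤ v) var-first (hyp t ≤-refl (m<m+n t (s≤s z≤n)))
    hyp' : ∀ i → suc t ≤ i → i < suc t + r → 1 ≤ variation (w i) (b (suc t)) ds × 12 * (m i * m i) ≤ variation (w i) (b (suc t)) ds
    hyp' i t<i i< = subst (λ v → 1 ≤ v × 12 * (m i * m i) ≤ v) (var-later i t<i) (hyp i (<⇒≤ t<i) (<-≤-trans i< (≤-reflexive (sym (+-suc t r)))))
    le' : b (suc t + r) ≤ b (suc t) + length ds
    le' = begin
      b (suc t + r)                     ≡⟨ cong b (sym (+-suc t r)) ⟩
      b (t + suc r)                     ≤⟨ le ⟩
      b t + length cs                   ≡⟨ cong (λ l → b t + length l) (sym (take++drop≡id ℓ cs)) ⟩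
      b t + length (bs ++ ds)           ≡⟨ cong (b t +_) (length-++ bs) ⟩
      b t + (length bs + length ds)     ≡⟨ sym (+-assoc (b t) _ _) ⟩
      b t + length bs + length ds       ≡⟨ cong (_+ length ds) next ⟩
      b (suc t) + length ds             ∎

  -- A union bound in indicator form: if no R i is positive, the alternative makes every block
  -- small.
  some-large : (R : ℕ → ℕ) → ∀ r t j x →
    (∀ i → t ≤ i → i < t + r → dot (w i) j x ℤ.≤ ℤ.+ m i ⊎ 1 ≤ R i) → 1 ≤ AllSmall t r j x + ∑< r (λ i → R (t + i))
  some-large R zero    t j x h = ≤-refl
  some-large R (suc r) t j x h with h t ≤-refl (m<m+n t (s≤s z≤n))
  ... | inj₂ 1≤R = begin
    1                                                             ≤⟨ 1≤R ⟩
    R t                                                           ≡⟨ cong R (sym (+-identityʳ t)) ⟩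
    R (t + 0)                                                     ≤⟨ m≤m+n _ _ ⟩
    R (t + 0) + ∑< r (λ i → R (t + suc i))                        ≡⟨ sym (∑<-front r (λ i → R (t + i))) ⟩
    ∑< (suc r) (λ i → R (t + i))                                  ≤⟨ m≤n+m _ (AllSmall t (suc r) j x) ⟩
    AllSmall t (suc r) j x + ∑< (suc r) (λ i → R (t + i))         ∎
    where open ≤-Reasoning
  ... | inj₁ small = begin
    1                                                             ≤⟨ some-large R r (suc t) j x (λ i t<i i< → h i (<⇒≤ t<i) (<-≤-trans i< (≤-reflexive (sym (+-suc t r))))) ⟩
    AllSmall (suc t) r j x + ∑< r (λ i → R (suc t + i))           ≤⟨ +-mono-≤
         (≤-reflexive (sym (trans (cong (_* AllSmall (suc t) r j x) (𝟙-yes (dot (w t) j x ℤ.≤? ℤ.+ m t) small)) (*-identityˡ _))))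
         (≤-trans (≤-reflexive (∑-cong (upTo r) (λ i → cong R (sym (+-suc t i))))) (≤-trans (m≤n+m _ (R (t + 0))) (≤-reflexive (sym (∑<-front r (λ i → R (t + i))))))) ⟩
    AllSmall t (suc r) j x + ∑< (suc r) (λ i → R (t + i))         ∎
    where open ≤-Reasoning

-- Degree sequences

∑≡sum : ∀ (f : A → ℕ) xs → sum (map f xs) ≡ ∑ xs f
∑≡sum f []       = refl
∑≡sum f (x ∷ xs) = cong (f x +_) (∑≡sum f xs)

∑-allFin : ∀ m (f : Fin (suc m) → ℕ) → ∑ (allFin (suc m)) f ≡ f Fin.zero + ∑ (allFin m) (f ∘ Fin.suc)
∑-allFin m f = cong (f Fin.zero +_) (trans (cong (λ l → ∑ l f) (sym (map-tabulate id Fin.suc))) (∑-map Fin.suc (allFin m) f))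

𝟙-cong : ∀ {P Q : Set} (p : Dec P) (q : Dec Q) → (P → Q) → (Q → P) → 𝟙 p ≡ 𝟙 q
𝟙-cong (yes p) q f g = sym (𝟙-yes q (f p))
𝟙-cong (no ¬p) q f g = sym (𝟙-no q (¬p ∘ g))

𝟙-suc : ∀ i k → 𝟙 (suc i <? suc k) ≡ 𝟙 (i <? k)
𝟙-suc i k = 𝟙-cong (suc i <? suc k) (i <? k) ≤-pred s≤s

count-first : ∀ m k → ∑ (allFin m) (λ i → 𝟙 (toℕ i <? k)) ≤ k
count-first zero    k       = z≤n
count-first (suc m) zero    = ≤-reflexive (∑-zero (allFin (suc m)) (λ _ → refl))
count-first (suc m) (suc k) = begin
  ∑ (allFin (suc m)) (λ i → 𝟙 (toℕ i <? suc k))       ≡⟨ ∑-allFin m (λ i → 𝟙 (toℕ i <? suc k)) ⟩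
  1 + ∑ (allFin m) (λ i → 𝟙 (suc (toℕ i) <? suc k))   ≡⟨ cong suc (∑-cong (allFin m) (λ i → 𝟙-suc (toℕ i) k)) ⟩
  1 + ∑ (allFin m) (λ i → 𝟙 (toℕ i <? k))             ≤⟨ s≤s (count-first m k) ⟩
  suc k ∎
  where open ≤-Reasoning

∑-lookup : ∀ (l : List ℕ) f → ∑ (allFin (length l)) (f ∘ lookup l) ≡ ∑ l f
∑-lookup []      f = refl
∑-lookup (x ∷ l) f = trans (∑-allFin (length l) _) (cong (f x +_) (∑-lookup l f))

∑-take : ∀ k l → ∑ (allFin (length l)) (λ i → 𝟙 (toℕ i <? k) * lookup l i) ≡ sum (take k l)
∑-take zero    l       = ∑-zero (allFin (length l)) (λ _ → refl)
∑-take (suc k) []      = refl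
∑-take (suc k) (x ∷ l) = trans (∑-allFin (length l) _) (cong₂ _+_ (*-identityˡ x)
  (trans (∑-cong (allFin (length l)) (λ i → cong (_* lookup l i) (𝟙-suc (toℕ i) k))) (∑-take k l)))

-- Count the adjacent pairs (i, j) with i among the first k vertices: each j occurs in at most as
-- many as its degree, and in at most k. For a partition and k up to its Durfee size this is the
-- Erdős-Gallai inequality with k² in place of k(k - 1).
graphical-dominated : ∀ l k → IsGraphical l → sum (take k l) ≤ ∑ l (_⊓ k)
graphical-dominated l k (Γ , deg) = begin
  sum (take k l)                                        ≡⟨ sym (∑-take k l) ⟩
  ∑ V (λ i → I i * lookup l i)                          ≡⟨ ∑-cong V (λ i → cong (I i *_) (trans (sym (deg i)) (∑≡sum (e i) V))) ⟩
  ∑ V (λ i → I i * ∑ V (e i))                           ≡⟨ ∑-cong V (λ i → sym (∑-*ˡ V (I i) (e i))) ⟩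
  ∑ V (λ i → ∑ V (λ j → I i * e i j))                   ≡⟨ ∑-swap V V _ ⟩
  ∑ V (λ j → ∑ V (λ i → I i * e i j))                   ≤⟨ ∑-mono V (λ j → ⊓-glb (by-degree j) (by-k j)) ⟩
  ∑ V (λ j → lookup l j ⊓ k)                            ≡⟨ ∑-lookup l (_⊓ k) ⟩
  ∑ l (_⊓ k) ∎
  where
  open ≤-Reasoning
  V = allFin (length l)
  e : Fin (length l) → Fin (length l) → ℕ
  e i j = if adj Γ i j then 1 else 0
  I : Fin (length l) → ℕ
  I i = 𝟙 (toℕ i <? k)
  e≤1 : ∀ i j → e i j ≤ 1
  e≤1 i j with adj Γ i j
  ... | true  = ≤-refl
  ... | false = z≤n
  by-degree : ∀ j → ∑ V (λ i → I i * e i j) ≤ lookup l j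
  by-degree j = begin
    ∑ V (λ i → I i * e i j)  ≤⟨ ∑-mono V (λ i → ≤-trans (*-monoˡ-≤ (e i j) (𝟙≤1 (toℕ i <? k))) (≤-reflexive (*-identityˡ _))) ⟩
    ∑ V (λ i → e i j)        ≡⟨ ∑-cong V (λ i → cong (λ b → if b then 1 else 0) (SimpleGraph.sym Γ i j)) ⟩
    ∑ V (e j)                ≡⟨ sym (∑≡sum (e j) V) ⟩
    degree Γ j               ≡⟨ deg j ⟩
    lookup l j               ∎
  by-k : ∀ j → ∑ V (λ i → I i * e i j) ≤ k
  by-k j = ≤-trans (∑-mono V (λ i → ≤-trans (*-monoʳ-≤ (I i) (e≤1 i j)) (≤-reflexive (*-identityʳ _)))) (count-first (length l) k)

-- The Durfee code: d rows of length d + Σ_{j ≥ i} A_j, followed by B_j rows of length j for j = d, ..., 1.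

top : ℕ → List ℕ → List ℕ
top d []       = []
top d (a ∷ as) = (d + (a + sum as)) ∷ top d as

bot : ℕ → List ℕ → List ℕ
bot j []       = []
bot j (b ∷ bs) = bot (suc j) bs ++ replicate b j

decode : List (ℕ × ℕ) → List ℕ
decode xs = top (length xs) (map proj₁ xs) ++ bot 1 (map proj₂ xs)

lin : (ℕ → ℕ) → ℕ → List ℕ → ℕ
lin w j []       = 0
lin w j (a ∷ as) = w j * a + lin w (suc j) as

length-top : ∀ d as → length (top d as) ≡ length as
length-top d []       = refl
length-top d (a ∷ as) = cong suc (length-top d as)

lin-⊓-suc : ∀ k j as → lin (_⊓ suc k) (suc j) as ≡ sum as + lin (_⊓ k) j as
lin-⊓-suc k j []       = refl
lin-⊓-suc k j (a ∷ as) = trans (cong (suc (j ⊓ k) * a +_) (lin-⊓-suc k (suc j) as)) (lem a (j ⊓ k * a) (sum as) _)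
  where
  lem : ∀ a b s l → a + b + (s + l) ≡ a + s + (b + l)
  lem = solve-∀

-- A column of height j meets min(j, k) of the first k rows. Removing the top row lowers all heights
-- by one, which is `lin-⊓-suc`.
sum-take-top : ∀ d k as → k ≤ length as → sum (take k (top d as)) ≡ k * d + lin (_⊓ k) 1 as
sum-take-top d zero    as       _ = sym (zero-lin 1 as)
  where
  zero-lin : ∀ j as → lin (_⊓ 0) j as ≡ 0
  zero-lin j []       = refl
  zero-lin j (a ∷ as) = cong₂ _+_ (cong (_* a) (⊓-zeroʳ j)) (zero-lin (suc j) as)
sum-take-top d (suc k) (a ∷ as) (s≤s k≤) = begin
  d + (a + sum as) + sum (take k (top d as))           ≡⟨ cong (d + (a + sum as) +_) (sum-take-top d k as k≤) ⟩
  d + (a + sum as) + (k * d + lin (_⊓ k) 1 as)         ≡⟨ lem d a (sum as) (k * d) _ ⟩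
  d + k * d + (1 * a + (sum as + lin (_⊓ k) 1 as))     ≡⟨ cong (λ x → d + k * d + (1 * a + x)) (sym (lin-⊓-suc k 1 as)) ⟩
  d + k * d + (1 * a + lin (_⊓ suc k) 2 as)            ∎
  where
  open ≡-Reasoning
  lem : ∀ d a s e l → d + (a + s) + (e + l) ≡ d + e + (1 * a + (s + l))
  lem = solve-∀

∑-replicate : ∀ b j (f : ℕ → ℕ) → ∑ (replicate b j) f ≡ f j * b
∑-replicate zero    j f = sym (*-zeroʳ (f j))
∑-replicate (suc b) j f = trans (cong (f j +_) (∑-replicate b j f)) (sym (*-suc (f j) b))

∑-bot : ∀ j bs f → ∑ (bot j bs) f ≡ lin f j bs
∑-bot j []       f = refl
∑-bot j (b ∷ bs) f = trans (∑-++ (bot (suc j) bs) (replicate b j) f)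
  (trans (cong₂ _+_ (∑-bot (suc j) bs f) (∑-replicate b j f)) (+-comm _ (f j * b)))

sum-take-++ : ∀ k (xs ys : List ℕ) → sum (take k xs) ≤ sum (take k (xs ++ ys))
sum-take-++ zero    xs       ys = z≤n
sum-take-++ (suc k) []       ys = z≤n
sum-take-++ (suc k) (x ∷ xs) ys = +-monoʳ-≤ x (sum-take-++ k xs ys)

dot≡lin : ∀ w j xs → dot w j xs ≡ ℤ.+ lin w j (map proj₁ xs) ℤ.- ℤ.+ lin w j (map proj₂ xs)
dot≡lin w j []             = refl
dot≡lin w j ((a , b) ∷ xs) = begin
  ℤ.+ w j ℤ.* (a ⊖ b) ℤ.+ dot w (suc j) xs
    ≡⟨ cong₂ (λ x y → ℤ.+ w j ℤ.* x ℤ.+ y) (sym (ℤ.m-n≡m⊖n a b)) (dot≡lin w (suc j) xs) ⟩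
  ℤ.+ w j ℤ.* (ℤ.+ a ℤ.- ℤ.+ b) ℤ.+ (ℤ.+ α ℤ.- ℤ.+ β)
    ≡⟨ lem (ℤ.+ w j) (ℤ.+ a) (ℤ.+ b) (ℤ.+ α) (ℤ.+ β) ⟩
  (ℤ.+ w j ℤ.* ℤ.+ a ℤ.+ ℤ.+ α) ℤ.- (ℤ.+ w j ℤ.* ℤ.+ b ℤ.+ ℤ.+ β)
    ≡⟨ cong₂ (λ x y → (x ℤ.+ ℤ.+ α) ℤ.- (y ℤ.+ ℤ.+ β)) (sym (ℤ.pos-* (w j) a)) (sym (ℤ.pos-* (w j) b)) ⟩
  ℤ.+ (w j * a + α) ℤ.- ℤ.+ (w j * b + β) ∎
  where
  open ≡-Reasoning
  α = lin w (suc j) (map proj₁ xs)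
  β = lin w (suc j) (map proj₂ xs)
  lem : ∀ w a b x y → w ℤ.* (a ℤ.- b) ℤ.+ (x ℤ.- y) ≡ (w ℤ.* a ℤ.+ x) ℤ.- (w ℤ.* b ℤ.+ y)
  lem = ℤ-Ring.solve-∀

-- The d top rows add at most d k to the right-hand side, which cancels the k d cells of the square
-- in the first k rows. What remains compares the A_j with the B_j under the same weights min(j, k).
graphical⇒dot≤0 : ∀ xs k → k ≤ length xs → IsGraphical (decode xs) → dot (_⊓ k) 1 xs ℤ.≤ ℤ.+ 0
graphical⇒dot≤0 xs k k≤d gr = subst (ℤ._≤ ℤ.+ 0) (sym (dot≡lin (_⊓ k) 1 xs)) (ℤ.i≤j⇒i-j≤0 (ℤ.+≤+ (+-cancelˡ-≤ (k * d) _ _ (begin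
  k * d + lin (_⊓ k) 1 as                       ≡⟨ sym (sum-take-top d k as (≤-trans k≤d (≤-reflexive (sym (length-map proj₁ xs))))) ⟩
  sum (take k (top d as))                       ≤⟨ sum-take-++ k (top d as) (bot 1 bs) ⟩
  sum (take k (decode xs))                      ≤⟨ graphical-dominated (decode xs) k gr ⟩
  ∑ (decode xs) (_⊓ k)                          ≡⟨ ∑-++ (top d as) (bot 1 bs) _ ⟩
  ∑ (top d as) (_⊓ k) + ∑ (bot 1 bs) (_⊓ k)     ≤⟨ +-mono-≤ (∑-bound (top d as) k (λ {x} _ → m⊓n≤n x k)) (≤-reflexive (∑-bot 1 bs _)) ⟩
  length (top d as) * k + lin (_⊓ k) 1 bs       ≡⟨ cong (λ x → x * k + lin (_⊓ k) 1 bs) (trans (length-top d as) (length-map proj₁ xs)) ⟩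
  d * k + lin (_⊓ k) 1 bs                       ≡⟨ cong (_+ lin (_⊓ k) 1 bs) (*-comm d k) ⟩
  k * d + lin (_⊓ k) 1 bs                       ∎))))
  where
  open ≤-Reasoning
  d = length xs
  as = map proj₁ xs
  bs = map proj₂ xs

top≥ : ∀ d as → All (d ≤_) (top d as)
top≥ d []       = []
top≥ d (a ∷ as) = m≤m+n d _ ∷ top≥ d as

bot-range : ∀ j bs → All (λ x → j ≤ x × x < j + length bs) (bot j bs)
bot-range j []       = []
bot-range j (b ∷ bs) = All.++⁺ (All.map (λ (p , q) → <⇒≤ p , <-≤-trans q (≤-reflexive (sym (+-suc j (length bs))))) (bot-range (suc j) bs))
  (All.replicate⁺ b (≤-refl , m<m+n j (s≤s z≤n)))

top-injective : ∀ d as as' → top d as ≡ top d as' → as ≡ as'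
top-injective d []       []         _ = refl
top-injective d (a ∷ as) (a' ∷ as') e with ∷-injective e
... | p , q with top-injective d as as' q
...   | refl = cong (_∷ as) (+-cancelʳ-≡ (sum as) a a' (+-cancelˡ-≡ d _ _ p))

-- Entries equal to j come only from the last stretch, so their number recovers b.
bot-injective : ∀ j bs bs' → length bs ≡ length bs' → bot j bs ≡ bot j bs' → bs ≡ bs'
bot-injective j []       []         _ _ = refl
bot-injective j (b ∷ bs) (b' ∷ bs') l e with mult j b bs | mult j b' bs'
  where
  mult : ∀ j b bs → ∑ (bot j (b ∷ bs)) (λ x → 𝟙 (x ≟ j)) ≡ b
  mult j b bs = trans (∑-++ (bot (suc j) bs) (replicate b j) _) (cong₂ _+_
    (∑-zero (bot (suc j) bs) (λ {x} x∈ → 𝟙-no (x ≟ j) (λ { refl → <-irrefl refl (proj₁ (All.lookup (bot-range (suc j) bs) x∈)) })))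
    (trans (∑-replicate b j _) (trans (cong (_* b) (𝟙-yes (j ≟ j) refl)) (*-identityˡ b))))
... | p | q with trans (sym p) (trans (cong (λ l → ∑ l (λ x → 𝟙 (x ≟ j))) e) q)
...   | refl = cong (b ∷_) (bot-injective (suc j) bs bs' (suc-injective l) (++-cancelʳ (replicate b j) (bot (suc j) bs) (bot (suc j) bs') e))

zip-injective : ∀ (xs ys : List (ℕ × ℕ)) → map proj₁ xs ≡ map proj₁ ys → map proj₂ xs ≡ map proj₂ ys → xs ≡ ys
zip-injective []             []             _ _ = refl
zip-injective ((a , b) ∷ xs) ((c , d) ∷ ys) p q with ∷-injective p | ∷-injective q
... | refl , p' | refl , q' = cong ((a , b) ∷_) (zip-injective xs ys p' q')

++-split : ∀ (xs xs' : List A) {ys ys'} → length xs ≡ length xs' → xs ++ ys ≡ xs' ++ ys' → xs ≡ xs' × ys ≡ ys'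
++-split []       []         _ e = refl , e
++-split (x ∷ xs) (x' ∷ xs') l e with ∷-injective e
... | refl , e' with ++-split xs xs' (suc-injective l) e'
...   | refl , e'' = refl , e''

-- If d < d', row d + 1 would be at most d and at least d'.
durfee-unique : ∀ (τ τ' : List ℕ) {β β'} d d' → length τ ≡ d → length τ' ≡ d' → All (d' ≤_) τ' → All (_≤ d) β →
  τ ++ β ≡ τ' ++ β' → d' ≤ d
durfee-unique τ τ' {β} d d' lt lt' ge le e with d' ≤? d
... | yes p = p
... | no ¬p = meet τ τ' ge e (≤-<-trans (≤-reflexive lt) (<-≤-trans (≰⇒> ¬p) (≤-reflexive (sym lt'))))
  where
  meet : ∀ (τ τ' : List ℕ) {β'} → All (d' ≤_) τ' → τ ++ β ≡ τ' ++ β' → length τ < length τ' → d' ≤ d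
  meet []      (t ∷ τ') (p ∷ _)  refl _       = ≤-trans p (All.head le)
  meet (x ∷ τ) (t ∷ τ') (_ ∷ ps) e    (s≤s l) = meet τ τ' ps (proj₂ (∷-injective e)) l

-- `durfee-unique` in both directions fixes the place of the cut; the two halves are then decoded
-- separately.
decode-injective : ∀ xs ys → decode xs ≡ decode ys → xs ≡ ys
decode-injective xs ys e = zip-injective xs ys (top-injective dx _ _ (trans (proj₁ parts) (cong (λ d → top d (map proj₁ ys)) (sym dd))))
    (bot-injective 1 _ _ (trans (length-map proj₂ xs) (trans dd (sym (length-map proj₂ ys)))) (proj₂ parts))
  where
  dx = length xs
  dy = length ys
  lenT : ∀ zs → length (top (length zs) (map proj₁ zs)) ≡ length zs
  lenT zs = trans (length-top (length zs) (map proj₁ zs)) (length-map proj₁ zs)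
  small : ∀ zs → All (_≤ length zs) (bot 1 (map proj₂ zs))
  small zs = All.map (λ (_ , q) → ≤-trans (≤-pred q) (≤-reflexive (length-map proj₂ zs))) (bot-range 1 (map proj₂ zs))
  dd : dx ≡ dy
  dd = ≤-antisym (durfee-unique (top dy (map proj₁ ys)) (top dx (map proj₁ xs)) dy dx (lenT ys) (lenT xs) (top≥ dx _) (small ys) (sym e))
                 (durfee-unique (top dx (map proj₁ xs)) (top dy (map proj₁ ys)) dx dy (lenT xs) (lenT ys) (top≥ dy _) (small xs) e)
  parts = ++-split (top dx (map proj₁ xs)) (top dy (map proj₁ ys)) (trans (lenT xs) (trans dd (sym (lenT ys)))) e

size-suc : ∀ j as → size (suc j) as ≡ sum as + size j as
size-suc j []       = refl
size-suc j (a ∷ as) = trans (cong (suc j * a +_) (size-suc (suc j) as)) (lem a (j * a) (sum as) _)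
  where
  lem : ∀ a b s l → a + b + (s + l) ≡ a + s + (b + l)
  lem = solve-∀

sum-top : ∀ d as → sum (top d as) ≡ length as * d + size 1 as
sum-top d []       = refl
sum-top d (a ∷ as) = begin
  d + (a + sum as) + sum (top d as)                       ≡⟨ cong (d + (a + sum as) +_) (sum-top d as) ⟩
  d + (a + sum as) + (length as * d + size 1 as)          ≡⟨ lem d a (sum as) (length as * d) _ ⟩
  d + length as * d + (1 * a + (sum as + size 1 as))      ≡⟨ cong (λ x → d + length as * d + (1 * a + x)) (sym (size-suc 1 as)) ⟩
  d + length as * d + (1 * a + size 2 as)                 ∎
  where
  open ≡-Reasoning
  lem : ∀ d a s e l → d + (a + s) + (e + l) ≡ d + e + (1 * a + (s + l))
  lem = solve-∀

sum-bot : ∀ j bs → sum (bot j bs) ≡ size j bs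
sum-bot j []       = refl
sum-bot j (b ∷ bs) = trans (sum-++ (bot (suc j) bs) (replicate b j))
  (trans (cong₂ _+_ (sum-bot (suc j) bs) (sum-replicate b)) (+-comm _ (j * b)))
  where
  sum-replicate : ∀ b → sum (replicate b j) ≡ j * b
  sum-replicate zero    = sym (*-zeroʳ j)
  sum-replicate (suc b) = trans (cong (j +_) (sum-replicate b)) (sym (*-suc j b))

merge : List (ℕ × ℕ) → List ℕ
merge = map (uncurry _+_)

size-merge : ∀ j xs → size j (map proj₁ xs) + size j (map proj₂ xs) ≡ size j (merge xs)
size-merge j []             = refl
size-merge j ((a , b) ∷ xs) = trans (lem j a b _ _) (cong (j * (a + b) +_) (size-merge (suc j) xs))
  where
  lem : ∀ j a b x y → j * a + x + (j * b + y) ≡ j * (a + b) + (x + y)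
  lem = solve-∀

sum-decode : ∀ xs → sum (decode xs) ≡ length xs * length xs + size 1 (merge xs)
sum-decode xs = begin
  sum (top d as ++ bot 1 bs)                   ≡⟨ sum-++ (top d as) (bot 1 bs) ⟩
  sum (top d as) + sum (bot 1 bs)              ≡⟨ cong₂ _+_ (trans (sum-top d as) (cong (λ x → x * d + size 1 as) (length-map proj₁ xs))) (sum-bot 1 bs) ⟩
  d * d + size 1 as + size 1 bs                ≡⟨ +-assoc (d * d) _ _ ⟩
  d * d + (size 1 as + size 1 bs)              ≡⟨ cong (d * d +_) (size-merge 1 xs) ⟩
  d * d + size 1 (merge xs)                    ∎
  where
  open ≡-Reasoning
  d = length xs
  as = map proj₁ xs
  bs = map proj₂ xs

top-sorted : ∀ d as → AllPairs _≥_ (top d as)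
top-sorted d []       = []
top-sorted d (a ∷ as) = All.map (λ p → ≤-trans p (+-monoʳ-≤ d (m≤n+m (sum as) a))) (below as) ∷ top-sorted d as
  where
  below : ∀ as → All (_≤ d + sum as) (top d as)
  below []       = []
  below (a ∷ as) = ≤-refl ∷ All.map (λ p → ≤-trans p (+-monoʳ-≤ d (m≤n+m (sum as) a))) (below as)

bot-sorted : ∀ j bs → AllPairs _≥_ (bot j bs)
bot-sorted j []       = []
bot-sorted j (b ∷ bs) = AllPairs.++⁺ (bot-sorted (suc j) bs) (constant b)
  (All.map (λ (p , _) → All.replicate⁺ b (<⇒≤ p)) (bot-range (suc j) bs))
  where
  constant : ∀ b → AllPairs _≥_ (replicate b j)
  constant zero    = []
  constant (suc b) = All.replicate⁺ b ≤-refl ∷ constant b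

decode-partition : ∀ xs → IsPartition (length xs * length xs + size 1 (merge xs)) (decode xs)
decode-partition xs = All.++⁺ (positive xs) (All.map proj₁ (bot-range 1 (map proj₂ xs))) ,
  Linked.AllPairs⇒Linked (AllPairs.++⁺ (top-sorted d (map proj₁ xs)) (bot-sorted 1 (map proj₂ xs))
    (All.map (λ p → All.map (λ (_ , q) → ≤-trans (≤-pred q) (≤-trans (≤-reflexive (length-map proj₂ xs)) p)) (bot-range 1 (map proj₂ xs))) (top≥ d (map proj₁ xs)))) ,
  sum-decode xs
  where
  d = length xs
  positive : ∀ xs → All (1 ≤_) (top (length xs) (map proj₁ xs))
  positive []       = []
  positive (x ∷ xs) = All.map (≤-trans (s≤s z≤n)) (top≥ (suc (length xs)) (map proj₁ (x ∷ xs)))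

-- The offset i counts the rows already taken into the square, whose final side is therefore i +
-- length τ. The search stops at the first row of length at most i.
durfee : ∀ i l → AllPairs _≥_ l → ∃ λ τ → ∃ λ β → l ≡ τ ++ β × All (i + length τ ≤_) τ × All (_≤ i + length τ) β
durfee i []      _ = [] , [] , refl , [] , []
durfee i (x ∷ l) (ps ∷ srt) with x ≤? i
... | yes x≤i = [] , x ∷ l , refl , [] , All.map (λ q → ≤-trans q (≤-reflexive (sym (+-identityʳ i)))) (x≤i ∷ All.map (λ p → ≤-trans p x≤i) ps)
... | no  x≰i with durfee (suc i) l srt
...   | τ , β , refl , big , small = x ∷ τ , β , refl ,
        subst (λ k → All (k ≤_) (x ∷ τ)) (sym (+-suc i (length τ))) (head τ ps big ∷ big) ,
        subst (λ k → All (_≤ k) β) (sym (+-suc i (length τ))) small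
  where
  head : ∀ τ {β} → All (x ≥_) (τ ++ β) → All (suc i + length τ ≤_) τ → suc i + length τ ≤ x
  head []      _       _       = ≤-trans (≤-reflexive (+-identityʳ (suc i))) (≰⇒> x≰i)
  head (t ∷ τ) (p ∷ _) (q ∷ _) = ≤-trans q p

-- The third component bounds d + sum as by the next row to be put in front, so that the truncated
-- subtraction giving the new entry is exact.
top-surjective : ∀ d τ → AllPairs _≥_ τ → All (d ≤_) τ → ∃ λ as → top d as ≡ τ × (∀ {y} → All (_≤ y) τ → d ≤ y → d + sum as ≤ y)
top-surjective d []      _ _ = [] , refl , λ _ d≤y → ≤-trans (≤-reflexive (+-identityʳ d)) d≤y
top-surjective d (x ∷ τ) (ps ∷ srt) (d≤x ∷ big) with top-surjective d τ srt big
... | as , e , h = (x ∸ (d + sum as)) ∷ as , cong₂ _∷_ eq e , λ { (x≤y ∷ _) _ → ≤-trans (≤-reflexive eq) x≤y }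
  where
  eq : d + (x ∸ (d + sum as) + sum as) ≡ x
  eq = trans (lem d (x ∸ (d + sum as)) (sum as)) (m∸n+n≡m (h ps d≤x))
    where
    lem : ∀ d a s → d + (a + s) ≡ a + (d + s)
    lem = solve-∀

strip : ∀ j β → AllPairs _≥_ β → All (j ≤_) β → ∃ λ β' → ∃ λ b → β ≡ β' ++ replicate b j × All (j <_) β'
strip j []      _ _ = [] , 0 , refl , []
strip j (x ∷ β) (ps ∷ srt) (j≤x ∷ ge) with strip j β srt ge
... | β' , b , refl , gt with j ≟ x
...   | no j≢x = x ∷ β' , b , refl , ≤∧≢⇒< j≤x j≢x ∷ gt
...   | yes refl with β' | gt | ps
...     | []     | _       | _       = [] , suc b , refl , []
...     | y ∷ _  | j<y ∷ _ | y≤j ∷ _ = ⊥-elim (<⇒≱ j<y y≤j)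

allPairs-++ˡ : ∀ {R : ℕ → ℕ → Set} (xs : List ℕ) {ys} → AllPairs R (xs ++ ys) → AllPairs R xs
allPairs-++ˡ []       _        = []
allPairs-++ˡ (x ∷ xs) (p ∷ ps) = All.++⁻ˡ xs p ∷ allPairs-++ˡ xs ps

allPairs-++ʳ : ∀ {R : ℕ → ℕ → Set} (xs : List ℕ) {ys} → AllPairs R (xs ++ ys) → AllPairs R ys
allPairs-++ʳ []       ps       = ps
allPairs-++ʳ (x ∷ xs) (_ ∷ ps) = allPairs-++ʳ xs ps

bot-surjective : ∀ r j β → AllPairs _≥_ β → All (j ≤_) β → All (_< j + r) β → ∃ λ bs → length bs ≡ r × bot j bs ≡ β
bot-surjective zero    j []      _ _ _ = [] , refl , refl
bot-surjective zero    j (x ∷ β) _ (p ∷ _) (q ∷ _) = ⊥-elim (<⇒≱ q (≤-trans (≤-reflexive (+-identityʳ j)) p))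
bot-surjective (suc r) j β srt ge lt with strip j β srt ge
... | β' , b , refl , gt with bot-surjective r (suc j) β' (allPairs-++ˡ β' srt) gt (All.map (λ q → <-≤-trans q (≤-reflexive (+-suc j r))) (All.++⁻ˡ β' lt))
...   | bs , l , e = b ∷ bs , cong suc l , cong (_++ replicate b j) e

zip-exists : ∀ (as bs : List ℕ) → length as ≡ length bs → ∃ λ xs → map proj₁ xs ≡ as × map proj₂ xs ≡ bs
zip-exists []       []       _ = [] , refl , refl
zip-exists (a ∷ as) (b ∷ bs) l with zip-exists as bs (suc-injective l)
... | xs , refl , refl = (a , b) ∷ xs , refl , refl

decode-surjective : ∀ {n l} → IsPartition n l → ∃ λ xs → decode xs ≡ l
decode-surjective {n} {l} (pos , lnk , _) with Linked.Linked⇒AllPairs (λ p q → ≤-trans q p) lnk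
... | srt with durfee 0 l srt
...   | τ , β , refl , big , small with top-surjective (length τ) τ (allPairs-++ˡ τ srt) big
                                     | bot-surjective (length τ) 1 β (allPairs-++ʳ τ srt) (All.++⁻ʳ τ pos) (All.map s≤s small)
...     | as , ea , _ | bs , lb , eb with zip-exists as bs (trans (trans (sym (length-top (length τ) as)) (cong length ea)) (sym lb))
...       | xs , refl , refl = xs , cong₂ _++_ (trans (cong (λ d → top d (map proj₁ xs)) len) ea) eb
  where
  len : length xs ≡ length τ
  len = trans (sym (length-map proj₂ xs)) lb

-- Counting codes

unique-⊆⇒length≤ : ∀ (xs : List A) {ys} → Unique xs → (∀ {x} → x ∈ xs → x ∈ ys) → length xs ≤ length ys
unique-⊆⇒length≤ []       _ _ = z≤n
unique-⊆⇒length≤ (x ∷ xs) (x∉ ∷ u) sub with ∈-∃++ (sub (here refl))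
... | ys₁ , ys₂ , refl = ≤-trans (s≤s (unique-⊆⇒length≤ xs u sub')) (≤-reflexive (sym len))
  where
  len : length (ys₁ ++ x ∷ ys₂) ≡ suc (length (ys₁ ++ ys₂))
  len = trans (length-++ ys₁) (trans (+-suc (length ys₁) (length ys₂)) (cong suc (sym (length-++ ys₁))))
  sub' : ∀ {z} → z ∈ xs → z ∈ ys₁ ++ ys₂
  sub' z∈ with ∈-++⁻ ys₁ (sub (there z∈))
  ... | inj₁ p           = ∈-++⁺ˡ p
  ... | inj₂ (here refl) = ⊥-elim (All.lookup x∉ z∈ refl)
  ... | inj₂ (there p)   = ∈-++⁺ʳ ys₁ p

unique-concatMap : ∀ (f : A → List A′) ks → (∀ {k k' y} → y ∈ f k → y ∈ f k' → k ≡ k') → Unique ks → (∀ k → Unique (f k)) → Unique (concatMap f ks)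
unique-concatMap f []       key u uf = []
unique-concatMap f (k ∷ ks) key (k∉ ∷ u) uf = Unique.++⁺ (uf k) (unique-concatMap f ks key u uf) disjoint
  where
  disjoint : ∀ {y} → ¬ (y ∈ f k × y ∈ concatMap f ks)
  disjoint (p , q) with find (∈-concatMap⁻ f {ks} q)
  ... | k' , k'∈ , r = All.lookup k∉ k'∈ (key p r)

unique-prod : ∀ (xss : List (List A)) → All Unique xss → Unique (prod xss)
unique-prod []         _        = [] ∷ []
unique-prod (xs ∷ xss) (u ∷ us) = unique-concatMap (λ x → map (x ∷_) (prod xss)) xs key u (λ x → Unique.map⁺ (proj₂ ∘ ∷-injective) (unique-prod xss us))
  where
  key : ∀ {k k' y} → y ∈ map (k ∷_) (prod xss) → y ∈ map (k' ∷_) (prod xss) → k ≡ k'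
  key p q with ∈-map⁻ _ p | ∈-map⁻ _ q
  ... | _ , _ , refl | _ , _ , e = proj₁ (∷-injective e)

∈-prod⁺ : ∀ {x : List A} {xss} → Pointwise _∈_ x xss → x ∈ prod xss
∈-prod⁺ []                          = here refl
∈-prod⁺ {xss = xs ∷ xss} (p ∷ ps) = ∈-concatMap⁺ (λ a → map (a ∷_) (prod xss)) (lose p (∈-map⁺ _ (∈-prod⁺ ps)))

merge-split : ∀ {x} c → x ∈ split c → uncurry _+_ x ≡ c
merge-split c x∈ with ∈-map⁻ (λ a → a , c ∸ a) x∈
... | a , a∈ , refl = m+[n∸m]≡n (≤-pred (∈-upTo⁻ a∈))

merge-cfgs : ∀ {x} cs → x ∈ cfgs cs → merge x ≡ cs
merge-cfgs cs x∈ = go cs (∈-prod⁻ (map split cs) x∈)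
  where
  go : ∀ cs {x} → Pointwise _∈_ x (map split cs) → merge x ≡ cs
  go []       []       = refl
  go (c ∷ cs) (p ∷ ps) = cong₂ _∷_ (merge-split c p) (go cs ps)

∈-cfgs-merge : ∀ xs → xs ∈ cfgs (merge xs)
∈-cfgs-merge xs = ∈-prod⁺ (go xs)
  where
  go : ∀ xs → Pointwise _∈_ xs (map split (merge xs))
  go []             = []
  go ((a , b) ∷ xs) = subst (λ y → (a , y) ∈ split (a + b)) (m+n∸m≡n a b) (∈-map⁺ (λ a' → a' , a + b ∸ a') (∈-upTo⁺ (s≤s (m≤m+n a b)))) ∷ go xs

∑-filter : ∀ {P : A → Set} (P? : ∀ x → Dec (P x)) xs f → ∑ (filter P? xs) f ≡ ∑ xs (λ x → 𝟙 (P? x) * f x)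
∑-filter P? []       f = refl
∑-filter P? (x ∷ xs) f with P? x
... | yes _ = cong₂ _+_ (sym (*-identityˡ (f x))) (∑-filter P? xs f)
... | no  _ = ∑-filter P? xs f

-- A decidable consequence of `IsGraphical (decode x)`, so that it can be counted by an indicator.
Balanced : List (ℕ × ℕ) → Set
Balanced x = All (λ k → dot (_⊓ k) 1 x ℤ.≤ ℤ.+ 0) (upTo (suc (length x)))

balanced? : ∀ x → Dec (Balanced x)
balanced? x = All.all? (λ k → dot (_⊓ k) 1 x ℤ.≤? ℤ.+ 0) (upTo (suc (length x)))

module Codes (n : ℕ) where
  open Boxed (suc n)

  columns : ℕ → List (List ℕ)
  columns d = filter (λ c → d * d + size 1 c ≟ n) (box d)

  codes : List (List (ℕ × ℕ))
  codes = concatMap (λ d → concatMap cfgs (columns d)) (upTo (suc n))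

  ∑-codes : ∀ f → ∑ codes f ≡ ∑< (suc n) (λ d → ∑ (box d) (λ c → 𝟙 (d * d + size 1 c ≟ n) * ∑ (cfgs c) f))
  ∑-codes f = trans (∑-concatMap (λ d → concatMap cfgs (columns d)) (upTo (suc n)) f) (∑-cong (upTo (suc n)) (λ d →
    trans (∑-concatMap cfgs (columns d) f) (∑-filter (λ c → d * d + size 1 c ≟ n) (box d) _)))

  length-column : ∀ {x} d → x ∈ concatMap cfgs (columns d) → length x ≡ d
  length-column {x} d p with find (∈-concatMap⁻ cfgs {columns d} p)
  ... | c , c∈ , q = trans (length-cfg c q) (trans (Pointwise-length (∈-prod⁻ (replicate d (upTo (suc n))) (proj₁ (∈-filter⁻ (λ c → d * d + size 1 c ≟ n) {xs = box d} c∈)))) (length-replicate d))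

  ∈-codes⁻ : ∀ {x} → x ∈ codes → length x * length x + size 1 (merge x) ≡ n
  ∈-codes⁻ {x} x∈ with find (∈-concatMap⁻ (λ d → concatMap cfgs (columns d)) {upTo (suc n)} x∈)
  ... | d , _ , p with find (∈-concatMap⁻ cfgs {columns d} p)
  ...   | c , c∈ , q = trans (cong₂ (λ k l → k * k + size 1 l) (length-column d p) (merge-cfgs c q))
    (proj₂ (∈-filter⁻ (λ c → d * d + size 1 c ≟ n) {xs = box d} c∈))

  codes-unique : Unique codes
  codes-unique = unique-concatMap _ (upTo (suc n)) (λ {k} {k'} p q → trans (sym (length-column k p)) (length-column k' q)) (Unique.upTo⁺ (suc n)) (λ d →
    unique-concatMap cfgs (columns d) (λ {k} {k'} p q → trans (sym (merge-cfgs k p)) (merge-cfgs k' q))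
      (Unique.filter⁺ (λ c → d * d + size 1 c ≟ n) (unique-prod _ (All.replicate⁺ d (Unique.upTo⁺ (suc n)))))
      (λ c → unique-prod _ (All.map⁺ (All.universal (λ k → Unique.map⁺ (cong proj₁) (Unique.upTo⁺ (suc k))) c))))

  ∈-codes⁺ : ∀ x → length x * length x + size 1 (merge x) ≡ n → x ∈ codes
  ∈-codes⁺ x e = ∈-concatMap⁺ _ (lose (∈-upTo⁺ (s≤s d≤n)) (∈-concatMap⁺ cfgs (lose
    (∈-filter⁺ (λ c → d * d + size 1 c ≟ n) (subst (λ k → merge x ∈ box k) (length-map _ x) (∈-prod⁺ (inBox (merge x) 1 ≤-refl (≤-trans (m≤n+m _ (d * d)) (≤-reflexive e)))))
      e) (∈-cfgs-merge x))))
    where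
    d = length x
    d≤n : d ≤ n
    d≤n = ≤-trans (square d) (≤-trans (m≤m+n (d * d) _) (≤-reflexive e))
      where
      square : ∀ d → d ≤ d * d
      square zero    = z≤n
      square (suc d) = m≤m*n (suc d) (suc d)
    inBox : ∀ c j → 1 ≤ j → size j c ≤ n → Pointwise _∈_ c (replicate (length c) (upTo (suc n)))
    inBox []       j _   _ = []
    inBox (c ∷ cs) j@(suc _) 1≤j s≤n = ∈-upTo⁺ (s≤s (≤-trans (m≤n*m c j) (≤-trans (m≤m+n (j * c) _) s≤n))) ∷ inBox cs (suc j) (s≤s z≤n) (≤-trans (m≤n+m _ (j * c)) s≤n)

  -- Injectivity of `decode` gives this direction; its surjectivity gives the bound on graphical
  -- partitions in `graphical≤balanced`.
  codes≤partitions : ∀ ps → (∀ l → IsPartition n l → l ∈ ps) → length codes ≤ length ps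
  codes≤partitions ps complete = ≤-trans (≤-reflexive (sym (length-map decode codes)))
    (unique-⊆⇒length≤ (map decode codes) (Unique.map⁺ (decode-injective _ _) codes-unique) sub)
    where
    sub : ∀ {l} → l ∈ map decode codes → l ∈ ps
    sub l∈ with ∈-map⁻ decode l∈
    ... | x , x∈ , refl = complete (decode x) (subst (λ m → IsPartition m (decode x)) (∈-codes⁻ x∈) (decode-partition x))

  graphical≤balanced : ∀ gs → Unique gs → All (GraphicalPartition n) gs → length gs ≤ ∑ codes (λ x → 𝟙 (balanced? x))
  graphical≤balanced gs u allG = begin
    length gs                                          ≤⟨ unique-⊆⇒length≤ gs u sub ⟩
    length (map decode (filter balanced? codes))       ≡⟨ length-map decode (filter balanced? codes) ⟩
    length (filter balanced? codes)                    ≡⟨ sym (∑-length (filter balanced? codes)) ⟩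
    ∑ (filter balanced? codes) (λ _ → 1)               ≡⟨ ∑-filter balanced? codes (λ _ → 1) ⟩
    ∑ codes (λ x → 𝟙 (balanced? x) * 1)                ≡⟨ ∑-cong codes (λ x → *-identityʳ _) ⟩
    ∑ codes (λ x → 𝟙 (balanced? x))                    ∎
    where
    open ≤-Reasoning
    sub : ∀ {l} → l ∈ gs → l ∈ map decode (filter balanced? codes)
    sub {l} l∈ with All.lookup allG l∈
    ... | part , gr with decode-surjective part
    ...   | x , refl = ∈-map⁺ decode (∈-filter⁺ balanced? (∈-codes⁺ x (trans (sym (sum-decode x)) (proj₂ (proj₂ part))))
            (All.tabulate (λ k∈ → graphical⇒dot≤0 x _ (≤-pred (∈-upTo⁻ k∈)) gr)))

-- Variation of one block and of the remainder

variation-∑ : ∀ w j cs → variation w j cs ≡ ∑< (length cs) (λ p → (w (j + p) * nth p cs) * (w (j + p) * nth p cs))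
variation-∑ w j []       = refl
variation-∑ w j (c ∷ cs) = trans
  (cong₂ _+_ (cong (λ i → (w i * c) * (w i * c)) (sym (+-identityʳ j)))
    (trans (variation-∑ w (suc j) cs) (∑-cong (upTo (length cs)) (λ p → cong (λ i → (w i * nth p cs) * (w i * nth p cs)) (sym (+-suc j p))))))
  (sym (∑<-front (length cs) (λ p → (w (j + p) * nth p (c ∷ cs)) * (w (j + p) * nth p (c ∷ cs)))))

nth-outside : ∀ p cs → length cs ≤ p → nth p cs ≡ 0
nth-outside p       []       _       = refl
nth-outside (suc p) (c ∷ cs) (s≤s l) = nth-outside p cs l

count< : ∀ n k → ∑< n (λ i → 𝟙 (i <? k)) ≤ k
count< n k = begin
  ∑< n f                  ≤⟨ ∑<-monoˡ f (m≤n+m n k) ⟩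
  ∑< (k + n) f            ≡⟨ ∑<-vanish k n (λ i k≤i → 𝟙-no (i <? k) (≤⇒≯ k≤i)) ⟩
  ∑< k f                  ≤⟨ ∑<-mono k (λ i _ → 𝟙≤1 (i <? k)) ⟩
  ∑< k (λ _ → 1)          ≡⟨ trans (∑<-const k 1) (*-identityʳ k) ⟩
  k                       ∎
  where
  open ≤-Reasoning
  f : ℕ → ℕ
  f i = 𝟙 (i <? k)

-- Σ_{j > a} 1/j² ≤ 1/a, by telescoping.
square-tail : ∀ n a h (x : ℕ → ℕ) → (∀ p → (suc a + p) * x p ≤ h) → a * ∑< n (λ p → x p * x p) ≤ h * h
square-tail zero    a h x bd = ≤-trans (≤-reflexive (*-zeroʳ a)) z≤n
square-tail (suc n) a h x bd = *-cancelˡ-≤ (suc a) (begin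
  suc a * (a * ∑< (suc n) (λ p → x p * x p))                 ≡⟨ cong (λ u → suc a * (a * u)) (∑<-front n (λ p → x p * x p)) ⟩
  suc a * (a * (x 0 * x 0 + S))                              ≡⟨ lem a (x 0) S ⟩
  a * (suc a * (x 0 * x 0)) + a * (suc a * S)                ≤⟨ +-mono-≤ (*-monoˡ-≤ _ (n≤1+n a)) (*-monoʳ-≤ a (square-tail n (suc a) h (x ∘ suc) (λ p → ≤-trans (≤-reflexive (cong (_* x (suc p)) (sym (+-suc (suc a) p)))) (bd (suc p))))) ⟩
  suc a * (suc a * (x 0 * x 0)) + a * (h * h)                ≡⟨ cong (_+ a * (h * h)) (lem' (suc a) (x 0)) ⟩
  (suc a * x 0) * (suc a * x 0) + a * (h * h)                ≤⟨ +-monoˡ-≤ (a * (h * h)) (*-mono-≤ b0 b0) ⟩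
  h * h + a * (h * h)                                        ∎)
  where
  open ≤-Reasoning
  S = ∑< n (λ p → x (suc p) * x (suc p))
  b0 : suc a * x 0 ≤ h
  b0 = ≤-trans (≤-reflexive (cong (_* x 0) (sym (+-identityʳ (suc a))))) (bd 0)
  lem : ∀ a x S → (1 + a) * (a * (x * x + S)) ≡ a * ((1 + a) * (x * x)) + a * ((1 + a) * S)
  lem = solve-∀
  lem' : ∀ a x → a * (a * (x * x)) ≡ (a * x) * (a * x)
  lem' = solve-∀

square-tail-from : ∀ n a h (x : ℕ → ℕ) → (∀ p → suc p * x p ≤ h) → a * ∑< n (λ p → 𝟙 (a <? suc p) * (x p * x p)) ≤ h * h
square-tail-from n a h x bd = begin
  a * ∑< n f                                                     ≤⟨ *-monoʳ-≤ a (∑<-monoˡ f (m≤n+m n a)) ⟩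
  a * ∑< (a + n) f                                               ≡⟨ cong (a *_) (∑<-split a n f) ⟩
  a * (∑< a f + ∑< n (λ p → f (a + p)))                          ≡⟨ cong (λ u → a * (u + ∑< n (λ p → f (a + p)))) (∑<-zero a (λ p p<a → cong (_* (x p * x p)) (𝟙-no (a <? suc p) (≤⇒≯ p<a)))) ⟩
  a * ∑< n (λ p → f (a + p))                                     ≤⟨ *-monoʳ-≤ a (∑-mono (upTo n) (λ p → ≤-trans (*-monoˡ-≤ _ (𝟙≤1 (a <? suc (a + p)))) (≤-reflexive (*-identityˡ _)))) ⟩
  a * ∑< n (λ p → x (a + p) * x (a + p))                         ≤⟨ square-tail n a h (λ p → x (a + p)) (λ p → bd (a + p)) ⟩
  h * h                                                          ∎
  where
  open ≤-Reasoning
  f : ℕ → ℕ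
  f p = 𝟙 (a <? suc p) * (x p * x p)

dot-add : ∀ {w w₁ w₂} → (∀ i → w₁ i + w₂ i ≡ w i) → ∀ j x → dot w j x ≡ dot w₁ j x ℤ.+ dot w₂ j x
dot-add e j []       = refl
dot-add {w} {w₁} {w₂} e j (p ∷ xs) = begin
  ℤ.+ w j ℤ.* diff p ℤ.+ dot w (suc j) xs
    ≡⟨ cong₂ (λ u y → ℤ.+ u ℤ.* diff p ℤ.+ y) (sym (e j)) (dot-add e (suc j) xs) ⟩
  (ℤ.+ w₁ j ℤ.+ ℤ.+ w₂ j) ℤ.* diff p ℤ.+ (dot w₁ (suc j) xs ℤ.+ dot w₂ (suc j) xs)
    ≡⟨ lem (ℤ.+ w₁ j) (ℤ.+ w₂ j) (diff p) _ _ ⟩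
  (ℤ.+ w₁ j ℤ.* diff p ℤ.+ dot w₁ (suc j) xs) ℤ.+ (ℤ.+ w₂ j ℤ.* diff p ℤ.+ dot w₂ (suc j) xs) ∎
  where
  open ≡-Reasoning
  lem : ∀ a b d x y → (a ℤ.+ b) ℤ.* d ℤ.+ (x ℤ.+ y) ≡ (a ℤ.* d ℤ.+ x) ℤ.+ (b ℤ.* d ℤ.+ y)
  lem = ℤ-Ring.solve-∀

-- Applied with y the block sum and z the remainder of S_k: a large positive block must be
-- compensated.
opposite-large : ∀ m y z → ℤ.+ m ℤ.< y → y ℤ.+ z ℤ.≤ ℤ.+ 0 → m * m ≤ sq z
opposite-large m y z m<y y+z≤0 = *-mono-≤ m≤z m≤z
  where
  y≤-z : y ℤ.≤ ℤ.- z
  y≤-z = subst₂ ℤ._≤_ (lem y z) (ℤ.+-identityˡ (ℤ.- z)) (ℤ.+-monoˡ-≤ (ℤ.- z) y+z≤0)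
    where
    lem : ∀ y z → y ℤ.+ z ℤ.+ ℤ.- z ≡ y
    lem = ℤ-Ring.solve-∀
  below-abs : ∀ {m} u → ℤ.+ m ℤ.≤ u → m ≤ ∣ u ∣
  below-abs (ℤ.+ u) (ℤ.+≤+ p) = p
  m≤z : m ≤ ∣ z ∣
  m≤z = ≤-trans (below-abs (ℤ.- z) (ℤ.≤-trans (ℤ.<⇒≤ m<y) y≤-z)) (≤-reflexive (ℤ.∣-i∣≡∣i∣ z))

-- Scales k t = R^(2t+1) with R = ρ², and blocks [R^(2t), R^(2t+2)) around them.
module Scales (ρ : ℕ) (2≤ρ : 2 ≤ ρ) where

  R = ρ * ρ

  2≤R : 2 ≤ R
  2≤R = ≤-trans 2≤ρ (m≤m*n ρ ρ {{>-nonZero (≤-trans (s≤s z≤n) 2≤ρ)}})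

  -- R is a square so that `κ t`, the square root of `k t`, is an integer; it enters the threshold
  -- `m t`, whose order is that of a standard deviation.
  b k κ : ℕ → ℕ
  b t = (R * R) ^ t
  k t = R * b t
  κ t = ρ * R ^ t

  b-suc : ∀ t → b (suc t) ≡ R * k t
  b-suc t = *-assoc R R (b t)

  κ² : ∀ t → κ t * κ t ≡ k t
  κ² t = trans (lem ρ (R ^ t)) (cong (R *_) (pow t))
    where
    lem : ∀ a b → (a * b) * (a * b) ≡ a * a * (b * b)
    lem = solve-∀
    pow : ∀ t → R ^ t * R ^ t ≡ (R * R) ^ t
    pow zero    = refl
    pow (suc t) = trans (lem R (R ^ t)) (cong (R * R *_) (pow t))

  1≤b : ∀ t → 1 ≤ b t
  1≤b t = m^n>0 (R * R) {{>-nonZero (*-mono-≤ (≤-trans (s≤s z≤n) 2≤R) (≤-trans (s≤s z≤n) 2≤R))}} t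

  b≤k : ∀ t → b t ≤ k t
  b≤k t = m≤n*m (b t) R {{>-nonZero (≤-trans (s≤s z≤n) 2≤R)}}

  1≤k : ∀ t → 1 ≤ k t
  1≤k t = ≤-trans (1≤b t) (b≤k t)

  2k≤b : ∀ t → 2 * k t ≤ b (suc t)
  2k≤b t = ≤-trans (*-monoˡ-≤ (k t) 2≤R) (≤-reflexive (sym (b-suc t)))

  b-mono : ∀ t → b t ≤ b (suc t)
  b-mono t = ≤-trans (b≤k t) (≤-trans (m≤m+n (k t) _) (2k≤b t))

  inside? : ∀ t i → Dec (b t ≤ i × i < b (suc t))
  inside? t i = (b t ≤? i) ×-dec (i <? b (suc t))

  blk rst : ℕ → ℕ → ℕ
  blk t i = 𝟙 (inside? t i) * (i ⊓ k t)
  rst t i = (1 ∸ 𝟙 (inside? t i)) * (i ⊓ k t)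

  blk+rst : ∀ t i → blk t i + rst t i ≡ i ⊓ k t
  blk+rst t i with inside? t i
  ... | yes _ = trans (+-identityʳ _) (*-identityˡ _)
  ... | no  _ = *-identityˡ _

  blk-below : ∀ t i → i < b t → blk t i ≡ 0
  blk-below t i i<b = cong (_* (i ⊓ k t)) (𝟙-no (inside? t i) (λ (p , _) → <⇒≱ i<b p))

  blk-above : ∀ t i → b (suc t) ≤ i → blk t i ≡ 0
  blk-above t i b≤i = cong (_* (i ⊓ k t)) (𝟙-no (inside? t i) (λ (_ , p) → <⇒≱ p b≤i))

  blk-inside : ∀ t i → i < k t → blk t (k t + i) ≡ k t
  blk-inside t i i<k = trans (cong₂ _*_ (𝟙-yes (inside? t (k t + i)) (≤-trans (b≤k t) (m≤m+n (k t) i) ,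
    <-≤-trans (+-monoʳ-< (k t) i<k) (≤-trans (≤-reflexive (cong (k t +_) (sym (+-identityʳ (k t))))) (2k≤b t))))
    (m≥n⇒m⊓n≡n (m≤m+n (k t) i))) (*-identityˡ _)

  -- Below the block there are at most b t terms, each at most h². Above it the weight is k t and
  -- the tail of Σ c_j² is at most 2 h² / b (t + 1). As b t = k t / R and b (t + 1) = R · k t, both
  -- parts gain a factor R.
  rest-variation : ∀ t c h → (∀ p → suc p * nth p c ≤ h) → R * variation (rst t) 1 c ≤ 3 * (h * h) * k t
  rest-variation t c h bd = begin
    R * variation (rst t) 1 c
      ≡⟨ cong (R *_) (variation-∑ (rst t) 1 c) ⟩
    R * ∑< n (λ p → (rst t (suc p) * x p) * (rst t (suc p) * x p))
      ≤⟨ *-monoʳ-≤ R (∑-mono (upTo n) one) ⟩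
    R * ∑< n (λ p → 𝟙 (suc p <? b t) * (h * h) + (k t * k t) * (𝟙 (a <? suc p) * (x p * x p)))
      ≡⟨ cong (R *_) (trans (∑-+ (upTo n) _ _) (cong₂ _+_ (∑-*ʳ (upTo n) (h * h) _) (∑-*ˡ (upTo n) (k t * k t) _))) ⟩
    R * (∑< n (λ p → 𝟙 (suc p <? b t)) * (h * h) + (k t * k t) * S)
      ≤⟨ *-monoʳ-≤ R (+-monoˡ-≤ ((k t * k t) * S) (*-monoˡ-≤ (h * h) (≤-trans (∑-mono (upTo n) fewer) (count< n (b t))))) ⟩
    R * (b t * (h * h) + (k t * k t) * S)
      ≡⟨ lem₁ R (b t) (h * h) (k t) S ⟩
    k t * (h * h) + k t * (R * k t * S)
      ≡⟨ cong (λ u → k t * (h * h) + k t * (u * S)) (sym (b-suc t)) ⟩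
    k t * (h * h) + k t * (b (suc t) * S)
      ≤⟨ +-monoʳ-≤ (k t * (h * h)) (*-monoʳ-≤ (k t) (*-monoˡ-≤ S b≤2a)) ⟩
    k t * (h * h) + k t * (2 * a * S)
      ≡⟨ cong (λ u → k t * (h * h) + k t * u) (*-assoc 2 a S) ⟩
    k t * (h * h) + k t * (2 * (a * S))
      ≤⟨ +-monoʳ-≤ (k t * (h * h)) (*-monoʳ-≤ (k t) (*-monoʳ-≤ 2 (square-tail-from n a h x bd))) ⟩
    k t * (h * h) + k t * (2 * (h * h))
      ≡⟨ lem₂ (k t) (h * h) ⟩
    3 * (h * h) * k t ∎
    where
    open ≤-Reasoning
    n = length c
    -- One less than the end of the block, because `square-tail-from` sums over j > a; replacing a
    -- by b (t + 1) later costs a factor 2.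
    a = pred (b (suc t))
    x : ℕ → ℕ
    x p = nth p c
    S = ∑< n (λ p → 𝟙 (a <? suc p) * (x p * x p))
    2≤b : 2 ≤ b (suc t)
    2≤b = ≤-trans (*-monoʳ-≤ 2 (1≤k t)) (2k≤b t)
    b≡ : suc a ≡ b (suc t)
    b≡ = suc-pred (b (suc t)) {{>-nonZero (1≤b (suc t))}}
    b≤2a : b (suc t) ≤ 2 * a
    b≤2a = ≤-trans (≤-reflexive (sym b≡)) (+-mono-≤ (≤-pred (≤-trans 2≤b (≤-reflexive (sym b≡)))) (m≤m+n a 0))
    lem₁ : ∀ R b h k S → R * (b * h + (k * k) * S) ≡ R * b * h + k * (R * k * S)
    lem₁ = solve-∀
    lem₂ : ∀ k h → k * h + k * (2 * h) ≡ 3 * h * k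
    lem₂ = solve-∀
    fewer : ∀ p → 𝟙 (suc p <? b t) ≤ 𝟙 (p <? b t)
    fewer p with suc p <? b t
    ... | yes q = ≤-reflexive (sym (𝟙-yes (p <? b t) (<⇒≤ q)))
    ... | no  _ = z≤n
    one : ∀ p → (rst t (suc p) * x p) * (rst t (suc p) * x p) ≤ 𝟙 (suc p <? b t) * (h * h) + (k t * k t) * (𝟙 (a <? suc p) * (x p * x p))
    one p with inside? t (suc p)
    ... | yes _ = z≤n
    ... | no ¬in with suc p <? b t
    ...   | yes _ = ≤-trans (*-mono-≤ q q) (≤-trans (≤-reflexive (sym (*-identityˡ (h * h)))) (m≤m+n _ _))
      where
      q : (suc p ⊓ k t + 0) * x p ≤ h
      q = ≤-trans (*-monoˡ-≤ (x p) (≤-trans (≤-reflexive (+-identityʳ _)) (m⊓n≤m (suc p) (k t)))) (bd p)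
    ...   | no p≮b = begin
      ((suc p ⊓ k t + 0) * x p) * ((suc p ⊓ k t + 0) * x p)   ≤⟨ *-mono-≤ q q ⟩
      (k t * x p) * (k t * x p)                               ≡⟨ lem (k t) (x p) ⟩
      (k t * k t) * (1 * (x p * x p))                         ≡⟨ cong (λ u → (k t * k t) * (u * (x p * x p))) (sym (𝟙-yes (a <? suc p) (≤-trans (≤-reflexive b≡) (≮⇒≥ (λ lt → ¬in (≮⇒≥ p≮b , lt)))))) ⟩
      (k t * k t) * (𝟙 (a <? suc p) * (x p * x p))            ∎
      where
      lem : ∀ k x → (k * x) * (k * x) ≡ (k * k) * (1 * (x * x))
      lem = solve-∀
      q : (suc p ⊓ k t + 0) * x p ≤ k t * x p
      q = *-monoˡ-≤ (x p) (≤-trans (≤-reflexive (+-identityʳ _)) (m⊓n≤n (suc p) (k t)))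

  -- Concerns the j in [k t, 2 k t). Positions start at 0 and part sizes at 1, hence `pred`.
  low : ℕ → ℕ → List ℕ → ℕ
  low t y c = ∑< (k t) (λ i → 𝟙 (nth (pred (k t) + i) c <? y))

  -- At least half of the j in [k t, 2 k t) have c_j ≥ 8 z and weight k t, which gives (k t / 2)(8 ·
  -- k t · z)². The 8 is chosen so that the resulting 32 exceeds the 12 required by
  -- `small-probability`.
  block-variation : ∀ t c z → 2 * k t ≤ length c → 2 * low t (8 * z) c ≤ k t → 32 * (k t * ((k t * z) * (k t * z))) ≤ variation (blk t) 1 c
  block-variation t c z 2k≤n few = *-cancelˡ-≤ 2 (+-cancelˡ-≤ (64 * (k t * ((k t * z) * (k t * z)))) _ _ (begin
    64 * (k t * Y) + 2 * (32 * (k t * Y))                      ≡⟨ lem₁ (k t) z ⟩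
    2 * (k t * W)                                              ≡⟨ cong (2 *_) (sym (∑<-const (k t) W)) ⟩
    2 * ∑< (k t) (λ _ → W)                                     ≤⟨ *-monoʳ-≤ 2 (∑<-mono (k t) one) ⟩
    2 * ∑< (k t) (λ i → 𝟙 (x i <? 8 * z) * W + f (pred (k t) + i)) ≡⟨ cong (2 *_) (trans (∑-+ (upTo (k t)) _ _) (cong (_+ ∑< (k t) (λ i → f (pred (k t) + i))) (∑-*ʳ (upTo (k t)) W _))) ⟩
    2 * (L * W + ∑< (k t) (λ i → f (pred (k t) + i)))          ≡⟨ lem₂ L W _ ⟩
    2 * L * W + 2 * ∑< (k t) (λ i → f (pred (k t) + i))        ≤⟨ +-mono-≤ (*-monoˡ-≤ W few) (*-monoʳ-≤ 2 part) ⟩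
    k t * W + 2 * variation (blk t) 1 c                        ≡⟨ cong (_+ 2 * variation (blk t) 1 c) (lem₃ (k t) z) ⟩
    64 * (k t * Y) + 2 * variation (blk t) 1 c                 ∎))
    where
    open ≤-Reasoning
    Y = (k t * z) * (k t * z)
    W = (k t * (8 * z)) * (k t * (8 * z))
    L = low t (8 * z) c
    x : ℕ → ℕ
    x i = nth (pred (k t) + i) c
    f : ℕ → ℕ
    f p = (blk t (suc p) * nth p c) * (blk t (suc p) * nth p c)
    lem₁ : ∀ k z → 64 * (k * ((k * z) * (k * z))) + 2 * (32 * (k * ((k * z) * (k * z)))) ≡ 2 * (k * ((k * (8 * z)) * (k * (8 * z))))
    lem₁ = solve-∀
    lem₂ : ∀ L W s → 2 * (L * W + s) ≡ 2 * L * W + 2 * s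
    lem₂ = solve-∀
    lem₃ : ∀ k z → k * ((k * (8 * z)) * (k * (8 * z))) ≡ 64 * (k * ((k * z) * (k * z)))
    lem₃ = solve-∀
    k≡ : suc (pred (k t)) ≡ k t
    k≡ = suc-pred (k t) {{>-nonZero (1≤k t)}}
    one : ∀ i → i < k t → W ≤ 𝟙 (x i <? 8 * z) * W + f (pred (k t) + i)
    one i i<k with x i <? 8 * z
    ... | yes _ = ≤-trans (≤-reflexive (sym (*-identityˡ W))) (m≤m+n _ _)
    ... | no ¬l = ≤-trans (*-mono-≤ q q) (≤-reflexive (cong (λ u → (u * x i) * (u * x i)) (sym (trans (cong (λ u → blk t (u + i)) k≡) (blk-inside t i i<k)))))
      where
      q : k t * (8 * z) ≤ k t * x i
      q = *-monoʳ-≤ (k t) (≮⇒≥ ¬l)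
    part : ∑< (k t) (λ i → f (pred (k t) + i)) ≤ variation (blk t) 1 c
    part = begin
      ∑< (k t) (λ i → f (pred (k t) + i))                      ≤⟨ m≤n+m _ (∑< (pred (k t)) f) ⟩
      ∑< (pred (k t)) f + ∑< (k t) (λ i → f (pred (k t) + i))  ≡⟨ sym (∑<-split (pred (k t)) (k t) f) ⟩
      ∑< (pred (k t) + k t) f                                  ≤⟨ ∑<-monoˡ f (≤-trans (+-mono-≤ (pred[n]≤n {k t}) (≤-reflexive (sym (+-identityʳ (k t))))) 2k≤n) ⟩
      ∑< (length c) f                                          ≡⟨ sym (variation-∑ (blk t) 1 c) ⟩
      variation (blk t) 1 c                                    ∎

-- The probability of being balanced, given the column counts

balanced-ways : List ℕ → ℕ
balanced-ways c = ∑ (cfgs c) (λ x → 𝟙 (balanced? x))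

balanced-ways≤ways : ∀ c → balanced-ways c ≤ ways c
balanced-ways≤ways c = ≤-trans (∑-mono (cfgs c) (λ x → 𝟙≤1 (balanced? x))) (≤-reflexive (trans (∑-cfgs-const c 1) (*-identityʳ _)))

module Conditional (ρ : ℕ) (2≤ρ : 2 ≤ ρ) (T v q h : ℕ) (z : ℕ → ℕ) where
  open Scales ρ 2≤ρ

  -- The order of the standard deviation of the block: k t terms, each of size about k t · z t.
  m : ℕ → ℕ
  m t = k t * (κ t * z t)

  m² : ∀ t → m t * m t ≡ k t * ((k t * z t) * (k t * z t))
  m² t = trans (lem (k t) (κ t) (z t)) (trans (cong (λ u → k t * k t * u * (z t * z t)) (κ² t)) (lem' (k t) (z t)))
    where
    lem : ∀ k c z → (k * (c * z)) * (k * (c * z)) ≡ k * k * (c * c) * (z * z)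
    lem = solve-∀
    lem' : ∀ k z → k * k * k * (z * z) ≡ k * ((k * z) * (k * z))
    lem' = solve-∀

  open Blocks b b-mono blk m blk-below blk-above public

  far : ℕ → List (ℕ × ℕ) → ℕ
  far t x = 𝟙 (m t * m t ≤? sq (dot (rst t) 1 x))

  b≤bT : ∀ {t} → t < T → b (suc t) ≤ b T
  b≤bT {t} t<T = ≤-trans (b-mono* (suc t) (T ∸ suc t)) (≤-reflexive (cong b (m+[n∸m]≡n t<T)))

  2k≤bT : ∀ {t} → t < T → 2 * k t ≤ b T
  2k≤bT {t} t<T = ≤-trans (2k≤b t) (b≤bT t<T)

  balanced-split : ∀ c x → b T ≤ length c → x ∈ cfgs c → 𝟙 (balanced? x) ≤ AllSmall 0 T 1 x + ∑< T (λ t → far t x)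
  balanced-split c x bT≤ x∈ with balanced? x
  ... | no  _   = z≤n
  ... | yes bal = some-large (λ t → far t x) T 0 1 x alternative
    where
    alternative : ∀ t → 0 ≤ t → t < T → dot (blk t) 1 x ℤ.≤ ℤ.+ m t ⊎ 1 ≤ far t x
    alternative t _ t<T with dot (blk t) 1 x ℤ.≤? ℤ.+ m t
    ... | yes p = inj₁ p
    ... | no ¬p = inj₂ (≤-reflexive (sym (𝟙-yes (m t * m t ≤? sq (dot (rst t) 1 x))
          (opposite-large (m t) (dot (blk t) 1 x) (dot (rst t) 1 x) (ℤ.≰⇒> ¬p)
            (subst (ℤ._≤ ℤ.+ 0) (dot-add (blk+rst t) 1 x) (All.lookup bal (∈-upTo⁺ (s≤s k≤len))))))))
      where
      k≤len : k t ≤ length x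
      k≤len = ≤-trans (≤-trans (m≤m+n (k t) _) (2k≤bT t<T)) (≤-trans bT≤ (≤-reflexive (sym (length-cfg c x∈))))

  -- Two equal shares of 2^(-v): all blocks are small with probability at most (431/432)^T, and some
  -- remainder is large with probability at most T · 3h²/(R q²). The gap between the upper bound h
  -- and the lower level q for j c_j is what R has to overcome.
  good-bound : ∀ c → (∀ t → t < T → k t * z t ≡ q) → 1 ≤ q → 2 ^ v * 431 ^ T ≤ 432 ^ T → 2 ^ v * (T * (3 * (h * h))) ≤ R * (q * q) →
    b T ≤ length c → (∀ p → suc p * nth p c ≤ h) → (∀ t → t < T → 2 * low t (8 * z t) c ≤ k t) →
    2 ^ v * balanced-ways c ≤ 2 * ways c
  good-bound c kz 1≤q hT hC bT≤ upper lower = begin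
    2 ^ v * balanced-ways c                                                              ≤⟨ *-monoʳ-≤ (2 ^ v) (∑-mono∈ (cfgs c) (λ {x} → balanced-split c x bT≤)) ⟩
    2 ^ v * ∑ (cfgs c) (λ x → AllSmall 0 T 1 x + ∑< T (λ t → far t x))       ≡⟨ cong (2 ^ v *_) (trans (∑-+ (cfgs c) _ _) (cong (S +_) (∑-swap (cfgs c) (upTo T) _))) ⟩
    2 ^ v * (S + ∑< T C)                                                     ≡⟨ *-distribˡ-+ (2 ^ v) S _ ⟩
    2 ^ v * S + 2 ^ v * ∑< T C                                               ≤⟨ +-mono-≤ small-part far-part ⟩
    ways c + ways c                                                          ≡⟨ cong (ways c +_) (sym (+-identityʳ (ways c))) ⟩
    2 * ways c                                                               ∎
    where
    open ≤-Reasoning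
    S = ∑ (cfgs c) (AllSmall 0 T 1)
    C : ℕ → ℕ
    C t = ∑ (cfgs c) (far t)
    variance : ∀ t → 0 ≤ t → t < T → 1 ≤ variation (blk t) 1 c × 12 * (m t * m t) ≤ variation (blk t) 1 c
    variance t _ t<T = ≤-trans (≤-trans 1≤mm (m≤n*m (m t * m t) 32)) V≥ , ≤-trans (*-monoˡ-≤ (m t * m t) (m≤m+n 12 20)) V≥
      where
      V≥ : 32 * (m t * m t) ≤ variation (blk t) 1 c
      V≥ = ≤-trans (≤-reflexive (cong (32 *_) (m² t))) (block-variation t c (z t) (≤-trans (2k≤bT t<T) bT≤) (lower t t<T))
      1≤mm : 1 ≤ m t * m t
      1≤mm = ≤-trans (*-mono-≤ (1≤k t) (*-mono-≤ 1≤kz 1≤kz)) (≤-reflexive (sym (m² t)))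
        where
        1≤kz : 1 ≤ k t * z t
        1≤kz = ≤-trans 1≤q (≤-reflexive (sym (kz t t<T)))
    small-part : 2 ^ v * S ≤ ways c
    small-part = *-cancelˡ-≤ (432 ^ T) {{m^n≢0 432 T}} (begin
      432 ^ T * (2 ^ v * S)          ≡⟨ lem (432 ^ T) (2 ^ v) S ⟩
      2 ^ v * (432 ^ T * S)          ≤⟨ *-monoʳ-≤ (2 ^ v) (independence T 0 c (≤-trans bT≤ (m≤n+m _ 1)) variance) ⟩
      2 ^ v * (431 ^ T * ways c)     ≡⟨ sym (*-assoc (2 ^ v) (431 ^ T) (ways c)) ⟩
      2 ^ v * 431 ^ T * ways c       ≤⟨ *-monoˡ-≤ (ways c) hT ⟩
      432 ^ T * ways c               ∎)
      where
      lem : ∀ a b c → a * (b * c) ≡ b * (a * c)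
      lem = solve-∀
    -- Chebyshev at one scale. Because k t · z t = q for every t, the bound 3h²/(R q²) is the same
    -- at all scales.
    each : ∀ t → t < T → R * (q * q) * C t ≤ 3 * (h * h) * ways c
    each t t<T = *-cancelˡ-≤ (k t) {{>-nonZero (1≤k t)}} (begin
      k t * (R * (q * q) * C t)                                      ≡⟨ cong (λ u → k t * (R * (u * u) * C t)) (sym (kz t t<T)) ⟩
      k t * (R * ((k t * z t) * (k t * z t)) * C t)                  ≡⟨ lem₁ (k t) R _ (C t) ⟩
      R * (k t * ((k t * z t) * (k t * z t)) * C t)                  ≡⟨ cong (λ u → R * (u * C t)) (sym (m² t)) ⟩
      R * (m t * m t * C t)                                          ≤⟨ *-monoʳ-≤ R (chebyshev (rst t) 1 c (m t)) ⟩
      R * (ways c * variation (rst t) 1 c)                           ≡⟨ lem₂ R (ways c) _ ⟩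
      ways c * (R * variation (rst t) 1 c)                           ≤⟨ *-monoʳ-≤ (ways c) (rest-variation t c h upper) ⟩
      ways c * (3 * (h * h) * k t)                                   ≡⟨ lem₃ (ways c) (3 * (h * h)) (k t) ⟩
      k t * (3 * (h * h) * ways c)                                   ∎)
      where
      lem₁ : ∀ k R u C → k * (R * u * C) ≡ R * (k * u * C)
      lem₁ = solve-∀
      lem₂ : ∀ R w V → R * (w * V) ≡ w * (R * V)
      lem₂ = solve-∀
      lem₃ : ∀ w h k → w * (h * k) ≡ k * (h * w)
      lem₃ = solve-∀
    far-part : 2 ^ v * ∑< T C ≤ ways c
    far-part = *-cancelˡ-≤ (R * (q * q)) {{>-nonZero (*-mono-≤ (≤-trans (s≤s z≤n) 2≤R) (*-mono-≤ 1≤q 1≤q))}} (begin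
      R * (q * q) * (2 ^ v * ∑< T C)                 ≡⟨ lem₁ (R * (q * q)) (2 ^ v) _ ⟩
      2 ^ v * (R * (q * q) * ∑< T C)                 ≡⟨ cong (2 ^ v *_) (sym (∑-*ˡ (upTo T) (R * (q * q)) C)) ⟩
      2 ^ v * ∑< T (λ t → R * (q * q) * C t)         ≤⟨ *-monoʳ-≤ (2 ^ v) (∑<-mono T each) ⟩
      2 ^ v * ∑< T (λ _ → 3 * (h * h) * ways c)      ≡⟨ cong (2 ^ v *_) (∑<-const T _) ⟩
      2 ^ v * (T * (3 * (h * h) * ways c))           ≡⟨ lem₂ (2 ^ v) T (3 * (h * h)) (ways c) ⟩
      2 ^ v * (T * (3 * (h * h))) * ways c           ≤⟨ *-monoˡ-≤ (ways c) hC ⟩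
      R * (q * q) * ways c                           ∎)
      where
      lem₁ : ∀ a b c → a * (b * c) ≡ b * (a * c)
      lem₁ = solve-∀
      lem₂ : ∀ a T h w → a * (T * (h * w)) ≡ a * (T * h) * w
      lem₂ = solve-∀

-- Averaging over the column counts for a fixed Durfee size

module Included (B d s ρ : ℕ) (2≤ρ : 2 ≤ ρ) (T v q H F : ℕ) (z : ℕ → ℕ) where
  open Truncated B
  open Boxed B
  open Scales ρ 2≤ρ
  open Conditional ρ 2≤ρ T v q (2 * H) z

  -- Numbers of failures rather than an indicator of failure: union bounds become exchanges of sums,
  -- and for a bad vector it suffices that the number is at least 1.
  upper-bad lower-bad : List ℕ → ℕ
  upper-bad c = ∑< d (λ p → 𝟙 (2 * H ≤? suc p * nth p c))
  lower-bad c = ∑< T (λ t → 𝟙 (k t <? 2 * low t (8 * z t) c))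

  ∑<-zero⁻ : ∀ n {f} → ∑< n f ≡ 0 → ∀ i → i < n → f i ≡ 0
  ∑<-zero⁻ n {f} e i i<n = n≤0⇒n≡0 (≤-trans (∑-∈ f (∈-upTo⁺ i<n)) (≤-reflexive e))

  𝟙≡0 : ∀ {P : Set} (p : Dec P) → 𝟙 p ≡ 0 → ¬ P
  𝟙≡0 (no ¬p) _ = ¬p

  module Bounds (kz : ∀ t → t < T → k t * z t ≡ q) (1≤q : 1 ≤ q) (hT : 2 ^ v * 431 ^ T ≤ 432 ^ T)
    (hC : 2 ^ v * (T * (3 * ((2 * H) * (2 * H)))) ≤ R * (q * q)) (1≤d : 1 ≤ d) (d≤B : d ≤ B) (s<B : s < B) (bT≤d : b T ≤ d)
    (hU : 2 ^ v * (d * (2 * shift H (G d) s)) ≤ G d s) (1≤F : 1 ≤ F) (hQ : F * Q d s ≤ 3 * H * G d s)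
    (hF : 2 ^ v * (T * (32 * q)) * (3 * H) ≤ F) where

    conditional : ∀ c → length c ≡ d → 2 ^ v * balanced-ways c ≤ (2 + 2 ^ v * (upper-bad c + lower-bad c)) * ways c
    conditional c len with upper-bad c + lower-bad c in eq
    ... | suc e = begin
      2 ^ v * balanced-ways c                              ≤⟨ *-monoʳ-≤ (2 ^ v) (balanced-ways≤ways c) ⟩
      2 ^ v * ways c                           ≤⟨ *-monoˡ-≤ (ways c) (≤-trans (m≤m*n (2 ^ v) (suc e)) (m≤n+m _ 2)) ⟩
      (2 + 2 ^ v * suc e) * ways c             ∎
      where open ≤-Reasoning
    ... | zero = ≤-trans (good-bound c kz 1≤q hT hC (≤-trans bT≤d (≤-reflexive (sym len))) upper lower)
                   (*-monoˡ-≤ (ways c) (m≤m+n 2 (2 ^ v * 0)))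
      where
      upper : ∀ p → suc p * nth p c ≤ 2 * H
      upper p with p <? d
      ... | yes p<d = <⇒≤ (≰⇒> (𝟙≡0 (2 * H ≤? suc p * nth p c) (∑<-zero⁻ d (m+n≡0⇒m≡0 (upper-bad c) eq) p p<d)))
      ... | no  p≮d = ≤-trans (≤-reflexive (trans (cong (suc p *_) (nth-outside p c (≤-trans (≤-reflexive len) (≮⇒≥ p≮d)))) (*-zeroʳ (suc p)))) z≤n
      lower : ∀ t → t < T → 2 * low t (8 * z t) c ≤ k t
      lower t t<T = ≮⇒≥ (𝟙≡0 (k t <? 2 * low t (8 * z t) c) (∑<-zero⁻ T (m+n≡0⇒n≡0 (upper-bad c) eq) t t<T))

    upper-total : 2 ^ v * ∑ (box d) (λ c → upper-bad c * wt 1 s c) ≤ G d s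
    upper-total = ≤-trans (*-monoʳ-≤ (2 ^ v) (begin
      ∑ (box d) (λ c → upper-bad c * wt 1 s c)
        ≡⟨ ∑-cong (box d) (λ c → sym (∑-*ʳ (upTo d) (wt 1 s c) _)) ⟩
      ∑ (box d) (λ c → ∑< d (λ p → 𝟙 (2 * H ≤? suc p * nth p c) * wt 1 s c))
        ≡⟨ ∑-swap (box d) (upTo d) _ ⟩
      ∑< d (λ p → ∑ (box d) (λ c → 𝟙 (2 * H ≤? suc p * nth p c) * wt 1 s c))
        ≤⟨ ∑<-mono d (λ p p<d → Tail.upper-tail {1} {d} {p} ≤-refl (proj₂ (marginal 1 d p p<d)) H (G-mono 1≤d) s<B) ⟩
      ∑< d (λ _ → 2 * shift H (G d) s)
        ≡⟨ ∑<-const d _ ⟩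
      d * (2 * shift H (G d) s) ∎)) hU
      where open ≤-Reasoning

    -- `lower-tail` bounds the weight by G (s) - G (s - (p + 1) y), a sum of (p + 1) y first
    -- differences.
    low-position : ∀ p y → p < d → ∑ (box d) (λ c → 𝟙 (nth p c <? y) * wt 1 s c) ≤ suc p * y * Q d s
    low-position p y p<d = +-cancelʳ-≤ (shift (suc p * y) (G d) s) _ _ (begin
      ∑ (box d) (λ c → 𝟙 (nth p c <? y) * wt 1 s c) + shift (suc p * y) (G d) s
        ≤⟨ Tail.lower-tail {1} {d} {p} ≤-refl (proj₂ (marginal 1 d p p<d)) y s<B ⟩
      G d s
        ≤⟨ G-increment (suc p * y) 1≤d s<B ⟩
      shift (suc p * y) (G d) s + suc p * y * Q d s
        ≡⟨ +-comm (shift (suc p * y) (G d) s) _ ⟩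
      suc p * y * Q d s + shift (suc p * y) (G d) s ∎)
      where open ≤-Reasoning

    -- Markov's inequality for the number of low positions: each of the k t positions costs at most
    -- 2 k t · 8 z t · Q, and the average is divided by k t / 2, giving 32 q Q.
    low-scale : ∀ t → t < T → ∑ (box d) (λ c → 𝟙 (k t <? 2 * low t (8 * z t) c) * wt 1 s c) ≤ 32 * q * Q d s
    low-scale t t<T = *-cancelˡ-≤ (k t) {{>-nonZero (1≤k t)}} (begin
      k t * ∑ (box d) (λ c → 𝟙 (k t <? 2 * low t y c) * wt 1 s c)
        ≡⟨ sym (∑-*ˡ (box d) (k t) _) ⟩
      ∑ (box d) (λ c → k t * (𝟙 (k t <? 2 * low t y c) * wt 1 s c))
        ≤⟨ ∑-mono (box d) markov ⟩
      ∑ (box d) (λ c → 2 * (low t y c * wt 1 s c))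
        ≡⟨ trans (∑-*ˡ (box d) 2 _) (cong (2 *_) (trans (∑-cong (box d) (λ c → sym (∑-*ʳ (upTo (k t)) (wt 1 s c) _))) (∑-swap (box d) (upTo (k t)) _))) ⟩
      2 * ∑< (k t) (λ i → ∑ (box d) (λ c → 𝟙 (nth (pred (k t) + i) c <? y) * wt 1 s c))
        ≤⟨ *-monoʳ-≤ 2 (∑<-mono (k t) (λ i i<k → ≤-trans (low-position (pred (k t) + i) y (≤-trans (index≤ i i<k) 2k≤d)) (*-monoˡ-≤ (Q d s) (*-monoˡ-≤ y (index≤ i i<k))))) ⟩
      2 * ∑< (k t) (λ i → 2 * k t * y * Q d s)
        ≡⟨ cong (2 *_) (∑<-const (k t) _) ⟩
      2 * (k t * (2 * k t * y * Q d s))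
        ≡⟨ lem (k t) (z t) (Q d s) ⟩
      k t * (32 * (k t * z t) * Q d s)
        ≡⟨ cong (λ u → k t * (32 * u * Q d s)) (kz t t<T) ⟩
      k t * (32 * q * Q d s) ∎)
      where
      open ≤-Reasoning
      y = 8 * z t
      2k≤d : 2 * k t ≤ d
      2k≤d = ≤-trans (2k≤bT t<T) bT≤d
      index≤ : ∀ i → i < k t → suc (pred (k t) + i) ≤ 2 * k t
      index≤ i i<k = ≤-trans (≤-reflexive (cong (_+ i) (suc-pred (k t) {{>-nonZero (1≤k t)}}))) (≤-trans (+-monoʳ-≤ (k t) (<⇒≤ i<k)) (≤-reflexive (cong (k t +_) (sym (+-identityʳ (k t))))))
      lem : ∀ k z Q → 2 * (k * (2 * k * (8 * z) * Q)) ≡ k * (32 * (k * z) * Q)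
      lem = solve-∀
      markov : ∀ c → k t * (𝟙 (k t <? 2 * low t y c) * wt 1 s c) ≤ 2 * (low t y c * wt 1 s c)
      markov c with k t <? 2 * low t y c
      ... | no  _ = ≤-trans (≤-reflexive (*-zeroʳ (k t))) z≤n
      ... | yes p = ≤-trans (*-mono-≤ (<⇒≤ p) (≤-reflexive (*-identityˡ (wt 1 s c)))) (≤-reflexive (*-assoc 2 (low t y c) (wt 1 s c)))

    lower-total : 2 ^ v * ∑ (box d) (λ c → lower-bad c * wt 1 s c) ≤ G d s
    lower-total = *-cancelˡ-≤ F {{>-nonZero 1≤F}} (begin
      F * (2 ^ v * ∑ (box d) (λ c → lower-bad c * wt 1 s c))
        ≡⟨ cong (λ u → F * (2 ^ v * u)) (trans (∑-cong (box d) (λ c → sym (∑-*ʳ (upTo T) (wt 1 s c) _))) (∑-swap (box d) (upTo T) _)) ⟩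
      F * (2 ^ v * ∑< T (λ t → ∑ (box d) (λ c → 𝟙 (k t <? 2 * low t (8 * z t) c) * wt 1 s c)))
        ≤⟨ *-monoʳ-≤ F (*-monoʳ-≤ (2 ^ v) (≤-trans (∑<-mono T low-scale) (≤-reflexive (∑<-const T _)))) ⟩
      F * (2 ^ v * (T * (32 * q * Q d s)))
        ≡⟨ lem₁ F (2 ^ v) T (32 * q) (Q d s) ⟩
      2 ^ v * (T * (32 * q)) * (F * Q d s)
        ≤⟨ *-monoʳ-≤ (2 ^ v * (T * (32 * q))) hQ ⟩
      2 ^ v * (T * (32 * q)) * (3 * H * G d s)
        ≡⟨ sym (*-assoc (2 ^ v * (T * (32 * q))) (3 * H) (G d s)) ⟩
      2 ^ v * (T * (32 * q)) * (3 * H) * G d s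
        ≤⟨ *-monoˡ-≤ (G d s) hF ⟩
      F * G d s ∎)
      where
      open ≤-Reasoning
      lem₁ : ∀ F a T c Q → F * (a * (T * (c * Q))) ≡ a * (T * c) * (F * Q)
      lem₁ = solve-∀

    -- Of the 4, two come from `good-bound` and one from each kind of failure.
    included : 2 ^ v * ∑ (box d) (λ c → shift (size 1 c) δ₀ s * balanced-ways c) ≤ 4 * G d s
    included = begin
      2 ^ v * ∑ (box d) (λ c → D c * balanced-ways c)
        ≡⟨ sym (∑-*ˡ (box d) (2 ^ v) _) ⟩
      ∑ (box d) (λ c → 2 ^ v * (D c * balanced-ways c))
        ≤⟨ ∑-mono∈ (box d) (λ {c} c∈ → ≤-trans (≤-reflexive (lem₁ (2 ^ v) (D c) (balanced-ways c))) (≤-trans (*-monoʳ-≤ (D c) (conditional c (box-length c∈)))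
             (≤-reflexive (lem₂ (D c) (ways c) (2 ^ v) (upper-bad c) (lower-bad c))))) ⟩
      ∑ (box d) (λ c → 2 * (1 * wt 1 s c) + (2 ^ v * (upper-bad c * wt 1 s c) + 2 ^ v * (lower-bad c * wt 1 s c)))
        ≡⟨ trans (∑-+ (box d) _ _) (cong₂ _+_ (∑-*ˡ (box d) 2 _) (trans (∑-+ (box d) _ _) (cong₂ _+_ (∑-*ˡ (box d) (2 ^ v) _) (∑-*ˡ (box d) (2 ^ v) _)))) ⟩
      2 * ∑ (box d) (λ c → 1 * wt 1 s c) + (2 ^ v * ∑ (box d) (λ c → upper-bad c * wt 1 s c) + 2 ^ v * ∑ (box d) (λ c → lower-bad c * wt 1 s c))
        ≤⟨ +-mono-≤ (≤-reflexive (cong (2 *_) (box-total 1 d s ≤-refl s<B))) (+-mono-≤ upper-total lower-total) ⟩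
      2 * G d s + (G d s + G d s)
        ≡⟨ lem₃ (G d s) ⟩
      4 * G d s ∎
      where
      open ≤-Reasoning
      D : List ℕ → ℕ
      D c = shift (size 1 c) δ₀ s
      lem₁ : ∀ a b c → a * (b * c) ≡ b * (a * c)
      lem₁ = solve-∀
      lem₂ : ∀ D w a x y → D * ((2 + a * (x + y)) * w) ≡ 2 * (1 * (w * D)) + (a * (x * (w * D)) + a * (y * (w * D)))
      lem₂ = solve-∀
      lem₃ : ∀ g → 2 * g + (g + g) ≡ 4 * g
      lem₃ = solve-∀
      box-length : ∀ {c} → c ∈ box d → length c ≡ d
      box-length c∈ = trans (Pointwise-length (∈-prod⁻ (replicate d (upTo B)) c∈)) (length-replicate d)

-- Choice of the parameters as powers of two

2^-+ : ∀ a b → 2 ^ a * 2 ^ b ≡ 2 ^ (a + b)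
2^-+ a b = sym (^-distribˡ-+-* 2 a b)

2^-mono : ∀ {a b} → a ≤ b → 2 ^ a ≤ 2 ^ b
2^-mono = ^-monoʳ-≤ 2

exponent-< : ∀ {a b} → 2 ^ a < 2 ^ b → a < b
exponent-< {a} {b} p = ≰⇒> (λ b≤a → <⇒≱ p (2^-mono b≤a))

1≤2^ : ∀ a → 1 ≤ 2 ^ a
1≤2^ a = m^n>0 2 a

n<2^n : ∀ n → n < 2 ^ n
n<2^n zero    = ≤-refl
n<2^n (suc n) = ≤-trans (+-mono-≤ (1≤2^ n) (n<2^n n)) (≤-reflexive (cong (2 ^ n +_) (sym (+-identityʳ (2 ^ n)))))

bracket : (f : ℕ → ℕ) → f 0 ≡ 1 → (∀ k → f k < f (suc k)) → ∀ m → 1 ≤ m → ∃ λ k → f k ≤ m × m < f (suc k)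
bracket f f0 up (suc zero)    _ = 0 , ≤-reflexive f0 , ≤-trans (s≤s (≤-reflexive (sym f0))) (up 0)
bracket f f0 up (suc (suc m)) _ with bracket f f0 up (suc m) (s≤s z≤n)
... | k , lo , hi with suc (suc m) <? f (suc k)
...   | yes p = k , m≤n⇒m≤1+n lo , p
...   | no ¬p = suc k , ≮⇒≥ ¬p , ≤-<-trans hi (up (suc k))

square-power-< : ∀ k → 2 ^ (2 * k) < 2 ^ (2 * suc k)
square-power-< k = ^-monoʳ-< 2 (s≤s (s≤s z≤n)) (*-monoʳ-< 2 (n<1+n k))

-- Exponents (to base 2) of the parameters: J₀ = 2^(g₀ - α), q = 2^(g - π), ρ = 2^σ, H = 2^(g + 4v + 16).
α π σ : ℕ → ℕ
α v = 2 * v + 9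
π v = 6 * v + 34
σ v = 12 * v + 59

-- 4 σ T is the base-2 logarithm of b T. A value g at least this large gives b T ≤ 2^(g - α) ≤ d and
-- makes q divisible by k t for every t < T.
demand : ℕ → ℕ → ℕ
demand v T = 4 * σ v * T + π v + α v

module Assembly (n v g₀ T : ℕ)
  (hB : suc n ≤ 2 ^ (2 ^ (2 * v + 2))) (hlo : 2 ^ (2 * g₀) ≤ n) (hhi : n < 2 ^ (2 * suc g₀))
  (hTv : T ≤ 2 ^ (v + 9)) (hT : 2 ^ v * 431 ^ T ≤ 432 ^ T) (hM : 2 * demand v T + α v + 1 ≤ g₀) where

  B = suc n
  open Truncated B
  open Boxed B
  open Codes n

  j = g₀ ∸ α v

  j+α : j + α v ≡ g₀
  j+α = m∸n+n≡m (≤-trans (≤-trans (m≤n+m (α v) (2 * demand v T)) (m≤m+n _ 1)) hM)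

  J₀ = 2 ^ j
  W₀ = 2 ^ (2 * v + 2)

  v<W₀ : suc v ≤ W₀
  v<W₀ = ≤-trans (n<2^n v) (2^-mono (≤-trans (m≤n*m v 2) (m≤m+n (2 * v) 2)))

  module Typical (d s : ℕ) (d≤n : d ≤ n) (s≤n : s ≤ n) (J₀≤d : J₀ ≤ d) (J₀≤s : J₀ ≤ s)
    (g : ℕ) (glo : 2 ^ (2 * g) ≤ s) (ghi : s < 2 ^ (2 * suc g)) where

    s<B : s < B
    s<B = s≤s s≤n

    1≤d : 1 ≤ d
    1≤d = ≤-trans (1≤2^ j) J₀≤d

    g≤g₀ : g ≤ g₀
    g≤g₀ = ≤-pred (*-cancelˡ-< 2 g (suc g₀) (exponent-< (≤-<-trans glo (≤-<-trans s≤n hhi))))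

    -- Only s ≥ 2^(g₀ - α) is known, about the square root of n, so g may be as small as about half
    -- of g₀: hence the doubled `demand` in `hM`.
    M≤g : demand v T ≤ g
    M≤g = ≤-pred (*-cancelˡ-< 2 (demand v T) (suc g) (+-cancelʳ-< (α v) _ _ (begin-strict
      2 * demand v T + α v       <⟨ ≤-reflexive (+-comm 1 _) ⟩
      2 * demand v T + α v + 1   ≤⟨ hM ⟩
      g₀                         ≡⟨ sym j+α ⟩
      j + α v                    ≤⟨ +-monoˡ-≤ (α v) (<⇒≤ (exponent-< {j} {2 * suc g} (≤-<-trans J₀≤s ghi))) ⟩
      2 * suc g + α v            ∎)))
      where open ≤-Reasoning

    ε qe He : ℕ
    ε = g ∸ α v
    qe = g ∸ π v
    He = (2 * v + 4) + (g + 3 + α v)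

    ε+α : ε + α v ≡ g
    ε+α = m∸n+n≡m (≤-trans (m≤n+m (α v) (4 * σ v * T + π v)) M≤g)

    qe+π : qe + π v ≡ g
    qe+π = m∸n+n≡m (≤-trans (≤-trans (m≤n+m (π v) (4 * σ v * T)) (m≤m+n _ (α v))) M≤g)

    -- r and x feed `decay^`: 2^ε · x = 2 · 4^(g + 1) > 2 s, and r = 4 W₀ makes 2^r at least B⁴,
    -- enough to absorb factors polynomial in n. F is the power of 4 just below s.
    r x H q ρ F : ℕ
    r = 2 ^ (2 * v + 4)
    x = 2 ^ (g + 3 + α v)
    H = 2 ^ He
    q = 2 ^ qe
    ρ = 2 ^ σ v
    F = 2 ^ (2 * g)

    H≡rx : H ≡ r * x
    H≡rx = sym (2^-+ (2 * v + 4) (g + 3 + α v))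

    2≤ρ : 2 ≤ ρ
    2≤ρ = 2^-mono {1} (≤-trans (s≤s z≤n) (m≤n+m 59 (12 * v)))

    e≤d : 2 ^ ε ≤ d
    e≤d = ≤-trans (2^-mono (∸-monoˡ-≤ (α v) g≤g₀)) J₀≤d

    decayed : 2 ^ r * shift H (G d) s ≤ G d s
    decayed = subst (λ u → 2 ^ r * shift u (G d) s ≤ G d s) (sym H≡rx)
      (decay^ {d} {s} {2 ^ ε} {x} {2 ^ (2 * suc g)} r 1≤d s<B (<⇒≤ ghi) e≤d
        (2^-mono (≤-trans (m∸n≤m g (α v)) (≤-trans (m≤m+n g 3) (m≤m+n (g + 3) (α v))))) (1≤2^ (g + 3 + α v))
        (≤-reflexive (trans (2^-+ 1 (2 * suc g)) (trans (cong (2 ^_) exps) (sym (2^-+ ε (g + 3 + α v)))))))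
      where
      exps : 1 + 2 * suc g ≡ ε + (g + 3 + α v)
      exps = trans (lem g) (trans (cong (λ u → u + (g + 3)) (sym ε+α)) (lem' ε (α v) (g + 3)))
        where
        lem : ∀ g → 1 + 2 * suc g ≡ g + (g + 3)
        lem = solve-∀
        lem' : ∀ a b c → a + b + c ≡ a + (c + b)
        lem' = solve-∀

    d≤2^ : d ≤ 2 ^ W₀
    d≤2^ = ≤-trans (m≤n⇒m≤1+n d≤n) hB

    s≤2^ : s ≤ 2 ^ W₀
    s≤2^ = ≤-trans (<⇒≤ s<B) hB

    r≡ : r ≡ 4 * W₀
    r≡ = trans (cong (2 ^_) (lem v)) (sym (2^-+ 2 (2 * v + 2)))
      where
      lem : ∀ v → 2 * v + 4 ≡ 2 + (2 * v + 2)
      lem = solve-∀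

    below-2^r : ∀ {a} → a ≤ 4 * W₀ → 2 ^ a ≤ 2 ^ r
    below-2^r p = 2^-mono (≤-trans p (≤-reflexive (sym r≡)))

    absorb : ∀ y → y ≤ 2 ^ r → y * shift H (G d) s ≤ G d s
    absorb y y≤ = ≤-trans (*-monoˡ-≤ (shift H (G d) s) y≤) decayed

    hU : 2 ^ v * (d * (2 * shift H (G d) s)) ≤ G d s
    hU = ≤-trans (≤-reflexive (lem (2 ^ v) d (shift H (G d) s))) (absorb (2 ^ v * (d * 2)) (begin
      2 ^ v * (d * 2)              ≤⟨ *-monoʳ-≤ (2 ^ v) (*-monoˡ-≤ 2 d≤2^) ⟩
      2 ^ v * (2 ^ W₀ * 2 ^ 1)     ≡⟨ trans (cong (2 ^ v *_) (2^-+ W₀ 1)) (2^-+ v (W₀ + 1)) ⟩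
      2 ^ (v + (W₀ + 1))           ≤⟨ below-2^r (≤-trans (≤-reflexive (lem' v W₀)) (≤-trans (+-monoˡ-≤ W₀ v<W₀) (≤-trans (m≤m+n (W₀ + W₀) (2 * W₀)) (≤-reflexive (lem'' W₀))))) ⟩
      2 ^ r                        ∎))
      where
      open ≤-Reasoning
      lem : ∀ a d x → a * (d * (2 * x)) ≡ a * (d * 2) * x
      lem = solve-∀
      lem' : ∀ v W → v + (W + 1) ≡ suc v + W
      lem' = solve-∀
      lem'' : ∀ W → W + W + 2 * W ≡ 4 * W
      lem'' = solve-∀

    -- In `Q-bound` the term at s - H is absorbed by 2^r, so the first difference of G is at most
    -- 3H/F times G. This relative size is about 1/√s up to powers of log n.
    hQ : F * Q d s ≤ 3 * H * G d s
    hQ = begin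
      F * Q d s                                                  ≤⟨ *-monoˡ-≤ (Q d s) glo ⟩
      s * Q d s                                                  ≤⟨ Q-bound H 1≤d (m≤n⇒m≤1+n d≤n) s<B ⟩
      2 * H * G d s + 2 * d * s * shift H (Q d) s                ≤⟨ +-monoʳ-≤ (2 * H * G d s) (≤-trans (*-monoʳ-≤ (2 * d * s) (shift-mono H s (λ s' s'≤s → Q≤G 1≤d (≤-<-trans s'≤s s<B)))) (absorb (2 * d * s) 2ds)) ⟩
      2 * H * G d s + G d s                                      ≤⟨ +-monoʳ-≤ (2 * H * G d s) (≤-trans (≤-reflexive (sym (*-identityˡ (G d s)))) (*-monoˡ-≤ (G d s) (1≤2^ He))) ⟩
      2 * H * G d s + H * G d s                                  ≡⟨ lem H (G d s) ⟩
      3 * H * G d s                                              ∎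
      where
      open ≤-Reasoning
      lem : ∀ h g → 2 * h * g + h * g ≡ 3 * h * g
      lem = solve-∀
      lem' : ∀ W → W + (W + W) + W ≡ 4 * W
      lem' = solve-∀
      2ds : 2 * d * s ≤ 2 ^ r
      2ds = begin
        2 * d * s                      ≤⟨ *-mono-≤ (*-monoʳ-≤ 2 d≤2^) s≤2^ ⟩
        2 ^ 1 * 2 ^ W₀ * 2 ^ W₀        ≡⟨ trans (*-assoc 2 (2 ^ W₀) (2 ^ W₀)) (trans (cong (2 *_) (2^-+ W₀ W₀)) (2^-+ 1 (W₀ + W₀))) ⟩
        2 ^ (1 + (W₀ + W₀))            ≤⟨ below-2^r (≤-trans (+-monoˡ-≤ (W₀ + W₀) (1≤2^ (2 * v + 2))) (≤-trans (m≤m+n _ W₀) (≤-reflexive (lem' W₀)))) ⟩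
        2 ^ r                          ∎

    -- This determines π: the exponents on the left add up to qe + g + 6v + 32, which is 2g - 2.
    hF : 2 ^ v * (T * (32 * q)) * (3 * H) ≤ F
    hF = begin
      2 ^ v * (T * (32 * q)) * (3 * H)
        ≤⟨ *-mono-≤ (*-monoʳ-≤ (2 ^ v) (*-monoˡ-≤ (32 * q) hTv)) (*-monoˡ-≤ H (m≤m+n 3 1)) ⟩
      2 ^ v * (2 ^ (v + 9) * (2 ^ 5 * q)) * (2 ^ 2 * H)
        ≡⟨ cong₂ _*_ (trans (cong (λ u → 2 ^ v * u) (trans (cong (2 ^ (v + 9) *_) (2^-+ 5 qe)) (2^-+ (v + 9) (5 + qe)))) (2^-+ v (v + 9 + (5 + qe)))) (2^-+ 2 He) ⟩
      2 ^ (v + (v + 9 + (5 + qe))) * 2 ^ (2 + He)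
        ≡⟨ 2^-+ (v + (v + 9 + (5 + qe))) (2 + He) ⟩
      2 ^ (v + (v + 9 + (5 + qe)) + (2 + He))
        ≤⟨ 2^-mono (m+n≤o⇒m≤o (v + (v + 9 + (5 + qe)) + (2 + He)) (≤-reflexive (trans (lem v qe g) (cong (_+ g) qe+π)))) ⟩
      2 ^ (g + g)
        ≡⟨ cong (λ u → 2 ^ (g + u)) (sym (+-identityʳ g)) ⟩
      F ∎
      where
      open ≤-Reasoning
      lem : ∀ v q g → v + (v + 9 + (5 + q)) + (2 + ((2 * v + 4) + (g + 3 + (2 * v + 9)))) + 2 ≡ q + (6 * v + 34) + g
      lem = solve-∀

    open Scales ρ 2≤ρ

    R≡ : R ≡ 2 ^ (2 * σ v)
    R≡ = trans (2^-+ (σ v) (σ v)) (cong (λ u → 2 ^ (σ v + u)) (sym (+-identityʳ (σ v))))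

    b≡ : ∀ t → b t ≡ 2 ^ (4 * σ v * t)
    b≡ t = trans (cong (_^ t) (trans (cong₂ _*_ R≡ R≡) (trans (2^-+ (2 * σ v) (2 * σ v)) (cong (2 ^_) (lem (σ v)))))) (^-*-assoc 2 (4 * σ v) t)
      where
      lem : ∀ s → 2 * s + 2 * s ≡ 4 * s
      lem = solve-∀

    k≡ : ∀ t → k t ≡ 2 ^ (2 * σ v + 4 * σ v * t)
    k≡ t = trans (cong₂ _*_ R≡ (b≡ t)) (2^-+ (2 * σ v) (4 * σ v * t))

    -- This determines σ: the exponents on the left add up to 2g + 10v + 45, and 2σ must also cover
    -- the 2π lost in q². A slack of 2v + 5 remains.
    hC : 2 ^ v * (T * (3 * ((2 * H) * (2 * H)))) ≤ R * (q * q)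
    hC = begin
      2 ^ v * (T * (3 * ((2 * H) * (2 * H))))
        ≤⟨ *-monoʳ-≤ (2 ^ v) (*-mono-≤ hTv (*-monoˡ-≤ ((2 * H) * (2 * H)) (m≤m+n 3 1))) ⟩
      2 ^ v * (2 ^ (v + 9) * (2 ^ 2 * ((2 ^ 1 * H) * (2 ^ 1 * H))))
        ≡⟨ cong (2 ^ v *_) (cong (2 ^ (v + 9) *_) (trans (cong (2 ^ 2 *_) (trans (cong₂ _*_ (2^-+ 1 He) (2^-+ 1 He)) (2^-+ (1 + He) (1 + He)))) (2^-+ 2 (1 + He + (1 + He))))) ⟩
      2 ^ v * (2 ^ (v + 9) * 2 ^ (2 + (1 + He + (1 + He))))
        ≡⟨ trans (cong (2 ^ v *_) (2^-+ (v + 9) (2 + (1 + He + (1 + He))))) (2^-+ v (v + 9 + (2 + (1 + He + (1 + He))))) ⟩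
      2 ^ (v + (v + 9 + (2 + (1 + He + (1 + He)))))
        ≤⟨ 2^-mono (≤-trans (≤-reflexive (lem₁ v g)) (≤-trans (+-monoʳ-≤ (10 * v + 45) (≤-reflexive (cong₂ _+_ (sym qe+π) (sym qe+π)))) (≤-trans (m≤m+n _ (2 * v + 5)) (≤-reflexive (lem₂ v qe))))) ⟩
      2 ^ (2 * σ v + (qe + qe))
        ≡⟨ trans (sym (2^-+ (2 * σ v) (qe + qe))) (cong₂ _*_ (sym R≡) (sym (2^-+ qe qe))) ⟩
      R * (q * q) ∎
      where
      open ≤-Reasoning
      lem₁ : ∀ v g → v + (v + 9 + (2 + (1 + ((2 * v + 4) + (g + 3 + (2 * v + 9))) + (1 + ((2 * v + 4) + (g + 3 + (2 * v + 9)))))))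
        ≡ 10 * v + 45 + (g + g)
      lem₁ = solve-∀
      lem₂ : ∀ v q → 10 * v + 45 + (q + (6 * v + 34) + (q + (6 * v + 34))) + (2 * v + 5) ≡ 2 * (12 * v + 59) + (q + q)
      lem₂ = solve-∀

    -- The quotient q / k t; `demand` makes the subtraction of exponents exact for t < T.
    z : ℕ → ℕ
    z t = 2 ^ (qe ∸ (2 * σ v + 4 * σ v * t))

    kz : ∀ t → t < T → k t * z t ≡ q
    kz t t<T = trans (cong (_* z t) (k≡ t)) (trans (2^-+ (2 * σ v + 4 * σ v * t) _) (cong (2 ^_) (m+[n∸m]≡n (begin
      2 * σ v + 4 * σ v * t     ≤⟨ +-monoˡ-≤ (4 * σ v * t) (*-monoˡ-≤ (σ v) (m≤m+n 2 2)) ⟩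
      4 * σ v + 4 * σ v * t     ≡⟨ sym (*-suc (4 * σ v) t) ⟩
      4 * σ v * suc t           ≤⟨ *-monoʳ-≤ (4 * σ v) t<T ⟩
      4 * σ v * T               ≤⟨ +-cancelʳ-≤ (π v) _ _ (≤-trans (m≤m+n _ (α v)) (≤-trans M≤g (≤-reflexive (sym qe+π)))) ⟩
      qe                        ∎))))
      where open ≤-Reasoning

    bT≤d : b T ≤ d
    bT≤d = ≤-trans (≤-reflexive (b≡ T)) (≤-trans (2^-mono {4 * σ v * T} {ε} (+-cancelʳ-≤ (α v) _ _ (≤-trans (+-monoˡ-≤ (α v) (m≤m+n (4 * σ v * T) (π v))) (≤-trans M≤g (≤-reflexive (sym ε+α)))))) e≤d)

    typical : 2 ^ v * ∑ (box d) (λ c → shift (size 1 c) δ₀ s * balanced-ways c) ≤ 4 * G d s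
    typical = Included.Bounds.included B d s ρ 2≤ρ T v q H F z kz (1≤2^ qe) hT hC 1≤d (m≤n⇒m≤1+n d≤n) s<B bT≤d hU (1≤2^ (2 * g)) hQ hF

  -- Few codes have d < J₀ or s < J₀, compared with the at least X * X codes of Durfee size about √n / 2.
  X = 2 ^ (2 ^ (g₀ ∸ 6))

  6≤g₀ : 6 ≤ g₀
  6≤g₀ = ≤-trans (≤-trans (m≤n+m 6 (2 * v + 3)) (≤-reflexive (+-assoc (2 * v) 3 6))) (≤-trans (m≤n+m (α v) j) (≤-reflexive j+α))

  -- This determines α: the crude bound B^(2 J₀) ≤ 2^(2 J₀ W₀) becomes exactly X.
  crude-exponent : 2 ^ (2 * v + 2) * (2 * J₀) ≡ 2 ^ (g₀ ∸ 6)
  crude-exponent = trans (cong (W₀ *_) (2^-+ 1 j)) (trans (2^-+ (2 * v + 2) (1 + j)) (cong (2 ^_) (+-cancelʳ-≡ 6 _ _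
    (trans (lem v j) (trans j+α (sym (m∸n+n≡m 6≤g₀)))))))
    where
    lem : ∀ v j → 2 * v + 2 + (1 + j) + 6 ≡ j + (2 * v + 9)
    lem = solve-∀

  -- Either there are fewer than J₀ part sizes, or parts beyond s cannot occur; in both cases at
  -- most 2 J₀ coloured parts matter, each with at most B multiplicities.
  crude : ∀ d s → s < B → d < J₀ ⊎ s < J₀ → G d s ≤ X
  crude d s s<B small = ≤-trans (by-cases small) (≤-trans (^-monoˡ-≤ (2 * J₀) hB) (≤-reflexive (trans (^-*-assoc 2 W₀ (2 * J₀)) (cong (2 ^_) crude-exponent))))
    where
    by-cases : d < J₀ ⊎ s < J₀ → G d s ≤ B ^ (2 * J₀)
    by-cases (inj₁ d<J₀) = ≤-trans (cnt-dup≤ 1 d s) (^-monoʳ-≤ B (*-monoʳ-≤ 2 (<⇒≤ d<J₀)))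
    by-cases (inj₂ s<J₀) = cnt-dup-small≤ 1 d J₀ s ≤-refl s<B (m≤n⇒m≤1+n s<J₀)

  2^vB≤X : 2 ^ v * B ≤ X
  2^vB≤X = begin
    2 ^ v * B            ≤⟨ *-monoʳ-≤ (2 ^ v) hB ⟩
    2 ^ v * 2 ^ W₀       ≡⟨ 2^-+ v W₀ ⟩
    2 ^ (v + W₀)         ≤⟨ 2^-mono (≤-trans (+-monoˡ-≤ W₀ (<⇒≤ v<W₀)) (≤-trans (≤-reflexive (lem W₀)) (≤-trans (*-monoʳ-≤ W₀ (*-monoʳ-≤ 2 (1≤2^ j))) (≤-reflexive crude-exponent)))) ⟩
    X                    ∎
    where
    open ≤-Reasoning
    lem : ∀ W → W + W ≡ W * (2 * 1)
    lem = solve-∀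

  weight : ℕ → ℕ
  weight d = ∑ (box d) (λ c → 𝟙 (d * d + size 1 c ≟ n) * ways c)

  δ₀-shift : ∀ y s → shift y δ₀ s ≡ 𝟙 (y ≟ s)
  δ₀-shift zero    zero    = refl
  δ₀-shift zero    (suc s) = refl
  δ₀-shift (suc y) zero    = refl
  δ₀-shift (suc y) (suc s) = trans (δ₀-shift y s) (𝟙-cong (y ≟ s) (suc y ≟ suc s) (cong suc) suc-injective)

  indicator : ∀ d s y → d * d + s ≡ n → 𝟙 (d * d + y ≟ n) ≡ shift y δ₀ s
  indicator d s y e = trans (𝟙-cong (d * d + y ≟ n) (y ≟ s) (λ p → +-cancelˡ-≡ (d * d) y s (trans p (sym e))) (λ p → trans (cong (d * d +_) p) e)) (sym (δ₀-shift y s))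

  weight≡G : ∀ d s → d * d + s ≡ n → weight d ≡ G d s
  weight≡G d s e = trans (∑-cong (box d) (λ c → trans (cong (_* ways c) (indicator d s (size 1 c) e)) (trans (*-comm _ (ways c)) (sym (*-identityˡ _)))))
    (box-total 1 d s ≤-refl (s≤s (≤-trans (m≤n+m s (d * d)) (≤-reflexive e))))

  -- `decay^` read backwards: after r halvings the coefficient is still at least 1, so `G d s` is at
  -- least 2^r = X².
  many-codes : X * X ≤ ∑< B weight
  many-codes = begin
    X * X                                       ≡⟨ 2^-+ (2 ^ (g₀ ∸ 6)) (2 ^ (g₀ ∸ 6)) ⟩
    2 ^ (2 ^ (g₀ ∸ 6) + 2 ^ (g₀ ∸ 6))           ≡⟨ cong (2 ^_) (cong (2 ^ (g₀ ∸ 6) +_) (sym (+-identityʳ _))) ⟩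
    2 ^ r                                       ≡⟨ sym (*-identityʳ (2 ^ r)) ⟩
    2 ^ r * 1                                   ≤⟨ *-monoʳ-≤ (2 ^ r) (≤-trans (G-positive {d} {s ∸ r * x} 1≤d (≤-<-trans (m∸n≤m s (r * x)) s<B)) (≤-reflexive (sym (shift-≤ (G d) rx≤s)))) ⟩
    2 ^ r * shift (r * x) (G d) s               ≤⟨ decay^ {d} {s} {d} {x} {2 ^ (2 * suc g₀)} r 1≤d s<B (<⇒≤ (≤-<-trans s≤n hhi)) ≤-refl (2^-mono (≤-trans (m∸n≤m g₀ 1) (m≤m+n g₀ 4))) (1≤2^ (g₀ + 4)) (≤-reflexive dx) ⟩
    G d s                                       ≡⟨ sym (weight≡G d s d²+s) ⟩
    weight d                                    ≤⟨ ∑-∈ weight (∈-upTo⁺ (s≤s (≤-trans (m≤m*n d d {{>-nonZero 1≤d}}) d²≤n))) ⟩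
    ∑< B weight                                 ∎
    where
    open ≤-Reasoning
    -- Chosen so that d x = 2 · 4^(g₀ + 1), as `decay^` requires, and r x = 2 d², which is at most n
    -- - d² because 4 d² ≤ n.
    r = 2 ^ suc (g₀ ∸ 6)
    x = 2 ^ (g₀ + 4)
    d = 2 ^ (g₀ ∸ 1)
    u = 2 ^ (2 * (g₀ ∸ 1))
    1≤d : 1 ≤ d
    1≤d = 1≤2^ (g₀ ∸ 1)
    g₀≡ : (g₀ ∸ 6) + 6 ≡ g₀
    g₀≡ = m∸n+n≡m 6≤g₀
    g₀≡' : (g₀ ∸ 1) + 1 ≡ g₀
    g₀≡' = m∸n+n≡m (≤-trans (s≤s z≤n) 6≤g₀)
    dd : d * d ≡ u
    dd = trans (2^-+ (g₀ ∸ 1) (g₀ ∸ 1)) (cong (λ y → 2 ^ ((g₀ ∸ 1) + y)) (sym (+-identityʳ _)))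
    4u≤n : 4 * u ≤ n
    4u≤n = ≤-trans (≤-reflexive (trans (2^-+ 2 (2 * (g₀ ∸ 1))) (cong (2 ^_) (trans (lem (g₀ ∸ 1)) (cong (2 *_) g₀≡'))))) hlo
      where
      lem : ∀ g → 2 + 2 * g ≡ 2 * (g + 1)
      lem = solve-∀
    d²≤n : d * d ≤ n
    d²≤n = ≤-trans (≤-reflexive dd) (≤-trans (m≤n*m u 4) 4u≤n)
    s = n ∸ d * d
    s≤n : s ≤ n
    s≤n = m∸n≤m n (d * d)
    s<B : s < B
    s<B = s≤s s≤n
    d²+s : d * d + s ≡ n
    d²+s = m+[n∸m]≡n d²≤n
    dx : 2 * 2 ^ (2 * suc g₀) ≡ d * x
    dx = trans (2^-+ 1 (2 * suc g₀)) (trans (cong (2 ^_) (trans (cong (λ y → 1 + 2 * suc y) (sym g₀≡')) (trans (lem (g₀ ∸ 1)) (cong (λ y → (g₀ ∸ 1) + (y + 4)) g₀≡')))) (sym (2^-+ (g₀ ∸ 1) (g₀ + 4))))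
      where
      lem : ∀ g → 1 + 2 * suc (g + 1) ≡ g + (g + 1 + 4)
      lem = solve-∀
    rx≤s : r * x ≤ s
    rx≤s = +-cancelˡ-≤ (d * d) _ _ (begin
      d * d + r * x      ≡⟨ cong₂ _+_ dd rx ⟩
      u + 2 * u          ≤⟨ m≤m+n _ u ⟩
      u + 2 * u + u      ≡⟨ lem u ⟩
      4 * u              ≤⟨ 4u≤n ⟩
      n                  ≡⟨ sym d²+s ⟩
      d * d + s          ∎)
      where
      lem : ∀ u → u + 2 * u + u ≡ 4 * u
      lem = solve-∀
      rx : r * x ≡ 2 * u
      rx = trans (2^-+ (suc (g₀ ∸ 6)) (g₀ + 4)) (trans (cong (2 ^_) exps) (sym (2^-+ 1 (2 * (g₀ ∸ 1)))))
        where
        lem₁ : ∀ a b → suc a + (b + 1 + 4) ≡ a + 6 + b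
        lem₁ = solve-∀
        lem₂ : ∀ b → b + 1 + b ≡ 1 + 2 * b
        lem₂ = solve-∀
        exps : suc (g₀ ∸ 6) + (g₀ + 4) ≡ 1 + 2 * (g₀ ∸ 1)
        exps = trans (cong (λ y → suc (g₀ ∸ 6) + (y + 4)) (sym g₀≡')) (trans (lem₁ (g₀ ∸ 6) (g₀ ∸ 1))
          (trans (cong (_+ (g₀ ∸ 1)) (trans g₀≡ (sym g₀≡'))) (lem₂ (g₀ ∸ 1))))

  balanced-weight : ℕ → ℕ
  balanced-weight d = ∑ (box d) (λ c → 𝟙 (d * d + size 1 c ≟ n) * balanced-ways c)

  each-d : ∀ d → d < B → 2 ^ v * balanced-weight d ≤ 4 * weight d + 2 ^ v * X
  each-d d d<B with d * d ≤? n
  ... | no d²≰n = ≤-trans (≤-reflexive (trans (cong (2 ^ v *_) (∑-zero (box d) (λ {c} _ → cong (_* balanced-ways c) (𝟙-no (d * d + size 1 c ≟ n) (λ e → d²≰n (≤-trans (m≤m+n (d * d) _) (≤-reflexive e))))))) (*-zeroʳ (2 ^ v)))) z≤n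
  ... | yes d²≤n = cases (d <? J₀) (s <? J₀)
    where
    s = n ∸ d * d
    d²+s : d * d + s ≡ n
    d²+s = m+[n∸m]≡n d²≤n
    s≤n : s ≤ n
    s≤n = m∸n≤m n (d * d)
    excluded : d < J₀ ⊎ s < J₀ → 2 ^ v * balanced-weight d ≤ 4 * weight d + 2 ^ v * X
    excluded small = ≤-trans (*-monoʳ-≤ (2 ^ v) (≤-trans (∑-mono (box d) (λ c → *-monoʳ-≤ (𝟙 (d * d + size 1 c ≟ n)) (balanced-ways≤ways c)))
      (≤-trans (≤-reflexive (weight≡G d s d²+s)) (crude d s (s≤s s≤n) small)))) (m≤n+m _ (4 * weight d))
    cases : Dec (d < J₀) → Dec (s < J₀) → 2 ^ v * balanced-weight d ≤ 4 * weight d + 2 ^ v * X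
    cases (yes p) _       = excluded (inj₁ p)
    cases (no _)  (yes p) = excluded (inj₂ p)
    cases (no p)  (no p') with bracket (λ k → 2 ^ (2 * k)) refl square-power-< s (≤-trans (1≤2^ j) (≮⇒≥ p'))
    ... | g , lo , hi = ≤-trans (≤-reflexive (cong (2 ^ v *_) (∑-cong (box d) (λ c → cong (_* balanced-ways c) (indicator d s (size 1 c) d²+s)))))
      (≤-trans (Typical.typical d s (≤-pred d<B) s≤n (≮⇒≥ p) (≮⇒≥ p') g lo hi) (≤-trans (≤-reflexive (cong (4 *_) (sym (weight≡G d s d²+s)))) (m≤m+n _ _)))

  -- The excluded d number at most B and cost 2^v · B · X ≤ X², at most the number of all codes: the
  -- fifth unit.
  balanced-codes : 2 ^ v * ∑ codes (λ x → 𝟙 (balanced? x)) ≤ 5 * length codes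
  balanced-codes = begin
    2 ^ v * ∑ codes (λ x → 𝟙 (balanced? x))       ≡⟨ cong (2 ^ v *_) (∑-codes (λ x → 𝟙 (balanced? x))) ⟩
    2 ^ v * ∑< B balanced-weight                  ≡⟨ sym (∑-*ˡ (upTo B) (2 ^ v) balanced-weight) ⟩
    ∑< B (λ d → 2 ^ v * balanced-weight d)        ≤⟨ ∑<-mono B each-d ⟩
    ∑< B (λ d → 4 * weight d + 2 ^ v * X)         ≡⟨ trans (∑-+ (upTo B) (λ d → 4 * weight d) (λ _ → 2 ^ v * X)) (cong₂ _+_ (∑-*ˡ (upTo B) 4 weight) (∑<-const B (2 ^ v * X))) ⟩
    4 * ∑< B weight + B * (2 ^ v * X)             ≤⟨ +-monoʳ-≤ (4 * ∑< B weight) (≤-trans (≤-reflexive (lem₁ B (2 ^ v) X)) (≤-trans (*-monoˡ-≤ X 2^vB≤X) many-codes)) ⟩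
    4 * ∑< B weight + ∑< B weight                 ≡⟨ lem₂ (∑< B weight) ⟩
    5 * ∑< B weight                               ≡⟨ cong (5 *_) (sym total) ⟩
    5 * length codes                              ∎
    where
    open ≤-Reasoning
    lem₁ : ∀ b a x → b * (a * x) ≡ a * b * x
    lem₁ = solve-∀
    lem₂ : ∀ w → 4 * w + w ≡ 5 * w
    lem₂ = solve-∀
    total : length codes ≡ ∑< B weight
    total = trans (sym (∑-length codes)) (trans (∑-codes (λ _ → 1)) (∑-cong (upTo B) (λ d → ∑-cong (box d) (λ c → cong (𝟙 (d * d + size 1 c ≟ n) *_) (trans (∑-cfgs-const c 1) (*-identityʳ _))))))

-- Elementary inequalities: the number of scales and the threshold for n

bernoulli : ∀ a m → a ^ m * (a + m) ≤ a * suc a ^ m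
bernoulli a zero    = ≤-reflexive (trans (*-identityˡ (a + 0)) (trans (+-identityʳ a) (sym (*-identityʳ a))))
bernoulli a (suc m) = begin
  a * a ^ m * (a + suc m)                          ≡⟨ lem₁ a (a ^ m) m ⟩
  a * (a ^ m * (a + m)) + a ^ m * a                ≤⟨ +-monoʳ-≤ (a * (a ^ m * (a + m))) (*-monoʳ-≤ (a ^ m) (m≤m+n a m)) ⟩
  a * (a ^ m * (a + m)) + a ^ m * (a + m)          ≡⟨ lem₂ a (a ^ m * (a + m)) ⟩
  suc a * (a ^ m * (a + m))                        ≤⟨ *-monoʳ-≤ (suc a) (bernoulli a m) ⟩
  suc a * (a * suc a ^ m)                          ≡⟨ lem₃ (suc a) a (suc a ^ m) ⟩
  a * (suc a * suc a ^ m)                          ∎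
  where
  open ≤-Reasoning
  lem₁ : ∀ a p m → a * p * (a + (1 + m)) ≡ a * (p * (a + m)) + p * a
  lem₁ = solve-∀
  lem₂ : ∀ a x → a * x + x ≡ (1 + a) * x
  lem₂ = solve-∀
  lem₃ : ∀ b a p → b * (a * p) ≡ a * (b * p)
  lem₃ = solve-∀

-- Bernoulli gives (1 + 1/a)^(a+1) ≥ 2. For a = 431 this is the reason for taking 432 v scales.
halving : ∀ a → 1 ≤ a → ∀ v → 2 ^ v * a ^ (suc a * v) ≤ suc a ^ (suc a * v)
halving a 1≤a v = subst₂ (λ x y → 2 ^ v * x ≤ y) (^-*-assoc a (suc a) v) (^-*-assoc (suc a) (suc a) v) (go v)
  where
  open ≤-Reasoning
  once : 2 * a ^ suc a ≤ suc a ^ suc a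
  once = *-cancelˡ-≤ a {{>-nonZero 1≤a}} (begin
    a * (2 * a ^ suc a)          ≡⟨ lem a (a ^ suc a) ⟩
    a ^ suc a * (a + a)          ≤⟨ *-monoʳ-≤ (a ^ suc a) (+-monoʳ-≤ a (n≤1+n a)) ⟩
    a ^ suc a * (a + suc a)      ≤⟨ bernoulli a (suc a) ⟩
    a * suc a ^ suc a            ∎)
    where
    lem : ∀ a p → a * (2 * p) ≡ p * (a + a)
    lem = solve-∀
  go : ∀ v → 2 ^ v * (a ^ suc a) ^ v ≤ (suc a ^ suc a) ^ v
  go zero    = ≤-refl
  go (suc v) = begin
    2 * 2 ^ v * (a ^ suc a * (a ^ suc a) ^ v)        ≡⟨ lem (2 ^ v) (a ^ suc a) ((a ^ suc a) ^ v) ⟩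
    2 * a ^ suc a * (2 ^ v * (a ^ suc a) ^ v)        ≤⟨ *-mono-≤ once (go v) ⟩
    suc a ^ suc a * (suc a ^ suc a) ^ v              ∎
    where
    lem : ∀ x y z → 2 * x * (y * z) ≡ 2 * y * (x * z)
    lem = solve-∀

linear≤exponential : ∀ c v → 2 * c + 2 ≤ v → c * suc v ≤ 2 ^ v
linear≤exponential c v le = begin
  c * suc v              ≤⟨ *-mono-≤ (<⇒≤ (n<2^n c)) (≤-trans v<2u (double u)) ⟩
  2 ^ c * 2 ^ u          ≡⟨ 2^-+ c u ⟩
  2 ^ (c + u)            ≡⟨ cong (2 ^_) c+u ⟩
  2 ^ v                  ∎
  where
  open ≤-Reasoning
  u = v ∸ c
  c+u : c + u ≡ v
  c+u = m+[n∸m]≡n (≤-trans (≤-trans (m≤n*m c 2) (m≤m+n (2 * c) 2)) le)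
  double : ∀ u → 2 * u ≤ 2 ^ u
  double zero    = z≤n
  double (suc u) = *-monoʳ-≤ 2 (n<2^n u)
  c<u : suc c ≤ u
  c<u = +-cancelˡ-≤ c _ _ (≤-trans (≤-trans (m≤m+n (c + suc c) 1) (≤-reflexive (lem c))) (≤-trans le (≤-reflexive (sym c+u))))
    where
    lem : ∀ c → c + (1 + c) + 1 ≡ 2 * c + 2
    lem = solve-∀
  v<2u : suc v ≤ 2 * u
  v<2u = ≤-trans (≤-reflexive (cong suc (sym c+u))) (≤-trans (+-monoˡ-≤ u c<u) (≤-reflexive (cong (u +_) (sym (+-identityʳ u)))))

-- With T = K v the demand is quadratic in v, whereas g₀ is about half of log₂ n ≥ 4^v.
threshold : ∀ K → ∃ λ V → ∀ v → V ≤ v → 2 * (2 * demand v (K * v) + α v + 1) + 1 ≤ 4 ^ v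
threshold K = 2 * c + 2 , λ v le → begin
  2 * (2 * demand v (K * v) + α v + 1) + 1         ≤⟨ m≤m+n _ _ ⟩
  -- The added polynomial completes the left side to c (v + 1)²; c is large enough for all its
  -- coefficients to be nonnegative.
  2 * (2 * demand v (K * v) + α v + 1) + 1 + ((752 * K + 193) * (v * v) + (944 * K + 350) * v + 944 * K)
                                                   ≡⟨ lem K v ⟩
  c * suc v * suc v                                ≤⟨ *-mono-≤ (linear≤exponential c v le) (n<2^n v) ⟩
  2 ^ v * 2 ^ v                                    ≡⟨ 2^-+ v v ⟩
  2 ^ (v + v)                                      ≡⟨ cong (λ u → 2 ^ (v + u)) (sym (+-identityʳ v)) ⟩
  2 ^ (2 * v)                                      ≡⟨ sym (^-*-assoc 2 2 v) ⟩
  4 ^ v                                            ∎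
  where
  open ≤-Reasoning
  c = 944 * K + 193
  lem : ∀ K v → 2 * (2 * (4 * (12 * v + 59) * (K * v) + (6 * v + 34) + (2 * v + 9)) + (2 * v + 9) + 1) + 1
    + ((752 * K + 193) * (v * v) + (944 * K + 350) * v + 944 * K) ≡ (944 * K + 193) * (1 + v) * (1 + v)
  lem = solve-∀

-- Abstract, so that the astronomically large threshold is never evaluated.
abstract
  V₀ : ℕ
  V₀ = proj₁ (threshold 432)

  beyond-V₀ : ∀ v → V₀ ≤ v → 2 * (2 * demand v (432 * v) + α v + 1) + 1 ≤ 4 ^ v
  beyond-V₀ = proj₂ (threshold 432)

theorem4 : Σ ℕ λ C → Σ ℕ λ N → ∀ n → N ≤ n → Even n →
    (gs : List (List ℕ)) → Unique gs → All (GraphicalPartition n) gs →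
    (ps : List (List ℕ)) → Unique ps → All (IsPartition n) ps →
    (∀ λs → IsPartition n λs → λs ∈ ps) →
    (length gs * length gs) * ⌊log₂ n ⌋ ≤ C * (length ps * length ps)
-- 100 = 4 · 5²: the 4 is lost between log₂ n and 4^v, and 5 is the constant of `balanced-codes`,
-- squared. The doubly exponential N guarantees v ≥ `V₀`.
theorem4 = 100 , 2 ^ (4 ^ V₀) , λ n N≤n _ gs uniq graphical ps _ _ complete → main n N≤n gs uniq graphical ps complete
  where
  main : ∀ n → 2 ^ (4 ^ V₀) ≤ n → (gs : List (List ℕ)) → Unique gs → All (GraphicalPartition n) gs →
    (ps : List (List ℕ)) → (∀ λs → IsPartition n λs → λs ∈ ps) →
    (length gs * length gs) * ⌊log₂ n ⌋ ≤ 100 * (length ps * length ps)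
  main n N≤n gs uniq graphical ps complete
    with 1≤n ← ≤-trans (1≤2^ (4 ^ V₀)) N≤n
    with ℓ , ℓlo , ℓhi ← bracket (2 ^_) refl (λ k → ^-monoʳ-< 2 (s≤s (s≤s z≤n)) (n<1+n k)) n 1≤n
    with V≤ℓ ← ≤-pred (exponent-< {4 ^ V₀} {suc ℓ} (≤-<-trans N≤n ℓhi))
    -- Rounding log₂ n down to a power of 4 makes 2^v equal to its square root up to a factor 2.
    with v , vlo , vhi ← bracket (4 ^_) refl (λ k → ^-monoʳ-< 4 (s≤s (s≤s z≤n)) (n<1+n k)) ℓ (≤-trans (m^n>0 4 V₀) V≤ℓ)
    with g₀ , glo , ghi ← bracket (λ k → 2 ^ (2 * k)) refl square-power-< n 1≤n
    = begin
    (a * a) * ⌊log₂ n ⌋                  ≤⟨ *-monoʳ-≤ (a * a) log≤ ⟩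
    (a * a) * 4 ^ suc v                  ≡⟨ cong (a * a *_) 4^≡ ⟩
    (a * a) * (4 * (2 ^ v * 2 ^ v))      ≡⟨ lem₁ a (2 ^ v) ⟩
    4 * ((2 ^ v * a) * (2 ^ v * a))      ≤⟨ *-monoʳ-≤ 4 (*-mono-≤ main-bound main-bound) ⟩
    4 * ((5 * p) * (5 * p))              ≡⟨ lem₂ p ⟩
    100 * (p * p)                        ∎
    where
    open ≤-Reasoning
    a = length gs
    p = length ps
    lem₁ : ∀ a t → (a * a) * (4 * (t * t)) ≡ 4 * ((t * a) * (t * a))
    lem₁ = solve-∀
    lem₂ : ∀ p → 4 * ((5 * p) * (5 * p)) ≡ 100 * (p * p)
    lem₂ = solve-∀
    4^≡ : 4 ^ suc v ≡ 4 * (2 ^ v * 2 ^ v)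
    4^≡ = cong (4 *_) (trans (^-*-assoc 2 2 v) (trans (cong (λ u → 2 ^ (v + u)) (+-identityʳ v)) (sym (2^-+ v v))))
    log≤ : ⌊log₂ n ⌋ ≤ 4 ^ suc v
    log≤ = ≤-trans (⌊log₂⌋-mono-≤ (<⇒≤ ℓhi)) (≤-trans (≤-reflexive (⌊log₂[2^n]⌋≡n (suc ℓ))) vhi)
    V₀≤v : V₀ ≤ v
    V₀≤v = ≤-pred (≰⇒> (λ v<V₀ → <⇒≱ (≤-<-trans V≤ℓ vhi) (^-monoʳ-≤ 4 v<V₀)))
    hB : suc n ≤ 2 ^ (2 ^ (2 * v + 2))
    hB = ≤-trans ℓhi (2^-mono (≤-trans vhi (≤-reflexive (trans (^-*-assoc 2 2 (suc v)) (cong (2 ^_) (trans (*-suc 2 v) (+-comm 2 (2 * v))))))))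
    hTv : 432 * v ≤ 2 ^ (v + 9)
    hTv = ≤-trans (*-mono-≤ (m≤m+n 432 80) (<⇒≤ (n<2^n v))) (≤-reflexive (trans (*-comm (2 ^ 9) (2 ^ v)) (2^-+ v 9)))
    hM : 2 * demand v (432 * v) + α v + 1 ≤ g₀
    hM = ≤-pred (*-cancelˡ-< 2 _ (suc g₀) (≤-<-trans (≤-trans (m≤m+n _ 1) (≤-trans (beyond-V₀ v V₀≤v) vlo)) (exponent-< {ℓ} {2 * suc g₀} (≤-<-trans ℓlo ghi))))
    main-bound : 2 ^ v * a ≤ 5 * p
    main-bound = begin
      2 ^ v * a                                                 ≤⟨ *-monoʳ-≤ (2 ^ v) (Codes.graphical≤balanced n gs uniq graphical) ⟩
      2 ^ v * ∑ (Codes.codes n) (λ x → 𝟙 (balanced? x))         ≤⟨ Assembly.balanced-codes n v g₀ (432 * v) hB glo ghi hTv (halving 431 (s≤s z≤n) v) hM ⟩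
      5 * length (Codes.codes n)                                ≤⟨ *-monoʳ-≤ 5 (Codes.codes≤partitions n ps complete) ⟩
      5 * p                                                     ∎
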